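{- Let $k_1,k_2,k_3\in\mathbb{Z}_{\ge0}$. Each matrix $M_{p/q}$ ($p/q\in\mathbb{Q}\cap[0,\infty)$ or $p/q=1/0$) is a $(k_1,k_2,k_3)$-CMM matrix, and for each vertex $(\frac pq,\frac{p+r}{q+s},\frac rs)$ of the Farey tree, $(M_{p/q},M_{(p+r)/(q+s)},M_{r/s})$ is a $(k_1,k_2,k_3)$-CMM triple.
   Context: Indeterminates $x_1,x_2,x_3$; $\mathbf{x}^{(v_1,v_2,v_3)}=x_1^{v_1}x_2^{v_2}x_3^{v_3}$; $\widehat{x_1}=x_2/x_3$, $\widehat{x_2}=x_3/x_1$, $\widehat{x_3}=x_1/x_2$; $\mathscr{M}=\frac{x_1^2+x_2^2+x_3^2+k_1x_2x_3+k_2x_1x_3+k_3x_1x_2}{x_1x_2x_3}$, $T=\begin{bmatrix}-1&0\\ \mathscr{M}&-1\end{bmatrix}$. Cluster structure: mutations $\mu_1(a,b,c)=(\frac{b^2+k_1bc+c^2}{a},b,c)$, $\mu_2(a,b,c)=(a,\frac{a^2+k_2ac+c^2}{b},c)$, $\mu_3(a,b,c)=(a,b,\frac{a^2+k_3ab+b^2}{c})$; labeled clusters: triples obtained from $(x_1,x_2,x_3)$ by finitely many mutations; non-labeled clusters: their permutations; cluster variables: their entries; a cluster variable $y$ occurs in a unique position $i$ and has parity $k_y:=k_i$. A CMM matrix is $X\in SL(2,\mathbb{Z}[x_1^{\pm1},x_2^{\pm1},x_3^{\pm1}])$ whose $(1,2)$-entry $x_{12}$ is a cluster variable with $\mathrm{tr}X=-k_{x_{12}}$;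 a CMM triple is a triple $(X,Y,Z)$ of CMM matrices with $XYZ=T$ and $(x_{12},y_{12},z_{12})$ a non-labeled cluster. Farey tree: root $(\frac01,\frac11,\frac10)$; vertex $(\frac ab,\frac cd,\frac ef)$ has children $(\frac ab,\frac{a+c}{b+d},\frac cd)$ and $(\frac cd,\frac{c+e}{d+f},\frac ef)$. Posets: fence posets with chronological ordering $\mathcal{P}(1),\dots,\mathcal{P}(h)$ (consecutive elements comparable, order = transitive closure), $L=\mathcal{P}(1)$, $R=\mathcal{P}(h)$; $\mathcal{W}(\mathcal{P})=\sum_I\prod_{x\in I}\mathrm{wt}(x)$ over order ideals $I$; $\mathcal{W}(\mathcal{P};\neg L)$, $\mathcal{W}(\mathcal{P};\neg R)$, $\mathcal{W}(\mathcal{P};\neg L,\neg R)$ restrict to ideals avoiding the indicated elements. For coprime $p,q>0$, $\mathcal{P}_{p/q}$: $\Lambda$ = lattice segments $(m,n)$–$(m+1,n)$ (label $x_3$), $(m,n)$–$(m,n+1)$ (label $x_2$), $(m,n+1)$–$(m+1,n)$ (label $x_1$); $\gamma$ from $(0,0)$ to $(q,p)$ crosses $\tau_1,\dots,\tau_m\in\Lambda$ away from its endpoints, in order; left/right w.r.t. direction of travel. For $\tau_j$ labeled $x_a$: one element of weight $\widehat{x_a}^2$ if $k_a=0$, else two consecutive elements, the first greater iff $\gamma$ crosses $\tau_j$ strictly closer to its right endpoint, the smaller weighted $k_a\widehat{x_a}$, the larger $\widehat{x_a}/k_a$; between the last element of $\tau_j$'s group and the first of $\tau_{j+1}$'s group,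 the former is greater iff their shared endpoint lies right of $\gamma$. $\mathbf{g}_{p/q}=(q-p-1,1-q,p+1)^\top$, $\mathbf{g}^\circ_{p/q}=(q-p,-q,p)^\top$. Matrices: $M_{0/1}=\begin{bmatrix}\frac{x_1}{x_2}&x_3\\-\frac{x_1^2}{x_2^2x_3}\left(1+k_3\frac{x_2}{x_1}+\frac{x_2^2}{x_1^2}\right)&-\frac{x_1}{x_2}-k_3\end{bmatrix}$, $M_{1/0}=\begin{bmatrix}-k_2&x_2\\-\frac1{x_2}&0\end{bmatrix}$, and for $p/q\in\mathbb{Q}\cap(0,\infty)$, $M_{p/q}=\begin{bmatrix}\mathbf{x}^{\mathbf{g}^\circ_{p/q}}\mathcal{W}(\mathcal{P}_{p/q};\neg L)&\mathbf{x}^{\mathbf{g}_{p/q}}\mathcal{W}(\mathcal{P}_{p/q})\\-\mathbf{x}^{2\mathbf{g}^\circ_{p/q}-\mathbf{g}_{p/q}}\mathcal{W}(\mathcal{P}_{p/q};\neg L,\neg R)&-\mathbf{x}^{\mathbf{g}^\circ_{p/q}}\mathcal{W}(\mathcal{P}_{p/q};\neg R)\end{bmatrix}$. -}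

module Defs where

open import Data.Bool using (Bool; true; false; _∧_; _∨_; not; if_then_else_)
open import Data.Nat as ℕ using (ℕ; zero; suc)
open import Data.Integer as ℤ using (ℤ; +_; -[1+_])
open import Data.Rational as ℚ using (ℚ; 0ℚ; 1ℚ)
import Data.Rational.Properties as ℚP
import Data.Integer.Properties as ℤP
open import Data.Product using (_×_; _,_; proj₁; proj₂; Σ; ∃)
open import Data.Product.Properties using (≡-dec)
open import Data.List using (List; []; _∷_; _++_; map; concatMap; foldr; upTo; length)
open import Data.Maybe using (Maybe; just; nothing)
open import Relation.Nullary.Decidable using (does; ⌊_⌋)
open import Relation.Binary.PropositionalEquality using (_≡_)

-- Laurent polynomials in x₁,x₂,x₃ with rational coefficients.
-- A Laurent polynomial is a finite formal sum of terms c·x^e, represented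
-- by a list of (coefficient, exponent vector); two representations are
-- equal (≈) iff every monomial has the same total coefficient.

Exp : Set
Exp = ℤ × ℤ × ℤ

_≟ᵉ_ : (e f : Exp) → _
_≟ᵉ_ = ≡-dec ℤ._≟_ (≡-dec ℤ._≟_ ℤ._≟_)

_+ᵉ_ : Exp → Exp → Exp
(a , b , c) +ᵉ (a' , b' , c') = (a ℤ.+ a' , b ℤ.+ b' , c ℤ.+ c')

_-ᵉ_ : Exp → Exp → Exp
(a , b , c) -ᵉ (a' , b' , c') = (a ℤ.- a' , b ℤ.- b' , c ℤ.- c')

0ᵉ : Exp
0ᵉ = (+ 0 , + 0 , + 0)

LP : Set
LP = List (ℚ × Exp)

coeff : LP → Exp → ℚ
coeff [] e = 0ℚ
coeff ((c , f) ∷ p) e = if does (f ≟ᵉ e) then c ℚ.+ coeff p e else coeff p e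

infix 4 _≈_
_≈_ : LP → LP → Set
p ≈ q = ∀ e → coeff p e ≡ coeff q e

infixl 6 _⊕_ _⊖_
infixl 7 _⊗_

_⊕_ : LP → LP → LP
p ⊕ q = p ++ q

⊝_ : LP → LP
⊝ p = map (λ { (c , e) → (ℚ.- c , e) }) p

_⊖_ : LP → LP → LP
p ⊖ q = p ⊕ (⊝ q)

_⊗_ : LP → LP → LP
p ⊗ q = concatMap (λ { (c , e) → map (λ { (d , f) → (c ℚ.* d , e +ᵉ f) }) q }) p

cst : ℚ → LP
cst c = (c , 0ᵉ) ∷ []

𝟘 𝟙 : LP
𝟘 = []
𝟙 = cst 1ℚ

ℕ→ℚ : ℕ → ℚ
ℕ→ℚ n = + n ℚ./ 1

ℤ→ℚ : ℤ → ℚ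
ℤ→ℚ z = z ℚ./ 1

term : ℚ → Exp → LP
term c e = (c , e) ∷ []

𝐱^ : Exp → LP
𝐱^ e = term 1ℚ e

x₁ x₂ x₃ : LP
x₁ = 𝐱^ (+ 1 , + 0 , + 0)
x₂ = 𝐱^ (+ 0 , + 1 , + 0)
x₃ = 𝐱^ (+ 0 , + 0 , + 1)

IntegerLaurent : LP → Set
IntegerLaurent p = ∀ e → ∃ λ (z : ℤ) → coeff p e ≡ ℤ→ℚ z

Mat : Set
Mat = LP × LP × LP × LP

e₁₁ e₁₂ e₂₁ e₂₂ : Mat → LP
e₁₁ (a , b , c , d) = a
e₁₂ (a , b , c , d) = b
e₂₁ (a , b , c , d) = c
e₂₂ (a , b , c , d) = d

infixl 7 _·ᴹ_
_·ᴹ_ : Mat → Mat → Mat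
(a , b , c , d) ·ᴹ (a' , b' , c' , d') =
  (a ⊗ a' ⊕ b ⊗ c' , a ⊗ b' ⊕ b ⊗ d' , c ⊗ a' ⊕ d ⊗ c' , c ⊗ b' ⊕ d ⊗ d')

infix 4 _≈ᴹ_
_≈ᴹ_ : Mat → Mat → Set
(a , b , c , d) ≈ᴹ (a' , b' , c' , d') = (a ≈ a') × (b ≈ b') × (c ≈ c') × (d ≈ d')

det tr : Mat → LP
det (a , b , c , d) = a ⊗ d ⊖ b ⊗ c
tr (a , b , c , d) = a ⊕ d

InSL2 : Mat → Set
InSL2 (a , b , c , d) =
  IntegerLaurent a × IntegerLaurent b × IntegerLaurent c × IntegerLaurent d ×
  (det (a , b , c , d) ≈ 𝟙)

data Pos : Set where
  ①' ②' ③' : Pos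

Triple : Set
Triple = LP × LP × LP

component : Pos → Triple → LP
component ①' (a , b , c) = a
component ②' (a , b , c) = b
component ③' (a , b , c) = c

data IsPermOf : Triple → Triple → Set where
  p123 : ∀ {a b c} → IsPermOf (a , b , c) (a , b , c)
  p132 : ∀ {a b c} → IsPermOf (a , c , b) (a , b , c)
  p213 : ∀ {a b c} → IsPermOf (b , a , c) (a , b , c)
  p231 : ∀ {a b c} → IsPermOf (b , c , a) (a , b , c)
  p312 : ∀ {a b c} → IsPermOf (c , a , b) (a , b , c)
  p321 : ∀ {a b c} → IsPermOf (c , b , a) (a , b , c)

_≈³_ : Triple → Triple → Set
(a , b , c) ≈³ (a' , b' , c') = (a ≈ a') × (b ≈ b') × (c ≈ c')

module _ (k₁ k₂ k₃ : ℕ) where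

  kOf : Pos → ℕ
  kOf ①' = k₁
  kOf ②' = k₂
  kOf ③' = k₃

  kq : Pos → ℚ
  kq i = ℕ→ℚ (kOf i)

  -- Labeled clusters.  Mutation μᵢ replaces the i-th entry y by y' with
  -- y·y' = (quadratic expression in the other two entries), i.e.
  -- y' = (…)/y; this is stated multiplicatively inside the Laurent ring.
  data LabeledCluster : Triple → Set where
    initial : LabeledCluster (x₁ , x₂ , x₃)
    μ₁ : ∀ {a b c a'} → LabeledCluster (a , b , c) →
         a ⊗ a' ≈ b ⊗ b ⊕ cst (kq ①') ⊗ b ⊗ c ⊕ c ⊗ c →
         LabeledCluster (a' , b , c)
    μ₂ : ∀ {a b c b'} → LabeledCluster (a , b , c) →
         b ⊗ b' ≈ a ⊗ a ⊕ cst (kq ②') ⊗ a ⊗ c ⊕ c ⊗ c →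
         LabeledCluster (a , b' , c)
    μ₃ : ∀ {a b c c'} → LabeledCluster (a , b , c) →
         c ⊗ c' ≈ a ⊗ a ⊕ cst (kq ③') ⊗ a ⊗ b ⊕ b ⊗ b →
         LabeledCluster (a , b , c')

  NonLabeledCluster : Triple → Set
  NonLabeledCluster t = Σ Triple λ s → LabeledCluster s × Σ Triple λ u → IsPermOf u s × (t ≈³ u)

  OccursAt : LP → Pos → Set
  OccursAt y i = Σ Triple λ s → LabeledCluster s × (y ≈ component i s)

  ClusterVariable : LP → Set
  ClusterVariable y = Σ Pos λ i → OccursAt y i

  -- CMM matrix: X ∈ SL(2,ℤ[x^±]), x₁₂ a cluster variable, tr X = -k_{x₁₂}
  -- (k_{x₁₂} = k_i for the position i in which x₁₂ occurs)
  CMM : Mat → Set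
  CMM X = InSL2 X × ClusterVariable (e₁₂ X) ×
          (∀ i → OccursAt (e₁₂ X) i → tr X ≈ cst (ℚ.- kq i))

  𝓜 : LP
  𝓜 = 𝐱^ (+ 1 , ℤ.- + 1 , ℤ.- + 1) ⊕ 𝐱^ (ℤ.- + 1 , + 1 , ℤ.- + 1) ⊕ 𝐱^ (ℤ.- + 1 , ℤ.- + 1 , + 1)
      ⊕ term (kq ①') (ℤ.- + 1 , + 0 , + 0) ⊕ term (kq ②') (+ 0 , ℤ.- + 1 , + 0)
      ⊕ term (kq ③') (+ 0 , + 0 , ℤ.- + 1)

  T : Mat
  T = (cst (ℚ.- 1ℚ) , 𝟘 , 𝓜 , cst (ℚ.- 1ℚ))

  CMMTriple : Mat → Mat → Mat → Set
  CMMTriple X Y Z = CMM X × CMM Y × CMM Z × (X ·ᴹ Y ·ᴹ Z ≈ᴹ T) ×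
                    NonLabeledCluster (e₁₂ X , e₁₂ Y , e₁₂ Z)

Pt : Set
Pt = ℤ × ℤ

record Seg : Set where
  constructor seg
  field
    lbl : Pos
    A B : Pt

-- the segments of Λ with lower-left corner (m,n)
segsAt : ℤ → ℤ → List Seg
segsAt m n =
  seg ③' (m , n) (m ℤ.+ + 1 , n) ∷
  seg ②' (m , n) (m , n ℤ.+ + 1) ∷
  seg ①' (m , n ℤ.+ + 1) (m ℤ.+ + 1 , n) ∷ []

range : ℕ → List ℤ
range N = -[1+ 0 ] ∷ map +_ (upTo (suc N))

-- every segment of Λ meeting the open box (0,q)×(0,p) has its lower-left
-- corner in [-1,q]×[-1,p]; these are the only candidates for crossings
candidates : ℕ → ℕ → List Seg
candidates p q = concatMap (λ m → concatMap (λ n → segsAt m n) (range p)) (range q)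

cross : Pt → Pt → ℤ
cross (a , b) (c , d) = a ℤ.* d ℤ.- b ℤ.* c

_-ᵖ_ : Pt → Pt → Pt
(a , b) -ᵖ (c , d) = (a ℤ.- c , b ℤ.- d)

_÷ℤ_ : ℤ → ℤ → Maybe ℚ
n ÷ℤ (+ zero) = nothing
n ÷ℤ (+ suc d) = just (n ℚ./ suc d)
n ÷ℤ (-[1+ d ]) = just ((ℤ.- n) ℚ./ suc d)

record Crossing : Set where
  constructor crossing
  field
    τ  : Seg
    t  : ℚ          -- γ(t) = (t q , t p) is the crossing point
    Cx Cy : ℚ

-- intersection of γ (the segment from (0,0) to (q,p)) with a segment τ,
-- if it lies in the open part of γ (away from its endpoints):
-- γ(t) = A + λ(B - A) with 0 ≤ λ ≤ 1 and 0 < t < 1.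
intersect : ℕ → ℕ → Seg → Maybe Crossing
intersect p q τ with Seg.A τ | (Seg.B τ -ᵖ Seg.A τ)
... | (ax , ay) | (dx , dy) with cross (ax , ay) (dx , dy) ÷ℤ cross (+ q , + p) (dx , dy)
                               | cross (ax , ay) (+ q , + p) ÷ℤ cross (+ q , + p) (dx , dy)
... | just t | just λ' =
  if ⌊ 0ℚ ℚP.<? t ⌋ ∧ ⌊ t ℚP.<? 1ℚ ⌋ ∧ ⌊ 0ℚ ℚP.≤? λ' ⌋ ∧ ⌊ λ' ℚP.≤? 1ℚ ⌋
  then just (crossing τ t (t ℚ.* ℕ→ℚ q) (t ℚ.* ℕ→ℚ p))
  else nothing
... | _ | _ = nothing

collect : ∀ {X : Set} → List (Maybe X) → List X
collect [] = []
collect (just x ∷ xs) = x ∷ collect xs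
collect (nothing ∷ xs) = collect xs

insertC : Crossing → List Crossing → List Crossing
insertC c [] = c ∷ []
insertC c (d ∷ ds) = if ⌊ Crossing.t c ℚP.≤? Crossing.t d ⌋ then c ∷ d ∷ ds else d ∷ insertC c ds

sortC : List Crossing → List Crossing
sortC = foldr insertC []

crossings : ℕ → ℕ → List Crossing
crossings p q = sortC (collect (map (intersect p q) (candidates p q)))

rightOf : ℕ → ℕ → Pt → Bool
rightOf p q P = ⌊ cross (+ q , + p) P ℤP.<? + 0 ⌋

rightEnd leftEnd : ℕ → ℕ → Seg → Pt
rightEnd p q τ = if rightOf p q (Seg.A τ) then Seg.A τ else Seg.B τ
leftEnd  p q τ = if rightOf p q (Seg.A τ) then Seg.B τ else Seg.A τ

dist² : ℚ → ℚ → Pt → ℚ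
dist² cx cy (a , b) = (cx ℚ.- ℤ→ℚ a) ℚ.* (cx ℚ.- ℤ→ℚ a) ℚ.+ (cy ℚ.- ℤ→ℚ b) ℚ.* (cy ℚ.- ℤ→ℚ b)

closerToRight : ℕ → ℕ → Crossing → Bool
closerToRight p q (crossing τ t cx cy) =
  ⌊ dist² cx cy (rightEnd p q τ) ℚP.<? dist² cx cy (leftEnd p q τ) ⌋

_==ᵖ_ : Pt → Pt → Bool
(a , b) ==ᵖ (c , d) = ⌊ a ℤ.≟ c ⌋ ∧ ⌊ b ℤ.≟ d ⌋

sharedEnd : Seg → Seg → Pt
sharedEnd σ τ = if (Seg.A σ ==ᵖ Seg.A τ) ∨ (Seg.A σ ==ᵖ Seg.B τ) then Seg.A σ else Seg.B σ

-- Fence posets: elements P(1),…,P(h) with weights, and for each i < h a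
-- Boolean saying whether P(i) > P(i+1) (true) or P(i) < P(i+1) (false).

record Fence : Set where
  constructor fence
  field
    wts  : List LP
    rels : List Bool   -- length = length wts - 1

-- x̂₁ = x₂/x₃, x̂₂ = x₃/x₁, x̂₃ = x₁/x₂ (exponent vectors)
hatᵉ : Pos → Exp
hatᵉ ①' = (+ 0 , + 1 , ℤ.- + 1)
hatᵉ ②' = (ℤ.- + 1 , + 0 , + 1)
hatᵉ ③' = (+ 1 , ℤ.- + 1 , + 0)

module _ (k₁ k₂ k₃ : ℕ) where

  group : ℕ → ℕ → Crossing → Fence
  group p q c with kOf k₁ k₂ k₃ (Seg.lbl (Crossing.τ c))
  ... | zero = fence (term 1ℚ (hatᵉ a +ᵉ hatᵉ a) ∷ []) []
    where a = Seg.lbl (Crossing.τ c)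
  ... | suc k' =
    if closerToRight p q c
    then fence (larger ∷ smaller ∷ []) (true ∷ [])
    else fence (smaller ∷ larger ∷ []) (false ∷ [])
    where
      a = Seg.lbl (Crossing.τ c)
      smaller = term (ℕ→ℚ (suc k')) (hatᵉ a)
      larger  = term (+ 1 ℚ./ suc k') (hatᵉ a)

  fenceOf : ℕ → ℕ → List Crossing → Fence
  fenceOf p q [] = fence [] []
  fenceOf p q (c ∷ []) = group p q c
  fenceOf p q (c ∷ d ∷ cs) with group p q c | fenceOf p q (d ∷ cs)
  ... | fence w₁ r₁ | fence w₂ r₂ =
    fence (w₁ ++ w₂) (r₁ ++ (rightOf p q (sharedEnd (Crossing.τ c) (Crossing.τ d)) ∷ r₂))

  𝒫 : ℕ → ℕ → Fence
  𝒫 p q = fenceOf p q (crossings p q)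

subsets : ℕ → List (List Bool)
subsets zero = [] ∷ []
subsets (suc h) = concatMap (λ s → (true ∷ s) ∷ (false ∷ s) ∷ []) (subsets h)

_⇒ᵇ_ : Bool → Bool → Bool
a ⇒ᵇ b = not a ∨ b

-- I is an order ideal: if P(i) > P(i+1) then P(i) ∈ I ⇒ P(i+1) ∈ I, and
-- if P(i) < P(i+1) then P(i+1) ∈ I ⇒ P(i) ∈ I (the order is the
-- transitive closure of these covering relations).
isIdeal : List Bool → List Bool → Bool
isIdeal (s ∷ s' ∷ ss) (g ∷ gs) =
  (if g then s ⇒ᵇ s' else s' ⇒ᵇ s) ∧ isIdeal (s' ∷ ss) gs
isIdeal _ _ = true

headFalse lastFalse : List Bool → Bool
headFalse [] = true
headFalse (b ∷ _) = not b
lastFalse [] = true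
lastFalse (b ∷ []) = not b
lastFalse (_ ∷ b ∷ bs) = lastFalse (b ∷ bs)

weightOf : List LP → List Bool → LP
weightOf (w ∷ ws) (true ∷ ss) = w ⊗ weightOf ws ss
weightOf (w ∷ ws) (false ∷ ss) = weightOf ws ss
weightOf _ _ = 𝟙

Wwith : (List Bool → Bool) → Fence → LP
Wwith extra (fence ws rs) =
  foldr (λ s acc → if isIdeal s rs ∧ extra s then weightOf ws s ⊕ acc else acc)
        𝟘 (subsets (length ws))

𝒲 𝒲¬L 𝒲¬R 𝒲¬L¬R : Fence → LP
𝒲 = Wwith (λ _ → true)
𝒲¬L = Wwith headFalse
𝒲¬R = Wwith lastFalse
𝒲¬L¬R = Wwith (λ s → headFalse s ∧ lastFalse s)

module _ (k₁ k₂ k₃ : ℕ) where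

  𝐠 𝐠° : ℕ → ℕ → Exp
  𝐠  p q = (+ q ℤ.- + p ℤ.- + 1 , + 1 ℤ.- + q , + p ℤ.+ + 1)
  𝐠° p q = (+ q ℤ.- + p , ℤ.- + q , + p)

  M0/1 : Mat
  M0/1 = ( 𝐱^ (+ 1 , ℤ.- + 1 , + 0)
         , x₃
         , ⊝ (𝐱^ (+ 2 , ℤ.- + 2 , ℤ.- + 1)
              ⊗ (𝟙 ⊕ cst (ℕ→ℚ k₃) ⊗ 𝐱^ (ℤ.- + 1 , + 1 , + 0) ⊕ 𝐱^ (ℤ.- + 2 , + 2 , + 0)))
         , ⊝ 𝐱^ (+ 1 , ℤ.- + 1 , + 0) ⊖ cst (ℕ→ℚ k₃) )

  M1/0 : Mat
  M1/0 = (cst (ℚ.- ℕ→ℚ k₂) , x₂ , ⊝ 𝐱^ (+ 0 , ℤ.- + 1 , + 0) , 𝟘)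

  Mgen : ℕ → ℕ → Mat
  Mgen p q =
    ( 𝐱^ (𝐠° p q) ⊗ 𝒲¬L P
    , 𝐱^ (𝐠 p q) ⊗ 𝒲 P
    , ⊝ (𝐱^ ((𝐠° p q +ᵉ 𝐠° p q) -ᵉ 𝐠 p q) ⊗ 𝒲¬L¬R P)
    , ⊝ (𝐱^ (𝐠° p q) ⊗ 𝒲¬R P) )
    where P = 𝒫 k₁ k₂ k₃ p q

  -- M_{p/q} for a fraction p/q in lowest terms (p/q ∈ ℚ ∩ [0,∞) or 1/0);
  -- the value at 0/0 is irrelevant (0 and 0 are not coprime).
  M : ℕ → ℕ → Mat
  M zero zero = M1/0
  M (suc _) zero = M1/0
  M zero (suc _) = M0/1
  M (suc p) (suc q) = Mgen (suc p) (suc q)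

-- The Farey tree: vertices (a/b, c/d, e/f) given as numerator/denominator pairs

data FareyVertex : ℕ → ℕ → ℕ → ℕ → ℕ → ℕ → Set where
  root  : FareyVertex 0 1 1 1 1 0
  left  : ∀ {a b c d e f} → FareyVertex a b c d e f →
          FareyVertex a b (a ℕ.+ c) (b ℕ.+ d) c d
  right : ∀ {a b c d e f} → FareyVertex a b c d e f →
          FareyVertex c d (c ℕ.+ e) (d ℕ.+ f) e f

{-# OPTIONS --safe #-}
module Submission where

-- Counting order ideals of 𝒫_{p/q} by transfer matrices turns M_{p/q} into a product Ω over the
-- segments crossed by the line γ, in which a crossing depends only on the side of γ on which the
-- midpoint of the segment lies.  The half-turn about the midpoint of γ shows that moving that
-- midpoint to the other side of γ transposes Ω, that is, inverts M_{p/q} up to sign.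
--
-- Let p/q < r/s be Farey neighbours.  The triangle (0,0), (s,r), (q+s,p+r) contains no further
-- lattice point, and its only other half-lattice points are the midpoints of its edges.  So the line to
-- the mediant crosses the same segments, on the same side of their midpoints, as the line to
-- (s,r) followed by a turn around (s,r) and the line from there, with the midpoints of both lines
-- moved to the other side.  The turn is conjugate to T, hence M_{(p+r)/(q+s)} = M_{p/q}⁻¹ T M_{r/s}⁻¹.
--
-- Descending the Farey tree therefore conjugates matrices: (X,Y,Z) has the children (X, YZY⁻¹, Y)
-- and (Y, Y⁻¹XY, Z).  This preserves determinants and traces, and the (1,2)-entries mutate.
--
-- A cluster variable determines its position because its leading exponent modulo 2 does: in
-- y y′ = b² + k b c + c² the leading exponent of the right-hand side is even.

-- What breaks the symmetry under the half-turn is a tie. The midpoint of γ is also the midpoint of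
-- a crossed segment; "strictly closer to the right endpoint" counts it as right of γ, and the
-- half-turn makes it count as left. Hence the two predicates `isLeft` and `isLeft≤`, which differ
-- only on the line itself. Along the line to the mediant the ties of both shorter lines are decided
-- the second way, so both parts enter transposed; transposing the whole restores them, with p/q in
-- front.
--
-- No fence belongs to 0/1 and 1/0. The matrices `Ω₀₁` and `Ω₁₀` are inverses of pieces of the turn,
-- so that the product formula for mediants holds on the boundary of the tree as well.
--
-- Integrality is not visible in the sums over ideals, whose weights involve 1/k. It is passed down
-- the tree by the product formula, which contains only adjugates and T.
--
-- Leading exponents can be followed through mutations because k ≥ 0 keeps leading coefficients
-- positive: nothing cancels in b² + k b c + c².

open import Algebra.Bundles using (CommutativeRing)
import Algebra.Solver.Ring
open import Algebra.Solver.Ring.AlmostCommutativeRing using (fromCommutativeRing; _-Raw-AlmostCommutative⟶_)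
open import Algebra.Structures using (IsCommutativeRing)
open import Data.Bool using (Bool; true; false; if_then_else_; not; _∧_; _∨_)
import Data.Bool.Properties as BoolP
import Data.Nat
open import Data.Nat as ℕ using (ℕ; zero; suc; z≤n; s≤s)
open import Data.Nat.Coprimality using (Coprime)
open import Data.Nat.Divisibility using (_∣_; divides; ∣⇒≤; ∣m+n∣m⇒∣n; ∣m∣n⇒∣m+n; ∣n⇒∣m*n; m∣m*n)
import Data.Nat.Properties as ℕP
open import Data.Nat.Tactic.RingSolver using () renaming (solve to solveℕ)
open import Data.Integer as ℤ using (ℤ; +_; -[1+_])
import Data.Integer.Properties as ℤP
open import Data.Integer.Solver using () renaming (module +-*-Solver to ℤSolver)
open import Data.Rational as ℚ using (ℚ; 0ℚ; 1ℚ)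
import Data.Rational.Properties as ℚP
open import Data.Rational.Solver using () renaming (module +-*-Solver to ℚSolver)
import Data.Rational.Unnormalised as ℚᵘ
import Data.Rational.Unnormalised.Properties as ℚᵘP
open import Data.List using (List; []; _∷_; _++_; map; concatMap; foldr; length)
import Data.List.Properties as ListP
open import Data.List.Membership.Propositional using (_∈_; find; lose)
open import Data.List.Membership.Propositional.Properties using (∈-concatMap⁺; ∈-concatMap⁻; ∈-map⁺; ∈-map⁻; ∈-upTo⁺)
open import Data.List.Relation.Binary.Disjoint.Propositional using (Disjoint)
open import Data.List.Relation.Unary.All as All using (All)
import Data.List.Relation.Unary.All.Properties as AllP
open import Data.List.Relation.Unary.AllPairs as AllPairs using (AllPairs)
import Data.List.Relation.Unary.AllPairs.Properties as AllPairsP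
open import Data.List.Relation.Unary.Any using (here; there)
open import Data.List.Relation.Unary.Linked as Linked using (Linked; [-])
open import Data.List.Relation.Unary.Linked.Properties using (Linked⇒AllPairs)
open import Data.List.Relation.Unary.Unique.Propositional using (Unique)
import Data.List.Relation.Unary.Unique.Propositional.Properties as UniqueP
open import Data.Maybe using (Maybe; just; nothing)
open import Data.Product using (_×_; _,_; proj₁; proj₂; ∃; ∃₂)
open import Data.Sum using (_⊎_; inj₁; inj₂)
open import Function.Bundles using (_⇔_; mk⇔; Equivalence)
open import Level using (0ℓ)
open import Relation.Binary.Bundles using (Setoid)
open import Relation.Binary.Definitions using (tri<; tri≈; tri>)
open import Relation.Binary.PropositionalEquality using (_≡_; _≢_; refl; sym; trans; cong; cong₂; subst; subst₂; module ≡-Reasoning)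
import Relation.Binary.Reasoning.Setoid
open import Relation.Nullary using (Dec; yes; no; ¬_; does)
open import Relation.Nullary.Decidable using (⌊_⌋; isYes≗does; dec-true; dec-false; does-⇔; ¬?)
open import Relation.Nullary.Negation using (contradiction)

-- Walks along a line of rational slope

module Walks where

  open Data.Nat using (_≤_; _<_; _+_; _*_)

  -- A linear consequence is checked by one semiring identity.
  lin≤ : ∀ {a b x y} → a ≤ b → x + b ≡ a + y → x ≤ y
  lin≤ {a} {b} {x} {y} a≤b eq = ℕP.+-cancelʳ-≤ b x y (begin
    x + b ≡⟨ eq ⟩
    a + y ≤⟨ ℕP.+-monoˡ-≤ y a≤b ⟩
    b + y ≡⟨ ℕP.+-comm b y ⟩
    y + b ∎)
    where open ℕP.≤-Reasoning

  scale≤ : ∀ n {a b} → a ≤ b → n * a ≤ n * b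
  scale≤ n = ℕP.*-monoʳ-≤ n

  infixl 6 _⊞_
  _⊞_ : ∀ {a b c d} → a ≤ b → c ≤ d → a + c ≤ b + d
  _⊞_ = ℕP.+-mono-≤

  -- The point (x , y) lies to the left of the line through (0 , 0) and (q , p); points on the
  -- line count as left for isLeft≤ only.
  isLeft isLeft≤ : ℕ → ℕ → ℕ → ℕ → Bool
  isLeft  p q x y = does (p * x ℕ.<? q * y)
  isLeft≤ p q x y = does (p * x ℕ.≤? q * y)

  -- The vectors (q , p) and (s , r) form a basis of the lattice, in which (x , y) has the
  -- coordinates α = r x - s y and β = q y - p x. The identity is x + y = α (p + q) + β (r + s) with
  -- the negative terms moved across.
  bezout-height : ∀ p q r s x y → r * q ≡ 1 + p * s →
    (r + s) * (q * y) + (p + q) * (r * x) ≡ (x + y) + (r + s) * (p * x) + (p + q) * (s * y)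
  bezout-height p q r s x y bez = begin
    (r + s) * (q * y) + (p + q) * (r * x)                      ≡⟨ solveℕ (p ∷ q ∷ r ∷ s ∷ x ∷ y ∷ []) ⟩
    (x + y) * (r * q) + s * (q * y) + p * (r * x)              ≡⟨ cong (λ z → (x + y) * z + s * (q * y) + p * (r * x)) bez ⟩
    (x + y) * (1 + p * s) + s * (q * y) + p * (r * x)          ≡⟨ solveℕ (p ∷ q ∷ r ∷ s ∷ x ∷ y ∷ []) ⟩
    (x + y) + (r + s) * (p * x) + (p + q) * (s * y) ∎
    where open ≡-Reasoning

  -- In the coordinates of `bezout-height` the two conditions are α < β and α ≤ 0. If α < β with α ≥
  -- 1, then β ≥ 2 and x + y exceeds 2 (r + s); if α ≤ 0, then x + y > 0 forces β > 0.
  left-concat₁ : ∀ p q r s x y → r * q ≡ 1 + p * s → 0 < p + q → 0 < x + y → x + y ≤ 2 * (r + s) →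
                 isLeft (p + r) (q + s) x y ≡ isLeft≤ r s x y
  left-concat₁ p q r s x y bez n₁ h>0 h≤ =
    does-⇔ (mk⇔ to from) ((p + r) * x ℕ.<? (q + s) * y) (r * x ℕ.≤? s * y)
    where
    idn = bezout-height p q r s x y bez
    from : r * x ≤ s * y → (p + r) * x < (q + s) * y
    from rx≤sy = lin≤ (px<qy ⊞ rx≤sy) (solveℕ (p ∷ q ∷ r ∷ s ∷ x ∷ y ∷ []))
      where
      px<qy : p * x < q * y
      px<qy = ℕP.*-cancelˡ-< (r + s) (p * x) (q * y)
        (lin≤ (h>0 ⊞ scale≤ (p + q) rx≤sy ⊞ ℕP.≤-reflexive (sym idn)) (solveℕ (p ∷ q ∷ r ∷ s ∷ x ∷ y ∷ [])))
    to : (p + r) * x < (q + s) * y → r * x ≤ s * y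
    to lt with r * x ℕ.≤? s * y
    ... | yes rx≤sy = rx≤sy
    ... | no rx≰sy = contradiction (lin≤ (ℕ.s≤s⁻¹ qy<px+2 ⊞ sy<rx ⊞ lt) (solveℕ (p ∷ q ∷ r ∷ s ∷ x ∷ y ∷ []))) (ℕP.n≮n 0)
      where
      sy<rx : s * y < r * x
      sy<rx = ℕP.≰⇒> rx≰sy
      qy<px+2 : q * y < 2 + p * x
      qy<px+2 = ℕP.*-cancelˡ-< (r + s) (q * y) (2 + p * x)
        (lin≤ (n₁ ⊞ h≤ ⊞ scale≤ (p + q) sy<rx ⊞ ℕP.≤-reflexive idn) (solveℕ (p ∷ q ∷ r ∷ s ∷ x ∷ y ∷ [])))

  -- The translation by 2 (s , r) raises β by 2, so the two conditions are α < β + 2 and β ≥ 0. If β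
  -- ≥ 0, then α ≥ 2 would make x + y at least 2 (p + q); if β < 0, then x + y > 0 forces α ≥ 1 ≥ β
  -- + 2. The bound on x + y is strict because of the endpoint (2 q , 2 p), which lies on both
  -- lines.
  left-concat₂ : ∀ p q r s x y → r * q ≡ 1 + p * s → 0 < r + s → 0 < x + y → x + y < 2 * (p + q) →
                 isLeft (p + r) (q + s) (2 * s + x) (2 * r + y) ≡ isLeft≤ p q x y
  left-concat₂ p q r s x y bez n₂ h>0 h< =
    does-⇔ (mk⇔ to from) ((p + r) * (2 * s + x) ℕ.<? (q + s) * (2 * r + y)) (p * x ℕ.≤? q * y)
    where
    idn = bezout-height p q r s x y bez
    bez≤ : 1 + p * s ≤ r * q
    bez≤ = ℕP.≤-reflexive (sym bez)
    from : p * x ≤ q * y → (p + r) * (2 * s + x) < (q + s) * (2 * r + y)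
    from px≤qy = lin≤ (px≤qy ⊞ rx<sy+2 ⊞ scale≤ 2 bez≤) (solveℕ (p ∷ q ∷ r ∷ s ∷ x ∷ y ∷ []))
      where
      rx<sy+2 : r * x < 2 + s * y
      rx<sy+2 = ℕP.*-cancelˡ-< (p + q) (r * x) (2 + s * y)
        (lin≤ (h< ⊞ scale≤ (r + s) px≤qy ⊞ ℕP.≤-reflexive idn) (solveℕ (p ∷ q ∷ r ∷ s ∷ x ∷ y ∷ [])))
    to : (p + r) * (2 * s + x) < (q + s) * (2 * r + y) → p * x ≤ q * y
    to lt with p * x ℕ.≤? q * y
    ... | yes px≤qy = px≤qy
    ... | no px≰qy = contradiction
            (lin≤ (sy<rx ⊞ qy<px ⊞ lt ⊞ scale≤ 2 (ℕP.≤-reflexive bez)) (solveℕ (p ∷ q ∷ r ∷ s ∷ x ∷ y ∷ []))) (ℕP.n≮n 0)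
      where
      qy<px : q * y < p * x
      qy<px = ℕP.≰⇒> px≰qy
      sy<rx : s * y < r * x
      sy<rx = ℕP.*-cancelˡ-< (p + q) (s * y) (r * x)
        (lin≤ (h>0 ⊞ scale≤ (r + s) (ℕP.<⇒≤ qy<px) ⊞ ℕP.≤-reflexive (sym idn)) (solveℕ (p ∷ q ∷ r ∷ s ∷ x ∷ y ∷ [])))

  -- The half-turn about (q , p) negates q y - p x. The negation of a strict inequality is a weak
  -- one, which is how a point on the line changes sides.
  isLeft≤-reflect : ∀ p q x y x′ y′ → x + x′ ≡ 2 * q → y + y′ ≡ 2 * p → isLeft≤ p q x′ y′ ≡ not (isLeft p q x y)
  isLeft≤-reflect p q x y x′ y′ ex ey = does-⇔ (mk⇔ to from) (p * x′ ℕ.≤? q * y′) (¬? (p * x ℕ.<? q * y))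
    where
    eq₁ : p * x + p * x′ ≡ q * y + q * y′
    eq₁ = begin
      p * x + p * x′   ≡⟨ solveℕ (p ∷ x ∷ x′ ∷ []) ⟩
      p * (x + x′)     ≡⟨ cong (p *_) ex ⟩
      p * (2 * q)      ≡⟨ solveℕ (p ∷ q ∷ []) ⟩
      q * (2 * p)      ≡⟨ cong (q *_) (sym ey) ⟩
      q * (y + y′)     ≡⟨ solveℕ (q ∷ y ∷ y′ ∷ []) ⟩
      q * y + q * y′ ∎
      where open ≡-Reasoning
    to : p * x′ ≤ q * y′ → ¬ (p * x < q * y)
    to h h′ = contradiction (lin≤ (h ⊞ h′ ⊞ ℕP.≤-reflexive (sym eq₁)) (solveℕ (p ∷ q ∷ x ∷ y ∷ x′ ∷ y′ ∷ []))) (ℕP.n≮n 0)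
    from : ¬ (p * x < q * y) → p * x′ ≤ q * y′
    from h = lin≤ (ℕP.≮⇒≥ h ⊞ ℕP.≤-reflexive eq₁) (solveℕ (p ∷ q ∷ x ∷ y ∷ x′ ∷ y′ ∷ []))

  -- Points carry doubled coordinates, so that midpoints of segments are integral:
  -- the unit square with lower left corner (f , g) has centre (odd f , odd g) and
  -- upper right corner (even f , even g).
  odd even : ℕ → ℕ
  odd f = suc (2 * f)
  even f = 2 * suc f

  Side : Set
  Side = ℕ → ℕ → Bool

  next : Side → ℕ × ℕ → ℕ × ℕ
  next σ (f , g) = if σ (even f) (even g) then (suc f , g) else (f , suc g)

  walk : Side → ℕ → ℕ × ℕ → ℕ × ℕ
  walk σ zero P = P
  walk σ (suc m) P = walk σ m (next σ P)

  height : ℕ × ℕ → ℕ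
  height (f , g) = f + g

  height-next : ∀ σ P → height (next σ P) ≡ suc (height P)
  height-next σ (f , g) with σ (even f) (even g)
  ... | true = refl
  ... | false = ℕP.+-suc f g

  height-walk : ∀ σ m P → height (walk σ m P) ≡ m + height P
  height-walk σ zero P = refl
  height-walk σ (suc m) P = trans (height-walk σ m (next σ P))
    (trans (cong (ℕ._+_ m) (height-next σ P)) (ℕP.+-suc m (height P)))

  walk-suc : ∀ σ m P → walk σ (suc m) P ≡ next σ (walk σ m P)
  walk-suc σ zero P = refl
  walk-suc σ (suc m) P = walk-suc σ m (next σ P)

  -- The line of slope p/q crosses the diagonal of the square.
  Crosses : ℕ → ℕ → ℕ × ℕ → Set
  Crosses p q (f , g) = p * f < q * suc g × q * g < p * suc f

  -- Squares of equal height lie along an antidiagonal. Of two of them, the upper left corner of the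
  -- lower one lies weakly below and to the right of the lower right corner of the upper one, so a
  -- rising line cannot separate the ends of both diagonals.
  crosses-unique : ∀ {p q P Q} → Crosses p q P → Crosses p q Q → height P ≡ height Q → P ≡ Q
  crosses-unique {p} {q} {f , g} {f′ , g′} (a , b) (a′ , b′) h with ℕP.<-cmp f f′
  ... | tri< f<f′ _ _ = contradiction (begin-strict
          p * f′      <⟨ a′ ⟩
          q * suc g′  ≤⟨ scale≤ q (lin≤ (f<f′ ⊞ ℕP.≤-reflexive (sym h)) (solveℕ (f ∷ g ∷ f′ ∷ g′ ∷ []))) ⟩
          q * g       <⟨ b ⟩
          p * suc f   ≤⟨ scale≤ p f<f′ ⟩
          p * f′ ∎) (ℕP.n≮n _)
    where open ℕP.≤-Reasoning
  ... | tri≈ _ refl _ = cong (f ,_) (ℕP.+-cancelˡ-≡ f g g′ h)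
  ... | tri> _ _ f′<f = contradiction (begin-strict
          p * f       <⟨ a ⟩
          q * suc g   ≤⟨ scale≤ q (lin≤ (f′<f ⊞ ℕP.≤-reflexive h) (solveℕ (f ∷ g ∷ f′ ∷ g′ ∷ []))) ⟩
          q * g′      <⟨ b′ ⟩
          p * suc f′  ≤⟨ scale≤ p f′<f ⟩
          p * f ∎) (ℕP.n≮n _)
    where open ℕP.≤-Reasoning

  crosses-last : ∀ p q → Crosses (suc p) (suc q) (q , p)
  crosses-last p q = lin≤ (z≤n {p}) (solveℕ (p ∷ q ∷ [])) , lin≤ (z≤n {q}) (solveℕ (p ∷ q ∷ []))

  crosses-first : ∀ p q → Crosses (suc p) (suc q) (0 , 0)
  crosses-first p q = lin≤ (z≤n {q}) (solveℕ (p ∷ q ∷ [])) , lin≤ (z≤n {p}) (solveℕ (p ∷ q ∷ []))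

  -- `next` consults only upper right corners, and at those before the endpoint the strict and the
  -- weak predicate agree if (q , p) is primitive. The facts about walks are therefore shared by
  -- `isLeft` and `isLeft≤`.
  record Separates (p q : ℕ) (σ : Side) : Set where
    field
      corner : ∀ f g → suc f + suc g < p + q →
        (σ (even f) (even g) ≡ true × p * suc f < q * suc g) ⊎ (σ (even f) (even g) ≡ false × q * suc g < p * suc f)

    crosses-next : ∀ f g → suc f + suc g < p + q → Crosses p q (f , g) → Crosses p q (next σ (f , g))
    crosses-next f g h (a , b) with corner f g h
    ... | inj₁ (eq , lt) rewrite eq = lt , ℕP.<-≤-trans b (scale≤ p (ℕP.n≤1+n (suc f)))
    ... | inj₂ (eq , lt) rewrite eq = ℕP.<-≤-trans a (scale≤ q (ℕP.n≤1+n (suc g))) , lt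

    crosses-walk : ∀ m P → m + height P + 2 ≤ p + q → Crosses p q P → Crosses p q (walk σ m P)
    crosses-walk zero P h c = c
    crosses-walk (suc m) (f , g) h c = crosses-walk m (next σ (f , g))
      (subst (λ z → m + z + 2 ≤ p + q) (sym (height-next σ (f , g))) (rest h)) (crosses-next f g (square h) c)
      where
      rest : suc m + (f + g) + 2 ≤ p + q → m + suc (f + g) + 2 ≤ p + q
      rest h = lin≤ h (solveℕ (p ∷ q ∷ m ∷ f ∷ g ∷ []))
      square : suc m + (f + g) + 2 ≤ p + q → suc f + suc g < p + q
      square h = lin≤ (h ⊞ z≤n {m}) (solveℕ (p ∷ q ∷ m ∷ f ∷ g ∷ []))

  walk-size : ∀ p q → p + q + 0 + 2 ≡ suc p + suc q
  walk-size p q = solveℕ (p ∷ q ∷ [])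

  walk-end : ∀ {p q σ} → Separates (suc p) (suc q) σ → walk σ (p + q) (0 , 0) ≡ (q , p)
  walk-end {p} {q} {σ} sep = crosses-unique {suc p} {suc q}
    (Separates.crosses-walk sep (p + q) (0 , 0) (ℕP.≤-reflexive (walk-size p q)) (crosses-first p q))
    (crosses-last p q)
    (trans (height-walk σ (p + q) (0 , 0)) (trans (ℕP.+-identityʳ (p + q)) (ℕP.+-comm p q)))

  -- No lattice point strictly between the endpoints lies on the line.
  Primitive : ℕ → ℕ → Set
  Primitive p q = ∀ i j → 0 < i + j → i + j < p + q → p * i ≢ q * j

  left-separates : ∀ {p q} → Primitive p q → Separates p q (isLeft p q)
  Separates.corner (left-separates {p} {q} prim) f g h with p * even f ℕ.<? q * even g
  ... | yes lt = inj₁ (dec-true (p * even f ℕ.<? q * even g) lt , half lt)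
    where
    half : p * (2 * suc f) < q * (2 * suc g) → p * suc f < q * suc g
    half lt = ℕP.*-cancelˡ-< 2 (p * suc f) (q * suc g) (lin≤ lt (solveℕ (p ∷ q ∷ f ∷ g ∷ [])))
  ... | no ≮ = inj₂ (dec-false (p * even f ℕ.<? q * even g) ≮ , ℕP.≤∧≢⇒< (half (ℕP.≮⇒≥ ≮)) λ eq → prim (suc f) (suc g) (s≤s z≤n) h (sym eq))
    where
    half : q * (2 * suc g) ≤ p * (2 * suc f) → q * suc g ≤ p * suc f
    half ge = ℕP.*-cancelˡ-≤ 2 (lin≤ ge (solveℕ (p ∷ q ∷ f ∷ g ∷ [])))

  isLeft≤-separates : ∀ {p q} → Primitive p q → Separates p q (isLeft≤ p q)
  Separates.corner (isLeft≤-separates {p} {q} prim) f g h with p * even f ℕ.≤? q * even g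
  ... | yes le = inj₁ (dec-true (p * even f ℕ.≤? q * even g) le , ℕP.≤∧≢⇒< (half le) (prim (suc f) (suc g) (s≤s z≤n) h))
    where
    half : p * (2 * suc f) ≤ q * (2 * suc g) → p * suc f ≤ q * suc g
    half le = ℕP.*-cancelˡ-≤ 2 (lin≤ le (solveℕ (p ∷ q ∷ f ∷ g ∷ [])))
  ... | no ≰ = inj₂ (dec-false (p * even f ℕ.≤? q * even g) ≰ , half (ℕP.≰⇒> ≰))
    where
    half : q * (2 * suc g) < p * (2 * suc f) → q * suc g < p * suc f
    half gt = ℕP.*-cancelˡ-< 2 (q * suc g) (p * suc f) (lin≤ gt (solveℕ (p ∷ q ∷ f ∷ g ∷ [])))


  -- If p i = q j, then (p + q) r i = r q (i + j) and (p + q) s j = p s (i + j). The right-hand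
  -- sides differ by i + j, so p + q divides i + j, which is positive and smaller.
  bezout⇒primitive : ∀ {p q} r s → r * q ≡ 1 + p * s ⊎ p * s ≡ 1 + r * q → Primitive p q
  bezout⇒primitive {p} {q} r s bez i j h>0 h< eq = contradiction (∣⇒≤ (n∣h bez)) (ℕP.<⇒≱ h<)
    where
    open ≡-Reasoning
    instance
      _ : ℕ.NonZero (i + j)
      _ = ℕ.>-nonZero h>0

    nri : (p + q) * (r * i) ≡ r * q * (i + j)
    nri = begin
      (p + q) * (r * i)              ≡⟨ solveℕ (p ∷ q ∷ r ∷ i ∷ []) ⟩
      r * (p * i) + r * q * i        ≡⟨ cong (λ z → r * z + r * q * i) eq ⟩
      r * (q * j) + r * q * i        ≡⟨ solveℕ (q ∷ r ∷ i ∷ j ∷ []) ⟩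
      r * q * (i + j) ∎

    nsj : (p + q) * (s * j) ≡ p * s * (i + j)
    nsj = begin
      (p + q) * (s * j)              ≡⟨ solveℕ (p ∷ q ∷ s ∷ j ∷ []) ⟩
      s * (q * j) + p * s * j        ≡⟨ cong (λ z → s * z + p * s * j) (sym eq) ⟩
      s * (p * i) + p * s * j        ≡⟨ solveℕ (p ∷ s ∷ i ∷ j ∷ []) ⟩
      p * s * (i + j) ∎

    n∣h : r * q ≡ 1 + p * s ⊎ p * s ≡ 1 + r * q → p + q ∣ i + j
    n∣h (inj₁ b) = ∣m+n∣m⇒∣n (divides (r * i) (begin
      (p + q) * (s * j) + (i + j)    ≡⟨ cong (ℕ._+ (i + j)) nsj ⟩
      p * s * (i + j) + (i + j)      ≡⟨ solveℕ (p ∷ s ∷ i ∷ j ∷ []) ⟩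
      (1 + p * s) * (i + j)          ≡⟨ cong (_* (i + j)) (sym b) ⟩
      r * q * (i + j)                ≡⟨ sym nri ⟩
      (p + q) * (r * i)              ≡⟨ ℕP.*-comm (p + q) (r * i) ⟩
      r * i * (p + q) ∎)) (m∣m*n (s * j))
    n∣h (inj₂ b) = ∣m+n∣m⇒∣n (divides (s * j) (begin
      (p + q) * (r * i) + (i + j)    ≡⟨ cong (ℕ._+ (i + j)) nri ⟩
      r * q * (i + j) + (i + j)      ≡⟨ solveℕ (r ∷ q ∷ i ∷ j ∷ []) ⟩
      (1 + r * q) * (i + j)          ≡⟨ cong (_* (i + j)) (sym b) ⟩
      p * s * (i + j)                ≡⟨ sym nsj ⟩
      (p + q) * (s * j)              ≡⟨ ℕP.*-comm (p + q) (s * j) ⟩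
      s * j * (p + q) ∎)) (m∣m*n (r * i))

open Walks

-- Matrices over a commutative ring

module Matrices
  {C : Set} (eq : C → C → Set) (plus times : C → C → C) (neg : C → C)
  (ι : ℚ → C) (isCommutativeRing : IsCommutativeRing eq plus times neg (ι 0ℚ) (ι 1ℚ))
  (+-homo : ∀ c d → eq (ι (c ℚ.+ d)) (plus (ι c) (ι d)))
  (*-homo : ∀ c d → eq (ι (c ℚ.* d)) (times (ι c) (ι d)))
  (-‿homo : ∀ c → eq (ι (ℚ.- c)) (neg (ι c)))
  where

  private
    R : CommutativeRing 0ℓ 0ℓ
    R = record { isCommutativeRing = isCommutativeRing }
    module CR = CommutativeRing R
  open CR using (Carrier; _+_; _*_; -_; 0#; 1#) renaming (_≈_ to _≃_)

  private
    morphism : ℚP.+-*-rawRing -Raw-AlmostCommutative⟶ fromCommutativeRing R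
    morphism = record { ⟦_⟧ = ι ; +-homo = +-homo ; *-homo = *-homo ; -‿homo = -‿homo
                      ; 0-homo = CR.refl ; 1-homo = CR.refl }

    _≟?_ : (a b : ℚ) → Maybe (ι a ≃ ι b)
    a ≟? b with a ℚP.≟ b
    ... | yes refl = just CR.refl
    ... | no _ = nothing

  module Solver = Algebra.Solver.Ring ℚP.+-*-rawRing (fromCommutativeRing R) morphism _≟?_
  open Solver

  one zer : ∀ {n} → Polynomial n
  one = con 1ℚ
  zer = con 0ℚ

  Matrix : Set
  Matrix = Carrier × Carrier × Carrier × Carrier

  infixl 7 _·_
  _·_ : Matrix → Matrix → Matrix
  (a , b , c , d) · (a′ , b′ , c′ , d′) =
    (a * a′ + b * c′ , a * b′ + b * d′ , c * a′ + d * c′ , c * b′ + d * d′)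

  adj transpose : Matrix → Matrix
  adj (a , b , c , d) = (d , - b , - c , a)
  transpose (a , b , c , d) = (a , c , b , d)

  det trace : Matrix → Carrier
  det (a , b , c , d) = a * d + - (b * c)
  trace (a , b , c , d) = a + d

  ent₁₂ : Matrix → Carrier
  ent₁₂ (a , b , c , d) = b

  I : Matrix
  I = (1# , 0# , 0# , 1#)

  infix 4 _≃ᴹ_
  data _≃ᴹ_ : Matrix → Matrix → Set where
    entries : ∀ {a b c d a′ b′ c′ d′} → a ≃ a′ → b ≃ b′ → c ≃ c′ → d ≃ d′ →
              (a , b , c , d) ≃ᴹ (a′ , b′ , c′ , d′)

  ≃ᴹ-refl : ∀ {X} → X ≃ᴹ X
  ≃ᴹ-refl = entries CR.refl CR.refl CR.refl CR.refl

  ≃ᴹ-reflexive : ∀ {X Y} → X ≡ Y → X ≃ᴹ Y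
  ≃ᴹ-reflexive refl = ≃ᴹ-refl

  ≃ᴹ-sym : ∀ {X Y} → X ≃ᴹ Y → Y ≃ᴹ X
  ≃ᴹ-sym (entries p q r s) = entries (CR.sym p) (CR.sym q) (CR.sym r) (CR.sym s)

  ≃ᴹ-trans : ∀ {X Y Z} → X ≃ᴹ Y → Y ≃ᴹ Z → X ≃ᴹ Z
  ≃ᴹ-trans (entries p q r s) (entries p′ q′ r′ s′) =
    entries (CR.trans p p′) (CR.trans q q′) (CR.trans r r′) (CR.trans s s′)

  matrixSetoid : Setoid _ _
  matrixSetoid = record { Carrier = Matrix ; _≈_ = _≃ᴹ_ ; isEquivalence = record
    { refl = ≃ᴹ-refl ; sym = ≃ᴹ-sym ; trans = ≃ᴹ-trans } }

  private module ER = Relation.Binary.Reasoning.Setoid CR.setoid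
  private module MR = Relation.Binary.Reasoning.Setoid matrixSetoid

  ·-cong : ∀ {X X′ Y Y′} → X ≃ᴹ X′ → Y ≃ᴹ Y′ → X · Y ≃ᴹ X′ · Y′
  ·-cong (entries p q r s) (entries p′ q′ r′ s′) = entries
    (CR.+-cong (CR.*-cong p p′) (CR.*-cong q r′)) (CR.+-cong (CR.*-cong p q′) (CR.*-cong q s′))
    (CR.+-cong (CR.*-cong r p′) (CR.*-cong s r′)) (CR.+-cong (CR.*-cong r q′) (CR.*-cong s s′))

  ·-assoc : ∀ X Y Z → (X · Y) · Z ≃ᴹ X · (Y · Z)
  ·-assoc (a , b , c , d) (a′ , b′ , c′ , d′) (a″ , b″ , c″ , d″) = entries
    (lem a b a′ b′ c′ d′ a″ c″) (lem a b a′ b′ c′ d′ b″ d″)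
    (lem c d a′ b′ c′ d′ a″ c″) (lem c d a′ b′ c′ d′ b″ d″)
    where
    lem : ∀ a b e f g h x y → (a * e + b * g) * x + (a * f + b * h) * y ≃ a * (e * x + f * y) + b * (g * x + h * y)
    lem = solve 8 (λ a b e f g h x y →
      (a :* e :+ b :* g) :* x :+ (a :* f :+ b :* h) :* y := a :* (e :* x :+ f :* y) :+ b :* (g :* x :+ h :* y)) CR.refl

  ·-identityˡ : ∀ X → I · X ≃ᴹ X
  ·-identityˡ (a , b , c , d) = entries (l a c) (l b d) (r a c) (r b d)
    where
    l : ∀ x y → 1# * x + 0# * y ≃ x
    l = solve 2 (λ x y → one :* x :+ zer :* y := x) CR.refl
    r : ∀ x y → 0# * x + 1# * y ≃ y
    r = solve 2 (λ x y → zer :* x :+ one :* y := y) CR.refl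

  ·-identityʳ : ∀ X → X · I ≃ᴹ X
  ·-identityʳ (a , b , c , d) = entries (l a b) (r a b) (l c d) (r c d)
    where
    l : ∀ x y → x * 1# + y * 0# ≃ x
    l = solve 2 (λ x y → x :* one :+ y :* zer := x) CR.refl
    r : ∀ x y → x * 0# + y * 1# ≃ y
    r = solve 2 (λ x y → x :* zer :+ y :* one := y) CR.refl

  transpose-cong : ∀ {X Y} → X ≃ᴹ Y → transpose X ≃ᴹ transpose Y
  transpose-cong (entries p q r s) = entries p r q s

  transpose-· : ∀ X Y → transpose (X · Y) ≃ᴹ transpose Y · transpose X
  transpose-· (a , b , c , d) (a′ , b′ , c′ , d′) =
    entries (lem a b a′ c′) (lem c d a′ c′) (lem a b b′ d′) (lem c d b′ d′)
    where
    lem : ∀ a b c d → a * c + b * d ≃ c * a + d * b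
    lem = solve 4 (λ a b c d → a :* c :+ b :* d := c :* a :+ d :* b) CR.refl

  adj-cong : ∀ {X Y} → X ≃ᴹ Y → adj X ≃ᴹ adj Y
  adj-cong (entries p q r s) = entries s (CR.-‿cong q) (CR.-‿cong r) p

  det-cong : ∀ {X Y} → X ≃ᴹ Y → det X ≃ det Y
  det-cong (entries p q r s) = CR.+-cong (CR.*-cong p s) (CR.-‿cong (CR.*-cong q r))

  trace-cong : ∀ {X Y} → X ≃ᴹ Y → trace X ≃ trace Y
  trace-cong (entries p q r s) = CR.+-cong p s

  ent₁₂-cong : ∀ {X Y} → X ≃ᴹ Y → ent₁₂ X ≃ ent₁₂ Y
  ent₁₂-cong (entries p q r s) = q

  det-· : ∀ X Y → det (X · Y) ≃ det X * det Y
  det-· (a , b , c , d) (a′ , b′ , c′ , d′) = solve 8 (λ a b c d a′ b′ c′ d′ →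
    (a :* a′ :+ b :* c′) :* (c :* b′ :+ d :* d′) :+ :- ((a :* b′ :+ b :* d′) :* (c :* a′ :+ d :* c′))
      := (a :* d :+ :- (b :* c)) :* (a′ :* d′ :+ :- (b′ :* c′))) CR.refl a b c d a′ b′ c′ d′

  det-adj : ∀ X → det (adj X) ≃ det X
  det-adj (a , b , c , d) = solve 4 (λ a b c d →
    d :* a :+ :- ((:- b) :* (:- c)) := a :* d :+ :- (b :* c)) CR.refl a b c d

  adj-inverseʳ : ∀ {X} → det X ≃ 1# → X · adj X ≃ᴹ I
  adj-inverseʳ {a , b , c , d} h = entries
    (CR.trans (solve 4 (λ a b c d → a :* d :+ b :* (:- c) := a :* d :+ :- (b :* c)) CR.refl a b c d) h)
    (solve 2 (λ a b → a :* (:- b) :+ b :* a := zer) CR.refl a b)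
    (solve 2 (λ c d → c :* d :+ d :* (:- c) := zer) CR.refl c d)
    (CR.trans (solve 4 (λ a b c d → c :* (:- b) :+ d :* a := a :* d :+ :- (b :* c)) CR.refl a b c d) h)

  adj-inverseˡ : ∀ {X} → det X ≃ 1# → adj X · X ≃ᴹ I
  adj-inverseˡ {a , b , c , d} h = entries
    (CR.trans (solve 4 (λ a b c d → d :* a :+ (:- b) :* c := a :* d :+ :- (b :* c)) CR.refl a b c d) h)
    (solve 2 (λ b d → d :* b :+ (:- b) :* d := zer) CR.refl b d)
    (solve 2 (λ a c → (:- c) :* a :+ a :* c := zer) CR.refl a c)
    (CR.trans (solve 4 (λ a b c d → (:- c) :* b :+ a :* d := a :* d :+ :- (b :* c)) CR.refl a b c d) h)

  cancel-adjˡ : ∀ {X} Y → det X ≃ 1# → adj X · (X · Y) ≃ᴹ Y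
  cancel-adjˡ {X} Y h = ≃ᴹ-trans (≃ᴹ-sym (·-assoc (adj X) X Y))
    (≃ᴹ-trans (·-cong (adj-inverseˡ h) ≃ᴹ-refl) (·-identityˡ Y))

  cancelˡ-adj : ∀ {X} Y → det X ≃ 1# → X · (adj X · Y) ≃ᴹ Y
  cancelˡ-adj {X} Y h = ≃ᴹ-trans (≃ᴹ-sym (·-assoc X (adj X) Y))
    (≃ᴹ-trans (·-cong (adj-inverseʳ h) ≃ᴹ-refl) (·-identityˡ Y))

  cancelʳ-adj : ∀ {X} Y → det X ≃ 1# → (Y · X) · adj X ≃ᴹ Y
  cancelʳ-adj {X} Y h = ≃ᴹ-trans (·-assoc Y X (adj X))
    (≃ᴹ-trans (·-cong ≃ᴹ-refl (adj-inverseʳ h)) (·-identityʳ Y))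

  cancel-adjʳ : ∀ {X} Y → det X ≃ 1# → (Y · adj X) · X ≃ᴹ Y
  cancel-adjʳ {X} Y h = ≃ᴹ-trans (·-assoc Y (adj X) X)
    (≃ᴹ-trans (·-cong ≃ᴹ-refl (adj-inverseˡ h)) (·-identityʳ Y))

  trace-conj : ∀ Y Z → trace (Y · Z · adj Y) ≃ det Y * trace Z
  trace-conj (a , b , c , d) (e , f , g , h) = solve 8 (λ a b c d e f g h →
    ((a :* e :+ b :* g) :* d :+ (a :* f :+ b :* h) :* (:- c)) :+
    ((c :* e :+ d :* g) :* (:- b) :+ (c :* f :+ d :* h) :* a)
    := (a :* d :+ :- (b :* c)) :* (e :+ h)) CR.refl a b c d e f g h

  trace-conj′ : ∀ X Y → trace (adj Y · X · Y) ≃ det Y * trace X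
  trace-conj′ (e , f , g , h) (a , b , c , d) = solve 8 (λ a b c d e f g h →
    ((d :* e :+ (:- b) :* g) :* a :+ (d :* f :+ (:- b) :* h) :* c) :+
    (((:- c) :* e :+ a :* g) :* b :+ ((:- c) :* f :+ a :* h) :* d)
    := (a :* d :+ :- (b :* c)) :* (e :+ h)) CR.refl a b c d e f g h

  T-of : Carrier → Matrix
  T-of t = (- 1# , 0# , t , - 1#)

  det-T : ∀ t → det (T-of t) ≃ 1#
  det-T t = solve 1 (λ t → (:- one) :* (:- one) :+ :- (zer :* t) := one) CR.refl t

  -- The exchange relation for z ↦ z′ is det Z = 1 after eliminating x = (YZ)₁₂ and tr Z = −k.
  exchange : ∀ Y Z k → det Z ≃ 1# → trace Z ≃ - k →
    ent₁₂ Z * ent₁₂ (Y · Z · adj Y) ≃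
    ent₁₂ (Y · Z) * ent₁₂ (Y · Z) + k * ent₁₂ (Y · Z) * ent₁₂ Y + ent₁₂ Y * ent₁₂ Y
  exchange (a , b , c , d) (e , f , g , h) k dZ tZ = begin
    f * ((a * e + b * g) * (- b) + (a * f + b * h) * a)
      ≈⟨ solve 6 (λ a b e f g h → f :* ((a :* e :+ b :* g) :* (:- b) :+ (a :* f :+ b :* h) :* a)
          := (a :* f :+ b :* h) :* (a :* f :+ b :* h) :+ (:- (e :+ h)) :* (a :* f :+ b :* h) :* b
             :+ b :* b :* (e :* h :+ :- (f :* g))) CR.refl a b e f g h ⟩
    (a * f + b * h) * (a * f + b * h) + (- (e + h)) * (a * f + b * h) * b + b * b * (e * h + - (f * g))
      ≈⟨ CR.+-cong (CR.+-cong CR.refl (CR.*-cong (CR.*-cong (CR.-‿cong tZ) CR.refl) CR.refl)) (CR.*-cong CR.refl dZ) ⟩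
    (a * f + b * h) * (a * f + b * h) + (- (- k)) * (a * f + b * h) * b + b * b * 1#
      ≈⟨ solve 3 (λ x k b → x :* x :+ (:- (:- k)) :* x :* b :+ b :* b :* one
          := x :* x :+ k :* x :* b :+ b :* b) CR.refl (a * f + b * h) k b ⟩
    (a * f + b * h) * (a * f + b * h) + k * (a * f + b * h) * b + b * b ∎
    where open ER

  exchange′ : ∀ X Y k → det X ≃ 1# → trace X ≃ - k →
    ent₁₂ X * ent₁₂ (adj Y · X · Y) ≃
    ent₁₂ Y * ent₁₂ Y + k * ent₁₂ Y * ent₁₂ (X · Y) + ent₁₂ (X · Y) * ent₁₂ (X · Y)
  exchange′ (e , f , g , h) (a , b , c , d) k dX tX = begin
    f * ((d * e + (- b) * g) * b + (d * f + (- b) * h) * d)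
      ≈⟨ solve 6 (λ b d e f g h → f :* ((d :* e :+ (:- b) :* g) :* b :+ (d :* f :+ (:- b) :* h) :* d)
          := b :* b :* (e :* h :+ :- (f :* g)) :+ (:- (e :+ h)) :* b :* (e :* b :+ f :* d)
             :+ (e :* b :+ f :* d) :* (e :* b :+ f :* d)) CR.refl b d e f g h ⟩
    b * b * (e * h + - (f * g)) + (- (e + h)) * b * (e * b + f * d) + (e * b + f * d) * (e * b + f * d)
      ≈⟨ CR.+-cong (CR.+-cong (CR.*-cong CR.refl dX) (CR.*-cong (CR.*-cong (CR.-‿cong tX) CR.refl) CR.refl)) CR.refl ⟩
    b * b * 1# + (- (- k)) * b * (e * b + f * d) + (e * b + f * d) * (e * b + f * d)
      ≈⟨ solve 3 (λ z k b → b :* b :* one :+ (:- (:- k)) :* b :* z :+ z :* z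
          := b :* b :+ k :* b :* z :+ z :* z) CR.refl (e * b + f * d) k b ⟩
    b * b + k * b * (e * b + f * d) + (e * b + f * d) * (e * b + f * d) ∎
    where open ER

  ent₁₂-T·adj : ∀ t X → ent₁₂ (T-of t · adj X) ≃ ent₁₂ X
  ent₁₂-T·adj t (a , b , c , d) = solve 2 (λ a b → (:- one) :* (:- b) :+ zer :* a := b) CR.refl a b

  ent₁₂-adj·T : ∀ t X → ent₁₂ (adj X · T-of t) ≃ ent₁₂ X
  ent₁₂-adj·T t (a , b , c , d) = solve 2 (λ d b → d :* zer :+ (:- b) :* (:- one) := b) CR.refl d b

  -- Transfer matrices for order ideals of a fence; the first row or column stands for an
  -- element outside the ideal.  U and L join two elements, the first being greater for U.  G describes a
  -- crossing with κ = k x̂ and w = x̂²: for k > 0 the two-element group, with the greater element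
  -- first in case true, and for k = 0 (κ = 0) the one-element group.
  U L : Matrix
  U = (1# , 1# , 0# , 1#)
  L = (1# , 0# , 1# , 1#)

  G : Bool → Carrier → Carrier → Matrix
  G false κ w = (1# , 0# , κ , w)
  G true  κ w = (1# , κ , 0# , w)

  -- The four weights entering M_{p/q}, read off from the product of the transfer matrices.
  ψ : Carrier → Matrix → Matrix
  ψ s (a , b , c , d) = (s * (a + b) , s * (a + b + c + d) , - (s * a) , - (s * (a + c)))

  ψ-cong : ∀ {s s′ X Y} → s ≃ s′ → X ≃ᴹ Y → ψ s X ≃ᴹ ψ s′ Y
  ψ-cong h (entries p q r s) = entries (CR.*-cong h (CR.+-cong p q))
    (CR.*-cong h (CR.+-cong (CR.+-cong (CR.+-cong p q) r) s))
    (CR.-‿cong (CR.*-cong h p)) (CR.-‿cong (CR.*-cong h (CR.+-cong p r)))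

  -- This is `U · T-of n · (1 , 1 , − 1 , 0)`. With X the transpose of its argument, `ψ s` yields s
  -- (1 , 1 , - 1 , 0) X U, and between two such products the constant factors surround T in this
  -- way.
  Φ-of : Carrier → Matrix
  Φ-of n = (n , n + - 1# , n + 1# , n)

  -- For m m′ = 1 this is conjugation by the diagonal matrix (m , 0 , 0 , 1). It accounts for the
  -- monomials off the diagonal of M_{p/q}, whose ratio to those on the diagonal does not depend on
  -- p/q.
  conj : Carrier → Carrier → Matrix → Matrix
  conj m m′ (a , b , c , d) = (a , m * b , m′ * c , d)

  conj-cong : ∀ {m m′ X Y} → X ≃ᴹ Y → conj m m′ X ≃ᴹ conj m m′ Y
  conj-cong (entries p q r s) = entries p (CR.*-cong CR.refl q) (CR.*-cong CR.refl r) s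

  conj-· : ∀ {m m′} → m * m′ ≃ 1# → ∀ X Y → conj m m′ X · conj m m′ Y ≃ᴹ conj m m′ (X · Y)
  conj-· {m} {m′} mm (a , b , c , d) (a′ , b′ , c′ , d′) = entries
    (CR.trans (solve 6 (λ m m′ a b a′ c′ → a :* a′ :+ m :* b :* (m′ :* c′) := a :* a′ :+ (m :* m′) :* (b :* c′)) CR.refl m m′ a b a′ c′)
       (CR.+-cong CR.refl (unit (b * c′))))
    (solve 5 (λ m a b b′ d′ → a :* (m :* b′) :+ m :* b :* d′ := m :* (a :* b′ :+ b :* d′)) CR.refl m a b b′ d′)
    (solve 5 (λ m c d a′ c′ → m :* c :* a′ :+ d :* (m :* c′) := m :* (c :* a′ :+ d :* c′)) CR.refl m′ c d a′ c′)
    (CR.trans (solve 6 (λ m m′ c d b′ d′ → m′ :* c :* (m :* b′) :+ d :* d′ := (m :* m′) :* (c :* b′) :+ d :* d′) CR.refl m m′ c d b′ d′)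
       (CR.+-cong (unit (c * b′)) CR.refl))
    where
    unit : ∀ x → (m * m′) * x ≃ x
    unit x = CR.trans (CR.*-cong mm CR.refl) (CR.*-identityˡ x)

  adj-conj : ∀ m m′ X → adj (conj m m′ X) ≃ᴹ conj m m′ (adj X)
  adj-conj m m′ (a , b , c , d) = entries CR.refl (lem m b) (lem m′ c) CR.refl
    where
    lem : ∀ x y → - (x * y) ≃ x * (- y)
    lem = solve 2 (λ x y → :- (x :* y) := x :* (:- y)) CR.refl

  -- ψ s is, up to a transpose, multiplication by constant matrices on both sides, so that it
  -- turns a product of transfer matrices into one of adjugates.
  ψ-product : ∀ s s′ n X Y →
    ψ (s * s′) (transpose (X · (Φ-of n · Y))) ≃ᴹ adj (ψ s X) · (T-of n · adj (ψ s′ Y))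
  ψ-product s s′ n (a , b , c , d) (e , f , g , h) = entries
    (solve 11 (λ s s′ n a b c d e f g h →
      let p = n :* e :+ (n :+ :- one) :* g ; q = n :* f :+ (n :+ :- one) :* h
          p′ = (n :+ one) :* e :+ n :* g ; q′ = (n :+ one) :* f :+ n :* h in
      (s :* s′) :* ((a :* p :+ b :* p′) :+ (c :* p :+ d :* p′))
      := (:- (s :* (a :+ c))) :* ((:- one) :* (:- (s′ :* (e :+ g))) :+ zer :* (:- (:- (s′ :* e))))
         :+ (:- (s :* (a :+ b :+ c :+ d))) :* (n :* (:- (s′ :* (e :+ g))) :+ (:- one) :* (:- (:- (s′ :* e)))))
      CR.refl s s′ n a b c d e f g h)
    (solve 11 (λ s s′ n a b c d e f g h →
      let p = n :* e :+ (n :+ :- one) :* g ; q = n :* f :+ (n :+ :- one) :* h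
          p′ = (n :+ one) :* e :+ n :* g ; q′ = (n :+ one) :* f :+ n :* h in
      (s :* s′) :* ((a :* p :+ b :* p′) :+ (c :* p :+ d :* p′) :+ (a :* q :+ b :* q′) :+ (c :* q :+ d :* q′))
      := (:- (s :* (a :+ c))) :* ((:- one) :* (:- (s′ :* (e :+ f :+ g :+ h))) :+ zer :* (s′ :* (e :+ f)))
         :+ (:- (s :* (a :+ b :+ c :+ d))) :* (n :* (:- (s′ :* (e :+ f :+ g :+ h))) :+ (:- one) :* (s′ :* (e :+ f))))
      CR.refl s s′ n a b c d e f g h)
    (solve 11 (λ s s′ n a b c d e f g h →
      let p = n :* e :+ (n :+ :- one) :* g ; q = n :* f :+ (n :+ :- one) :* h
          p′ = (n :+ one) :* e :+ n :* g ; q′ = (n :+ one) :* f :+ n :* h in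
      :- ((s :* s′) :* (a :* p :+ b :* p′))
      := (:- (:- (s :* a))) :* ((:- one) :* (:- (s′ :* (e :+ g))) :+ zer :* (:- (:- (s′ :* e))))
         :+ (s :* (a :+ b)) :* (n :* (:- (s′ :* (e :+ g))) :+ (:- one) :* (:- (:- (s′ :* e)))))
      CR.refl s s′ n a b c d e f g h)
    (solve 11 (λ s s′ n a b c d e f g h →
      let p = n :* e :+ (n :+ :- one) :* g ; q = n :* f :+ (n :+ :- one) :* h
          p′ = (n :+ one) :* e :+ n :* g ; q′ = (n :+ one) :* f :+ n :* h in
      :- ((s :* s′) :* ((a :* p :+ b :* p′) :+ (a :* q :+ b :* q′)))
      := (:- (:- (s :* a))) :* ((:- one) :* (:- (s′ :* (e :+ f :+ g :+ h))) :+ zer :* (s′ :* (e :+ f)))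
         :+ (s :* (a :+ b)) :* (n :* (:- (s′ :* (e :+ f :+ g :+ h))) :+ (:- one) :* (s′ :* (e :+ f))))
      CR.refl s s′ n a b c d e f g h)

  middle-triple : ∀ {X Y Z t} → det X ≃ 1# → det Z ≃ 1# → Y ≃ᴹ adj X · (T-of t · adj Z) → X · Y · Z ≃ᴹ T-of t
  middle-triple {X} {Y} {Z} {t} dX dZ hY = begin
    X · Y · Z                              ≈⟨ ·-cong (·-cong ≃ᴹ-refl hY) ≃ᴹ-refl ⟩
    X · (adj X · (T-of t · adj Z)) · Z     ≈⟨ ·-cong (cancelˡ-adj (T-of t · adj Z) dX) ≃ᴹ-refl ⟩
    (T-of t · adj Z) · Z                   ≈⟨ cancel-adjʳ (T-of t) dZ ⟩
    T-of t ∎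
    where open MR

  det-middle : ∀ {X Y Z t} → det X ≃ 1# → det Z ≃ 1# → Y ≃ᴹ adj X · (T-of t · adj Z) → det Y ≃ 1#
  det-middle {X} {Y} {Z} {t} dX dZ hY = begin
    det Y                                     ≈⟨ det-cong hY ⟩
    det (adj X · (T-of t · adj Z))            ≈⟨ det-· (adj X) (T-of t · adj Z) ⟩
    det (adj X) * det (T-of t · adj Z)        ≈⟨ CR.*-cong (CR.trans (det-adj X) dX) (det-· (T-of t) (adj Z)) ⟩
    1# * (det (T-of t) * det (adj Z))         ≈⟨ CR.*-cong CR.refl (CR.*-cong (det-T t) (CR.trans (det-adj Z) dZ)) ⟩
    1# * (1# * 1#)                            ≈⟨ CR.*-identityˡ (1# * 1#) ⟩
    1# * 1#                                   ≈⟨ CR.*-identityˡ 1# ⟩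
    1# ∎
    where open ER

  left-child : ∀ {X Y Z t Y′} → det X ≃ 1# → X · Y · Z ≃ᴹ T-of t → Y′ ≃ᴹ adj X · (T-of t · adj Y) → Y′ ≃ᴹ Y · Z · adj Y
  left-child {X} {Y} {Z} {t} {Y′} dX hT hY′ = begin
    Y′                               ≈⟨ hY′ ⟩
    adj X · (T-of t · adj Y)         ≈⟨ ·-cong ≃ᴹ-refl (·-cong (≃ᴹ-sym hT) ≃ᴹ-refl) ⟩
    adj X · (X · Y · Z · adj Y)      ≈⟨ ·-cong ≃ᴹ-refl (·-cong (·-assoc X Y Z) ≃ᴹ-refl) ⟩
    adj X · (X · (Y · Z) · adj Y)    ≈⟨ ·-cong ≃ᴹ-refl (·-assoc X (Y · Z) (adj Y)) ⟩
    adj X · (X · (Y · Z · adj Y))    ≈⟨ cancel-adjˡ (Y · Z · adj Y) dX ⟩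
    Y · Z · adj Y ∎
    where open MR

  right-child : ∀ {X Y Z t Y′} → det Z ≃ 1# → X · Y · Z ≃ᴹ T-of t → Y′ ≃ᴹ adj Y · (T-of t · adj Z) → Y′ ≃ᴹ adj Y · X · Y
  right-child {X} {Y} {Z} {t} {Y′} dZ hT hY′ = begin
    Y′                               ≈⟨ hY′ ⟩
    adj Y · (T-of t · adj Z)         ≈⟨ ·-cong ≃ᴹ-refl (·-cong (≃ᴹ-sym hT) ≃ᴹ-refl) ⟩
    adj Y · (X · Y · Z · adj Z)      ≈⟨ ·-cong ≃ᴹ-refl (cancelʳ-adj (X · Y) dZ) ⟩
    adj Y · (X · Y)                  ≈⟨ ≃ᴹ-sym (·-assoc (adj Y) X Y) ⟩
    adj Y · X · Y ∎
    where open MR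

  -- Y Z = X⁻¹ T, and T is lower triangular with - 1 on the diagonal, so in the upper right entry it
  -- only undoes the sign of the adjugate. This turns the identity `exchange` into a relation
  -- between the three entries of a triple.
  ent₁₂-first : ∀ {X Y Z t} → det X ≃ 1# → X · Y · Z ≃ᴹ T-of t → ent₁₂ (Y · Z) ≃ ent₁₂ X
  ent₁₂-first {X} {Y} {Z} {t} dX hT = CR.trans (ent₁₂-cong (begin
    Y · Z                    ≈⟨ ≃ᴹ-sym (cancel-adjˡ (Y · Z) dX) ⟩
    adj X · (X · (Y · Z))    ≈⟨ ·-cong ≃ᴹ-refl (≃ᴹ-trans (≃ᴹ-sym (·-assoc X Y Z)) hT) ⟩
    adj X · T-of t ∎)) (ent₁₂-adj·T t X)
    where open MR

  ent₁₂-last : ∀ {X Y Z t} → det Z ≃ 1# → X · Y · Z ≃ᴹ T-of t → ent₁₂ (X · Y) ≃ ent₁₂ Z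
  ent₁₂-last {X} {Y} {Z} {t} dZ hT = CR.trans (ent₁₂-cong (begin
    X · Y                    ≈⟨ ≃ᴹ-sym (cancelʳ-adj (X · Y) dZ) ⟩
    X · Y · Z · adj Z        ≈⟨ ·-cong hT ≃ᴹ-refl ⟩
    T-of t · adj Z ∎)) (ent₁₂-T·adj t Z)
    where open MR

  Vector : Set
  Vector = Carrier × Carrier

  infix 4 _≃ᵛ_
  data _≃ᵛ_ : Vector → Vector → Set where
    both : ∀ {x y x′ y′} → x ≃ x′ → y ≃ y′ → (x , y) ≃ᵛ (x′ , y′)

  ≃ᵛ-sym : ∀ {u v} → u ≃ᵛ v → v ≃ᵛ u
  ≃ᵛ-sym (both x y) = both (CR.sym x) (CR.sym y)

  ≃ᵛ-trans : ∀ {u v w} → u ≃ᵛ v → v ≃ᵛ w → u ≃ᵛ w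
  ≃ᵛ-trans (both x y) (both x′ y′) = both (CR.trans x x′) (CR.trans y y′)

  act : Matrix → Vector → Vector
  act (a , b , c , d) (x , y) = (a * x + b * y , c * x + d * y)

  act-cong : ∀ X {u v} → u ≃ᵛ v → act X u ≃ᵛ act X v
  act-cong (a , b , c , d) (both x y) = both
    (CR.+-cong (CR.*-cong CR.refl x) (CR.*-cong CR.refl y)) (CR.+-cong (CR.*-cong CR.refl x) (CR.*-cong CR.refl y))

  act-· : ∀ X Y v → act (X · Y) v ≃ᵛ act X (act Y v)
  act-· (a , b , c , d) (a′ , b′ , c′ , d′) (x , y) = both (lem a b) (lem c d)
    where
    lem : ∀ a b → (a * a′ + b * c′) * x + (a * b′ + b * d′) * y ≃ a * (a′ * x + b′ * y) + b * (c′ * x + d′ * y)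
    lem a b = solve 8 (λ a b e f g h x y →
      (a :* e :+ b :* g) :* x :+ (a :* f :+ b :* h) :* y := a :* (e :* x :+ f :* y) :+ b :* (g :* x :+ h :* y)) CR.refl a b a′ b′ c′ d′ x y

  J : Bool → Matrix
  J true  = U
  J false = L

  act-U : ∀ o i → act U (o , i) ≃ᵛ (o + i , i)
  act-U o i = both (solve 2 (λ o i → one :* o :+ one :* i := o :+ i) CR.refl o i)
                   (solve 2 (λ o i → zer :* o :+ one :* i := i) CR.refl o i)

  act-L : ∀ o i → act L (o , i) ≃ᵛ (o , o + i)
  act-L o i = both (solve 2 (λ o i → one :* o :+ zer :* i := o) CR.refl o i)
                   (solve 2 (λ o i → one :* o :+ one :* i := o :+ i) CR.refl o i)

  act-G-true : ∀ κ x o i → act (G true κ x) (o , i) ≃ᵛ (o + κ * i , x * i)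
  act-G-true κ x o i = both (solve 3 (λ κ o i → one :* o :+ κ :* i := o :+ κ :* i) CR.refl κ o i)
                            (solve 3 (λ x o i → zer :* o :+ x :* i := x :* i) CR.refl x o i)

  act-G-false : ∀ κ x o i → act (G false κ x) (o , i) ≃ᵛ (o , κ * o + x * i)
  act-G-false κ x o i = both (solve 2 (λ o i → one :* o :+ zer :* i := o) CR.refl o i) CR.refl

  act-G-zero : ∀ b {κ} x o i → κ ≃ 0# → act (G b κ x) (o , i) ≃ᵛ (o , x * i)
  act-G-zero true {κ} x o i h = ≃ᵛ-trans (act-G-true κ x o i)
    (both (CR.trans (CR.+-cong CR.refl (CR.trans (CR.*-cong h CR.refl) (CR.zeroˡ i))) (CR.+-identityʳ o)) CR.refl)
  act-G-zero false {κ} x o i h = ≃ᵛ-trans (act-G-false κ x o i)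
    (both CR.refl (CR.trans (CR.+-cong (CR.trans (CR.*-cong h CR.refl) (CR.zeroˡ o)) CR.refl) (CR.+-identityˡ (x * i))))

  insertTerm : Bool → Carrier → Carrier → Carrier
  insertTerm b x y = if b then x + y else y

  -- One step of the fold over subsets: a subset of the tail is extended in two ways, with and
  -- without a first element of weight w.
  insertTerm-step : ∀ (a b : Bool) w x X Y Z → Z ≃ w * X + Y →
    insertTerm a (w * x) (insertTerm b x Z) ≃ w * insertTerm a x X + insertTerm b x Y
  insertTerm-step true true w x X Y Z eq = CR.trans (CR.+-cong CR.refl (CR.+-cong CR.refl eq))
    (solve 4 (λ w x X Y → w :* x :+ (x :+ (w :* X :+ Y)) := w :* (x :+ X) :+ (x :+ Y)) CR.refl w x X Y)
  insertTerm-step true false w x X Y Z eq = CR.trans (CR.+-cong CR.refl eq)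
    (solve 4 (λ w x X Y → w :* x :+ (w :* X :+ Y) := w :* (x :+ X) :+ Y) CR.refl w x X Y)
  insertTerm-step false true w x X Y Z eq = CR.trans (CR.+-cong CR.refl eq)
    (solve 4 (λ w x X Y → x :+ (w :* X :+ Y) := w :* X :+ (x :+ Y)) CR.refl w x X Y)
  insertTerm-step false false w x X Y Z eq = eq

  -- Adding the elements of a group in front of a fence: the pair (o , i) sums over the ideals
  -- that avoid, respectively contain, the first element.
  larger-first : ∀ {l s x} κ o i → κ ≃ s → l * s ≃ x → act (G true κ x) (o , i) ≃ᵛ (o + s * i , l * (s * i))
  larger-first {l} {s} {x} κ o i hκ hx = ≃ᵛ-trans (act-G-true κ x o i) (both (CR.+-cong CR.refl (CR.*-cong hκ CR.refl))
    (CR.trans (CR.*-cong (CR.sym hx) CR.refl) (CR.*-assoc l s i)))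

  smaller-first : ∀ {l s x} κ o i → κ ≃ s → l * s ≃ x → act (G false κ x) (o , i) ≃ᵛ (o , s * (o + l * i))
  smaller-first {l} {s} {x} κ o i hκ hx = ≃ᵛ-trans (act-G-false κ x o i) (both CR.refl
    (CR.trans (CR.+-cong (CR.*-cong hκ CR.refl) (CR.*-cong (CR.sym hx) CR.refl))
      (solve 4 (λ l s o i → s :* o :+ (l :* s) :* i := s :* (o :+ l :* i)) CR.refl l s o i)))

  -- Products of transfer matrices along a walk

  module Transfer (k₁ k₂ k₃ d v h w : Carrier) (hvd : h * (v * d) ≃ 1#) (vw : v * w ≃ 1#) where

    -- Here d, v, h stand for x̂₁, x̂₂, x̂₃, which belong to diagonal, vertical and horizontal
    -- segments, and w for the inverse of v. As x̂₁ x̂₂ x̂₃ = 1, u is the inverse of h.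
    u : Carrier
    u = v * d

    GD GV GH : Bool → Matrix
    GD b = G b (k₁ * d) (d * d)
    GV b = G b (k₂ * v) (v * v)
    GH b = G b (k₃ * h) (h * h)

    -- Crossing the three segments at a lattice point while passing it on the left.
    around : Matrix
    around = L · (GH true · (U · (GD true · (U · (GV true · L)))))

    -- This is 𝓜 times x₂ x₃ / x₁, since u = x₂ / x₁ and v = x₃ / x₁.
    N : Carrier
    N = 1# + u * u + v * v + k₁ * (v * u) + k₂ * v + k₃ * u

    private
      unit : ∀ {a} x → a ≃ 1# → x * a ≃ x
      unit x a≃1 = CR.trans (CR.*-cong CR.refl a≃1) (CR.*-identityʳ x)

      half : Matrix
      half = (1# + u * u + v * v + k₁ * (v * u) + k₂ * v , u * u + v * v + k₁ * (v * u) + k₂ * v , u * u , u * u)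

      half-≃ : U · (GD true · (U · (GV true · L))) ≃ᴹ half
      half-≃ = entries
        (solve 4 (λ k₁ k₂ v d → let (x , y) = p k₁ k₂ v d in one :* x :+ one :* y
          := one :+ v :* d :* (v :* d) :+ v :* v :+ k₁ :* (v :* (v :* d)) :+ k₂ :* v) CR.refl k₁ k₂ v d)
        (solve 4 (λ k₁ k₂ v d → let (x , y) = q k₁ k₂ v d in one :* x :+ one :* y
          := v :* d :* (v :* d) :+ v :* v :+ k₁ :* (v :* (v :* d)) :+ k₂ :* v) CR.refl k₁ k₂ v d)
        (solve 4 (λ k₁ k₂ v d → let (x , y) = p k₁ k₂ v d in zer :* x :+ one :* y
          := v :* d :* (v :* d)) CR.refl k₁ k₂ v d)
        (solve 4 (λ k₁ k₂ v d → let (x , y) = q k₁ k₂ v d in zer :* x :+ one :* y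
          := v :* d :* (v :* d)) CR.refl k₁ k₂ v d)
        where
        p q : ∀ {n} (k₁ k₂ v d : Polynomial n) → Polynomial n × Polynomial n
        p k₁ k₂ v d = let x = one :* one :+ (k₂ :* v) :* one ; y = zer :* one :+ (v :* v) :* one
                          x′ = one :* x :+ one :* y ; y′ = zer :* x :+ one :* y in
                      (one :* x′ :+ (k₁ :* d) :* y′ , zer :* x′ :+ (d :* d) :* y′)
        q k₁ k₂ v d = let x = one :* zer :+ (k₂ :* v) :* one ; y = zer :* zer :+ (v :* v) :* one
                          x′ = one :* x :+ one :* y ; y′ = zer :* x :+ one :* y in
                      (one :* x′ :+ (k₁ :* d) :* y′ , zer :* x′ :+ (d :* d) :* y′)

      eval : ∀ a → (a + (k₃ * h) * (u * u)) ≃ a + k₃ * u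
      eval a = CR.+-cong CR.refl (CR.trans
        (solve 3 (λ k h u → (k :* h) :* (u :* u) := (k :* u) :* (h :* u)) CR.refl k₃ h u) (unit (k₃ * u) hvd))

      hhuu : (h * h) * (u * u) ≃ 1#
      hhuu = CR.trans (solve 2 (λ h u → (h :* h) :* (u :* u) := (h :* u) :* (h :* u)) CR.refl h u)
               (CR.trans (CR.*-cong hvd hvd) (CR.*-identityˡ 1#))

    around≃Φ : around ≃ᴹ Φ-of N
    around≃Φ = ≃ᴹ-trans (·-cong (≃ᴹ-refl {L}) (≃ᴹ-trans (·-cong (≃ᴹ-refl {GH true}) half-≃) H·half)) (entries
      (solve 1 (λ n → one :* n :+ zer :* one := n) CR.refl N)
      (solve 1 (λ n → one :* (n :+ :- one) :+ zer :* one := n :+ :- one) CR.refl N)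
      (solve 1 (λ n → one :* n :+ one :* one := n :+ one) CR.refl N)
      (solve 1 (λ n → one :* (n :+ :- one) :+ one :* one := n) CR.refl N))
      where
      H·half : GH true · half ≃ᴹ (N , N + - 1# , 1# , 1#)
      H·half = entries
        (CR.trans (CR.+-cong (CR.*-identityˡ _) CR.refl) (eval _))
        (CR.trans (CR.+-cong (CR.*-identityˡ _) CR.refl) (CR.trans (eval _)
          (solve 5 (λ a b c d e → a :+ b :+ c :+ d :+ e := one :+ a :+ b :+ c :+ d :+ e :+ :- one) CR.refl
            (u * u) (v * v) (k₁ * (v * u)) (k₂ * v) (k₃ * u))))
        (CR.trans (CR.+-cong (CR.zeroˡ _) CR.refl) (CR.trans (CR.+-identityˡ _) hhuu))
        (CR.trans (CR.+-cong (CR.zeroˡ _) CR.refl) (CR.trans (CR.+-identityˡ _) hhuu))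

    -- The degenerate walks along the x- and y-axis: inverses of L · GH true · U and U · GV true · L.
    Ω₀₁ Ω₁₀ : Matrix
    Ω₀₁ = (1# + k₃ * u + u * u , - (k₃ * u + u * u) , - (u * u) , u * u)
    Ω₁₀ = (1# , - (1# + k₂ * w) , - 1# , 1# + k₂ * w + w * w)

    Ω₀₁-inverse : Ω₀₁ · (L · (GH true · U)) ≃ᴹ I
    Ω₀₁-inverse = entries
      (solve 3 (λ k h u → (one :+ k :* u :+ u :* u) :* (one :* (one :* one :+ (k :* h) :* zer) :+ zer :* (zer :* one :+ (h :* h) :* zer))
        :+ (:- (k :* u :+ u :* u)) :* (one :* (one :* one :+ (k :* h) :* zer) :+ one :* (zer :* one :+ (h :* h) :* zer)) := one) CR.refl k₃ h u)
      (CR.trans (solve 3 (λ k h u → (one :+ k :* u :+ u :* u) :* (one :* (one :* one :+ (k :* h) :* one) :+ zer :* (zer :* one :+ (h :* h) :* one))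
        :+ (:- (k :* u :+ u :* u)) :* (one :* (one :* one :+ (k :* h) :* one) :+ one :* (zer :* one :+ (h :* h) :* one))
        := one :+ k :* h :+ :- ((k :* h) :* (h :* u)) :+ :- ((h :* h) :* (u :* u))) CR.refl k₃ h u)
        (CR.trans (CR.+-cong (CR.+-cong CR.refl (CR.-‿cong (unit (k₃ * h) hvd))) (CR.-‿cong hhuu))
          (solve 1 (λ x → one :+ x :+ :- x :+ :- one := zer) CR.refl (k₃ * h))))
      (solve 3 (λ k h u → (:- (u :* u)) :* (one :* (one :* one :+ (k :* h) :* zer) :+ zer :* (zer :* one :+ (h :* h) :* zer))
        :+ (u :* u) :* (one :* (one :* one :+ (k :* h) :* zer) :+ one :* (zer :* one :+ (h :* h) :* zer)) := zer) CR.refl k₃ h u)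
      (CR.trans (solve 3 (λ k h u → (:- (u :* u)) :* (one :* (one :* one :+ (k :* h) :* one) :+ zer :* (zer :* one :+ (h :* h) :* one))
        :+ (u :* u) :* (one :* (one :* one :+ (k :* h) :* one) :+ one :* (zer :* one :+ (h :* h) :* one))
        := (h :* h) :* (u :* u)) CR.refl k₃ h u) hhuu)

    Ω₁₀-inverse : (U · (GV true · L)) · Ω₁₀ ≃ᴹ I
    Ω₁₀-inverse = entries
      (solve 3 (λ k v w → let a = one :* one :+ (k :* v) :* one ; b = one :* zer :+ (k :* v) :* one
                              c = zer :* one :+ (v :* v) :* one ; d = zer :* zer :+ (v :* v) :* one in
        (one :* a :+ one :* c) :* one :+ (one :* b :+ one :* d) :* (:- one) := one) CR.refl k₂ v w)
      (CR.trans (solve 3 (λ k v w → let a = one :* one :+ (k :* v) :* one ; b = one :* zer :+ (k :* v) :* one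
                                        c = zer :* one :+ (v :* v) :* one ; d = zer :* zer :+ (v :* v) :* one in
        (one :* a :+ one :* c) :* (:- (one :+ k :* w)) :+ (one :* b :+ one :* d) :* (one :+ k :* w :+ w :* w)
        := :- one :+ :- (k :* w) :+ (k :* w) :* (v :* w) :+ (v :* w) :* (v :* w)) CR.refl k₂ v w)
        (CR.trans (CR.+-cong (CR.+-cong CR.refl (unit (k₂ * w) vw)) (CR.trans (CR.*-cong vw vw) (CR.*-identityˡ 1#)))
          (solve 1 (λ x → :- one :+ :- x :+ x :+ one := zer) CR.refl (k₂ * w))))
      (solve 3 (λ k v w → let a = one :* one :+ (k :* v) :* one ; b = one :* zer :+ (k :* v) :* one
                              c = zer :* one :+ (v :* v) :* one ; d = zer :* zer :+ (v :* v) :* one in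
        (zer :* a :+ one :* c) :* one :+ (zer :* b :+ one :* d) :* (:- one) := zer) CR.refl k₂ v w)
      (CR.trans (solve 3 (λ k v w → let a = one :* one :+ (k :* v) :* one ; b = one :* zer :+ (k :* v) :* one
                                        c = zer :* one :+ (v :* v) :* one ; d = zer :* zer :+ (v :* v) :* one in
        (zer :* a :+ one :* c) :* (:- (one :+ k :* w)) :+ (zer :* b :+ one :* d) :* (one :+ k :* w :+ w :* w)
        := (v :* w) :* (v :* w)) CR.refl k₂ v w)
        (CR.trans (CR.*-cong vw vw) (CR.*-identityˡ 1#)))

    -- The degenerate walk to 0/1 cancels the horizontal crossing at the start of the turn, and what
    -- remains begins with the diagonal.
    Ω₀₁-around : Ω₀₁ · around ≃ᴹ GD true · (U · (GV true · L))
    Ω₀₁-around = begin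
      Ω₀₁ · (L · (GH true · (U · Z)))    ≈⟨ ·-cong ≃ᴹ-refl (·-cong ≃ᴹ-refl (≃ᴹ-sym (·-assoc (GH true) U Z))) ⟩
      Ω₀₁ · (L · (GH true · U · Z))      ≈⟨ ·-cong ≃ᴹ-refl (≃ᴹ-sym (·-assoc L (GH true · U) Z)) ⟩
      Ω₀₁ · (L · (GH true · U) · Z)      ≈⟨ ≃ᴹ-sym (·-assoc Ω₀₁ (L · (GH true · U)) Z) ⟩
      Ω₀₁ · (L · (GH true · U)) · Z      ≈⟨ ·-cong Ω₀₁-inverse ≃ᴹ-refl ⟩
      I · Z                              ≈⟨ ·-identityˡ Z ⟩
      Z ∎
      where
      open MR
      Z = GD true · (U · (GV true · L))

    around-Ω₁₀ : around · Ω₁₀ ≃ᴹ L · (GH true · (U · GD true))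
    around-Ω₁₀ = begin
      L · (GH true · (U · (GD true · Z))) · Ω₁₀      ≈⟨ ·-assoc L (GH true · (U · (GD true · Z))) Ω₁₀ ⟩
      L · (GH true · (U · (GD true · Z)) · Ω₁₀)      ≈⟨ ·-cong ≃ᴹ-refl (·-assoc (GH true) (U · (GD true · Z)) Ω₁₀) ⟩
      L · (GH true · (U · (GD true · Z) · Ω₁₀))      ≈⟨ ·-cong ≃ᴹ-refl (·-cong ≃ᴹ-refl (·-assoc U (GD true · Z) Ω₁₀)) ⟩
      L · (GH true · (U · (GD true · Z · Ω₁₀)))      ≈⟨ ·-cong ≃ᴹ-refl (·-cong ≃ᴹ-refl (·-cong ≃ᴹ-refl (·-assoc (GD true) Z Ω₁₀))) ⟩
      L · (GH true · (U · (GD true · (Z · Ω₁₀))))    ≈⟨ ·-cong ≃ᴹ-refl (·-cong ≃ᴹ-refl (·-cong ≃ᴹ-refl (·-cong ≃ᴹ-refl Ω₁₀-inverse))) ⟩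
      L · (GH true · (U · (GD true · I)))            ≈⟨ ·-cong ≃ᴹ-refl (·-cong ≃ᴹ-refl (·-cong ≃ᴹ-refl (·-identityʳ (GD true)))) ⟩
      L · (GH true · (U · GD true)) ∎
      where
      open MR
      Z = U · (GV true · L)

    -- The diagonal of a square meets the right side in the lower right corner, which is right of γ,
    -- and the top in the upper left corner, which is left of γ. Either exit meets the next diagonal
    -- in the upper right corner, on the opposite side of γ. Hence U before L for a vertical exit
    -- and L before U for a horizontal one.
    stepOf : Bool → Bool → Bool → Matrix
    stepOf true  v h = U · (GV v · L)
    stepOf false v h = L · (GH h · U)

    diagonal step : Side → ℕ × ℕ → Matrix
    diagonal σ (f , g) = GD (σ (odd f) (odd g))
    step σ (f , g) = stepOf (σ (even f) (even g)) (σ (even f) (odd g)) (σ (odd f) (even g))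

    -- The bit of a crossing is the side of the midpoint of the crossed segment.
    Ω : Side → ℕ → ℕ × ℕ → Matrix
    Ω σ zero    P = diagonal σ P
    Ω σ (suc m) P = diagonal σ P · (step σ P · Ω σ m (next σ P))

    Ω-split : ∀ σ m m′ P → Ω σ (m ℕ.+ suc m′) P ≃ᴹ Ω σ m P · (step σ (walk σ m P) · Ω σ m′ (walk σ (suc m) P))
    Ω-split σ zero m′ P = ≃ᴹ-refl
    Ω-split σ (suc m) m′ P = begin
      D · (S · Ω σ (m ℕ.+ suc m′) Q)     ≈⟨ ·-cong ≃ᴹ-refl (·-cong ≃ᴹ-refl (Ω-split σ m m′ Q)) ⟩
      D · (S · (W · K))                  ≈⟨ ·-cong ≃ᴹ-refl (≃ᴹ-sym (·-assoc S W K)) ⟩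
      D · (S · W · K)                    ≈⟨ ≃ᴹ-sym (·-assoc D (S · W) K) ⟩
      D · (S · W) · K ∎
      where
      open MR
      D = diagonal σ P
      S = step σ P
      Q = next σ P
      W = Ω σ m Q
      K = step σ (walk σ m Q) · Ω σ m′ (walk σ (suc m) Q)

    shift : ℕ → ℕ → ℕ × ℕ → ℕ × ℕ
    shift a b (f , g) = (a ℕ.+ f , b ℕ.+ g)

    module Shift (σ τ : Side) (a b : ℕ) where

      -- The bound is 2 h because coordinates are doubled. The origin is left out: strict and weak
      -- sides differ there, and no walk consults it.
      Agree : ℕ → Set
      Agree h = ∀ x y → 0 ℕ.< x ℕ.+ y → x ℕ.+ y ℕ.≤ 2 ℕ.* h → σ (2 ℕ.* a ℕ.+ x) (2 ℕ.* b ℕ.+ y) ≡ τ x y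

      private
        odd-shift : ∀ a f → 2 ℕ.* a ℕ.+ suc (2 ℕ.* f) ≡ suc (2 ℕ.* (a ℕ.+ f))
        odd-shift a f = solveℕ (a ∷ f ∷ [])
        even-shift : ∀ a f → 2 ℕ.* a ℕ.+ 2 ℕ.* suc f ≡ 2 ℕ.* suc (a ℕ.+ f)
        even-shift a f = solveℕ (a ∷ f ∷ [])

        oo : ∀ f g {h} → Agree h → suc (f ℕ.+ g) ℕ.≤ h → σ (odd (a ℕ.+ f)) (odd (b ℕ.+ g)) ≡ τ (odd f) (odd g)
        oo f g {h} H le = subst₂ (λ x y → σ x y ≡ τ (odd f) (odd g)) (odd-shift a f) (odd-shift b g)
          (H (odd f) (odd g) (s≤s z≤n) (lem le))
          where
          lem : suc (f ℕ.+ g) ℕ.≤ h → suc (2 ℕ.* f) ℕ.+ suc (2 ℕ.* g) ℕ.≤ 2 ℕ.* h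
          lem le = lin≤ (scale≤ 2 le) (solveℕ (f ∷ g ∷ h ∷ []))
        ee : ∀ f g {h} → Agree h → suc (suc (f ℕ.+ g)) ℕ.≤ h → σ (even (a ℕ.+ f)) (even (b ℕ.+ g)) ≡ τ (even f) (even g)
        ee f g {h} H le = subst₂ (λ x y → σ x y ≡ τ (even f) (even g)) (even-shift a f) (even-shift b g)
          (H (even f) (even g) (s≤s z≤n) (lem le))
          where
          lem : suc (suc (f ℕ.+ g)) ℕ.≤ h → 2 ℕ.* suc f ℕ.+ 2 ℕ.* suc g ℕ.≤ 2 ℕ.* h
          lem le = lin≤ (scale≤ 2 le) (solveℕ (f ∷ g ∷ h ∷ []))
        eo : ∀ f g {h} → Agree h → suc (suc (f ℕ.+ g)) ℕ.≤ h → σ (even (a ℕ.+ f)) (odd (b ℕ.+ g)) ≡ τ (even f) (odd g)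
        eo f g {h} H le = subst₂ (λ x y → σ x y ≡ τ (even f) (odd g)) (even-shift a f) (odd-shift b g)
          (H (even f) (odd g) (s≤s z≤n) (lem le))
          where
          lem : suc (suc (f ℕ.+ g)) ℕ.≤ h → 2 ℕ.* suc f ℕ.+ suc (2 ℕ.* g) ℕ.≤ 2 ℕ.* h
          lem le = lin≤ (scale≤ 2 le ⊞ z≤n {1}) (solveℕ (f ∷ g ∷ h ∷ []))
        oe : ∀ f g {h} → Agree h → suc (suc (f ℕ.+ g)) ℕ.≤ h → σ (odd (a ℕ.+ f)) (even (b ℕ.+ g)) ≡ τ (odd f) (even g)
        oe f g {h} H le = subst₂ (λ x y → σ x y ≡ τ (odd f) (even g)) (odd-shift a f) (even-shift b g)
          (H (odd f) (even g) (s≤s z≤n) (lem le))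
          where
          lem : suc (suc (f ℕ.+ g)) ℕ.≤ h → suc (2 ℕ.* f) ℕ.+ 2 ℕ.* suc g ℕ.≤ 2 ℕ.* h
          lem le = lin≤ (scale≤ 2 le ⊞ z≤n {1}) (solveℕ (f ∷ g ∷ h ∷ []))

      next-shift : ∀ P {h} → Agree h → suc (suc (height P)) ℕ.≤ h → next σ (shift a b P) ≡ shift a b (next τ P)
      next-shift (f , g) H le rewrite ee f g H le with τ (even f) (even g)
      ... | true  = cong (_, b ℕ.+ g) (sym (ℕP.+-suc a f))
      ... | false = cong (a ℕ.+ f ,_) (sym (ℕP.+-suc b g))

      step-shift : ∀ P {h} → Agree h → suc (suc (height P)) ℕ.≤ h → step σ (shift a b P) ≡ step τ P
      step-shift (f , g) H le = step≡ (ee f g H le) (eo f g H le) (oe f g H le)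
        where
        step≡ : ∀ {a b c a′ b′ c′} → a ≡ a′ → b ≡ b′ → c ≡ c′ → stepOf a b c ≡ stepOf a′ b′ c′
        step≡ refl refl refl = refl

      private
        tighten : ∀ m P {h} → suc (suc m ℕ.+ height P) ℕ.≤ h → suc (m ℕ.+ height (next τ P)) ℕ.≤ h
        tighten m P {h} = subst (λ z → suc z ℕ.≤ h)
          (trans (sym (ℕP.+-suc m (height P))) (cong (m ℕ.+_) (sym (height-next τ P))))
        now : ∀ m P {h} → suc (suc m ℕ.+ height P) ℕ.≤ h → suc (suc (height P)) ℕ.≤ h
        now m P = ℕP.≤-trans (s≤s (s≤s (ℕP.m≤n+m (height P) m)))

      walk-shift : ∀ m P {h} → Agree h → suc (m ℕ.+ height P) ℕ.≤ h → walk σ m (shift a b P) ≡ shift a b (walk τ m P)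
      walk-shift zero P H le = refl
      walk-shift (suc m) P H le = trans (cong (walk σ m) (next-shift P H (now m P le)))
        (walk-shift m (next τ P) H (tighten m P le))

      Ω-shift : ∀ m P {h} → Agree h → suc (m ℕ.+ height P) ℕ.≤ h → Ω σ m (shift a b P) ≡ Ω τ m P
      Ω-shift zero (f , g) H le = cong GD (oo f g H le)
      Ω-shift (suc m) P@(f , g) H le = cong₂ _·_
        (cong GD (oo f g H (ℕP.≤-trans (ℕP.n≤1+n _) (now m P le))))
        (cong₂ _·_ (step-shift P H (now m P le))
          (trans (cong (Ω σ m) (next-shift P H (now m P le))) (Ω-shift m (next τ P) H (tighten m P le))))

    transpose-·₃ : ∀ X Y Z → transpose (X · (Y · Z)) ≃ᴹ transpose Z · (transpose Y · transpose X)
    transpose-·₃ X Y Z = begin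
      transpose (X · (Y · Z))                     ≈⟨ transpose-· X (Y · Z) ⟩
      transpose (Y · Z) · transpose X             ≈⟨ ·-cong (transpose-· Y Z) ≃ᴹ-refl ⟩
      transpose Z · transpose Y · transpose X     ≈⟨ ·-assoc (transpose Z) (transpose Y) (transpose X) ⟩
      transpose Z · (transpose Y · transpose X) ∎
      where open MR

    transpose-G : ∀ b κ x → transpose (G b κ x) ≡ G (not b) κ x
    transpose-G true κ x = refl
    transpose-G false κ x = refl

    -- Transposition reverses the factors and exchanges U and L, so the shape of a step survives and
    -- only its bit is negated.
    transpose-stepOf : ∀ c a b → transpose (stepOf c a b) ≃ᴹ stepOf c (not a) (not b)
    transpose-stepOf true a b = subst (λ Z → transpose (U · (GV a · L)) ≃ᴹ U · (Z · L))
      (transpose-G a (k₂ * v) (v * v)) (transpose-·₃ U (GV a) L)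
    transpose-stepOf false a b = subst (λ Z → transpose (L · (GH b · U)) ≃ᴹ L · (Z · U))
      (transpose-G b (k₃ * h) (h * h)) (transpose-·₃ L (GH b) U)

    -- The half-turn about the midpoint of the segment from (0 , 0) to (q , p) reverses the walk
    -- and exchanges the two sides of the line.
    module HalfTurn (p q : ℕ) (prim : Primitive (suc p) (suc q)) where

      private
        σ σ̃ : Side
        σ = isLeft (suc p) (suc q)
        σ̃ = isLeft≤ (suc p) (suc q)

        odd-reflect : ∀ f f̄ {n} → f̄ ℕ.+ f ≡ n → odd f ℕ.+ odd f̄ ≡ 2 ℕ.* suc n
        odd-reflect f f̄ refl = lem f f̄
          where
          lem : ∀ f f̄ → suc (2 ℕ.* f) ℕ.+ suc (2 ℕ.* f̄) ≡ 2 ℕ.* suc (f̄ ℕ.+ f)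
          lem f f̄ = solveℕ (f ∷ f̄ ∷ [])

        even-reflect : ∀ f f̄ {n} → f̄ ℕ.+ suc f ≡ n → even f ℕ.+ even f̄ ≡ 2 ℕ.* suc n
        even-reflect f f̄ refl = lem f f̄
          where
          lem : ∀ f f̄ → 2 ℕ.* suc f ℕ.+ 2 ℕ.* suc f̄ ≡ 2 ℕ.* suc (f̄ ℕ.+ suc f)
          lem f f̄ = solveℕ (f ∷ f̄ ∷ [])

        double-reflect : ∀ f f̄ {n} → f̄ ℕ.+ f ≡ n → 2 ℕ.* f ℕ.+ even f̄ ≡ 2 ℕ.* suc n
        double-reflect f f̄ refl = lem f f̄
          where
          lem : ∀ f f̄ → 2 ℕ.* f ℕ.+ 2 ℕ.* suc f̄ ≡ 2 ℕ.* suc (f̄ ℕ.+ f)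
          lem f f̄ = solveℕ (f ∷ f̄ ∷ [])

        right-corner : ∀ f g → suc q ℕ.* g ℕ.< suc p ℕ.* suc f → σ (2 ℕ.* suc f) (2 ℕ.* g) ≡ false
        right-corner f g lt = dec-false (suc p ℕ.* (2 ℕ.* suc f) ℕ.<? suc q ℕ.* (2 ℕ.* g)) (ℕP.≤⇒≯ (lem (ℕP.<⇒≤ lt)))
          where
          lem : suc q ℕ.* g ℕ.≤ suc p ℕ.* suc f → suc q ℕ.* (2 ℕ.* g) ℕ.≤ suc p ℕ.* (2 ℕ.* suc f)
          lem le = lin≤ (scale≤ 2 le) (solveℕ (p ∷ q ∷ f ∷ g ∷ []))

        left-corner : ∀ f g → suc p ℕ.* f ℕ.< suc q ℕ.* suc g → σ (2 ℕ.* f) (2 ℕ.* suc g) ≡ true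
        left-corner f g lt = dec-true (suc p ℕ.* (2 ℕ.* f) ℕ.<? suc q ℕ.* (2 ℕ.* suc g)) (lem lt)
          where
          lem : suc p ℕ.* f ℕ.< suc q ℕ.* suc g → suc p ℕ.* (2 ℕ.* f) ℕ.< suc q ℕ.* (2 ℕ.* suc g)
          lem le = lin≤ (scale≤ 2 le ⊞ z≤n {1}) (solveℕ (p ∷ q ∷ f ∷ g ∷ []))

        Opposite : ℕ × ℕ → ℕ × ℕ → Set
        Opposite (f̄ , ḡ) (f , g) = f̄ ℕ.+ f ≡ q × ḡ ℕ.+ g ≡ p

        diagonal-reflect : ∀ P̄ P → Opposite P̄ P → transpose (diagonal σ P) ≡ diagonal σ̃ P̄
        diagonal-reflect (f̄ , ḡ) (f , g) (ef , eg) = trans (transpose-G (σ (odd f) (odd g)) (k₁ * d) (d * d))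
          (cong GD (sym (isLeft≤-reflect (suc p) (suc q) (odd f) (odd g) (odd f̄) (odd ḡ) (odd-reflect f f̄ ef) (odd-reflect g ḡ eg))))

        -- The corner at which the reversed walk decides is the mirror image of the lower left
        -- corner of `next σ P`. That corner is an end of the diagonal of P, so its side is known
        -- from `Crosses`.
        step-reflect : ∀ P̄ P → Crosses (suc p) (suc q) P → Opposite P̄ (next σ P) →
          transpose (step σ P) ≃ᴹ step σ̃ P̄ × Opposite (next σ̃ P̄) P
        step-reflect (f̄ , ḡ) (f , g) (below , above) opp = go (σ (even f) (even g)) refl
          where
          step≡ : ∀ c → σ (even f) (even g) ≡ c → σ̃ (even f̄) (even ḡ) ≡ c →
            stepOf c (not (σ (even f) (odd g))) (not (σ (odd f) (even g))) ≡ stepOf c (σ̃ (even f̄) (odd ḡ)) (σ̃ (odd f̄) (even ḡ)) →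
            transpose (step σ (f , g)) ≃ᴹ step σ̃ (f̄ , ḡ)
          step≡ c eq eq̄ h = ≃ᴹ-trans
            (transpose-cong (≃ᴹ-reflexive (cong (λ c → stepOf c (σ (even f) (odd g)) (σ (odd f) (even g))) eq)))
            (≃ᴹ-trans (transpose-stepOf c (σ (even f) (odd g)) (σ (odd f) (even g)))
              (≃ᴹ-reflexive (trans h (cong (λ c → stepOf c (σ̃ (even f̄) (odd ḡ)) (σ̃ (odd f̄) (even ḡ))) (sym eq̄)))))
          opposite : ∀ b → σ (even f) (even g) ≡ b → Opposite (f̄ , ḡ) (if b then (suc f , g) else (f , suc g))
          opposite b refl = opp
          go : ∀ b → σ (even f) (even g) ≡ b → transpose (step σ (f , g)) ≃ᴹ step σ̃ (f̄ , ḡ) × Opposite (next σ̃ (f̄ , ḡ)) (f , g)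
          go true eq =
            step≡ true eq corner (cong (λ z → stepOf true z false)
              (sym (isLeft≤-reflect (suc p) (suc q) (even f) (odd g) (even f̄) (odd ḡ) (even-reflect f f̄ ef) (odd-reflect g ḡ eg)))) ,
            subst (λ b → Opposite (if b then (suc f̄ , ḡ) else (f̄ , suc ḡ)) (f , g)) (sym corner) (trans (sym (ℕP.+-suc f̄ f)) ef , eg)
            where
            ef = proj₁ (opposite true eq)
            eg = proj₂ (opposite true eq)
            corner = trans (isLeft≤-reflect (suc p) (suc q) (2 ℕ.* suc f) (2 ℕ.* g) (even f̄) (even ḡ)
                       (even-reflect f f̄ ef) (double-reflect g ḡ eg)) (cong not (right-corner f g above))
          go false eq =
            step≡ false eq corner (cong (stepOf false false)
              (sym (isLeft≤-reflect (suc p) (suc q) (odd f) (even g) (odd f̄) (even ḡ) (odd-reflect f f̄ ef) (even-reflect g ḡ eg)))) ,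
            subst (λ b → Opposite (if b then (suc f̄ , ḡ) else (f̄ , suc ḡ)) (f , g)) (sym corner) (ef , trans (sym (ℕP.+-suc ḡ g)) eg)
            where
            ef = proj₁ (opposite false eq)
            eg = proj₂ (opposite false eq)
            corner = trans (isLeft≤-reflect (suc p) (suc q) (2 ℕ.* f) (2 ℕ.* suc g) (even f̄) (even ḡ)
                       (double-reflect f f̄ ef) (even-reflect g ḡ eg)) (cong not (left-corner f g below))

        -- `Ω` unfolds from the front whereas transposition reverses, so the induction splits off
        -- the last square of the walk and matches it with the first square of the reversed one.
        Ω-reflect : ∀ m P̄ → m ℕ.+ 2 ℕ.≤ suc p ℕ.+ suc q → Opposite P̄ (walk σ m (0 , 0)) →
          transpose (Ω σ m (0 , 0)) ≃ᴹ Ω σ̃ m P̄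
        Ω-reflect zero P̄ h opp = ≃ᴹ-reflexive (diagonal-reflect P̄ (0 , 0) opp)
        Ω-reflect (suc m) P̄ h opp = begin
          transpose (Ω σ (suc m) (0 , 0))
            ≈⟨ transpose-cong (subst (λ n → Ω σ n (0 , 0) ≃ᴹ Ω σ m (0 , 0) · (step σ P · diagonal σ (walk σ (suc m) (0 , 0))))
                 (ℕP.+-comm m 1) (Ω-split σ m 0 (0 , 0))) ⟩
          transpose (Ω σ m (0 , 0) · (step σ P · diagonal σ (walk σ (suc m) (0 , 0))))
            ≈⟨ transpose-·₃ (Ω σ m (0 , 0)) (step σ P) (diagonal σ (walk σ (suc m) (0 , 0))) ⟩
          transpose (diagonal σ (walk σ (suc m) (0 , 0))) · (transpose (step σ P) · transpose (Ω σ m (0 , 0)))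
            ≡⟨ cong (_· (transpose (step σ P) · transpose (Ω σ m (0 , 0)))) (diagonal-reflect P̄ (walk σ (suc m) (0 , 0)) opp) ⟩
          diagonal σ̃ P̄ · (transpose (step σ P) · transpose (Ω σ m (0 , 0)))
            ≈⟨ ·-cong ≃ᴹ-refl (·-cong (proj₁ reflected) (Ω-reflect m (next σ̃ P̄) (ℕP.<⇒≤ h) (proj₂ reflected))) ⟩
          diagonal σ̃ P̄ · (step σ̃ P̄ · Ω σ̃ m (next σ̃ P̄)) ∎
          where
          open MR
          P = walk σ m (0 , 0)
          reflected = step-reflect P̄ P
            (Separates.crosses-walk (left-separates prim) m (0 , 0)
              (subst (λ z → z ℕ.+ 2 ℕ.≤ suc p ℕ.+ suc q) (sym (ℕP.+-identityʳ m)) (ℕP.<⇒≤ h)) (crosses-first p q))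
            (subst (Opposite P̄) (walk-suc σ m (0 , 0)) opp)

      Ω-transpose : transpose (Ω σ (p ℕ.+ q) (0 , 0)) ≃ᴹ Ω σ̃ (p ℕ.+ q) (0 , 0)
      Ω-transpose = Ω-reflect (p ℕ.+ q) (0 , 0) (ℕP.≤-reflexive (size p q))
        (subst (Opposite (0 , 0)) (sym (walk-end (left-separates prim))) (refl , refl))
        where
        size : ∀ p q → p ℕ.+ q ℕ.+ 2 ≡ suc p ℕ.+ suc q
        size p q = solveℕ (p ∷ q ∷ [])

    around-split : around ≃ᴹ (L · (GH true · U) · GD true) · (U · (GV true · L))
    around-split = begin
      L · (GH true · (U · (GD true · Z)))    ≈⟨ ·-cong ≃ᴹ-refl (≃ᴹ-sym (·-assoc (GH true) U (GD true · Z))) ⟩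
      L · (GH true · U · (GD true · Z))      ≈⟨ ≃ᴹ-sym (·-assoc L (GH true · U) (GD true · Z)) ⟩
      L · (GH true · U) · (GD true · Z)      ≈⟨ ≃ᴹ-sym (·-assoc (L · (GH true · U)) (GD true) Z) ⟩
      L · (GH true · U) · GD true · Z ∎
      where
      open MR
      Z = U · (GV true · L)

    -- The walk to the mediant from the turn onwards; the lattice point (s , suc r) that it turns
    -- around lies to the left of the line. The parameter s may be 0, so that the neighbour 1/0 is
    -- included.
    module Suffix (p q r s : ℕ) (bez : suc r ℕ.* suc q ≡ 1 ℕ.+ suc p ℕ.* s) where

      private
        τ : Side
        τ = isLeft (suc p ℕ.+ suc r) (suc q ℕ.+ s)

        bez≥ : suc r ℕ.* suc q ℕ.≤ 1 ℕ.+ suc p ℕ.* s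
        bez≥ = ℕP.≤-reflexive bez

        outside : ∀ x y → (suc q ℕ.+ s) ℕ.* y ℕ.≤ (suc p ℕ.+ suc r) ℕ.* x → τ x y ≡ false
        outside x y le = dec-false ((suc p ℕ.+ suc r) ℕ.* x ℕ.<? (suc q ℕ.+ s) ℕ.* y) (ℕP.≤⇒≯ le)

      suffix : Primitive (suc p) (suc q) →
        Ω τ (p ℕ.+ q) (s , suc r) ≃ᴹ transpose (Ω (isLeft (suc p) (suc q)) (p ℕ.+ q) (0 , 0))
      suffix prim = ≃ᴹ-trans
        (subst (λ P → Ω τ (p ℕ.+ q) P ≃ᴹ Ω σ̃ (p ℕ.+ q) (0 , 0))
          (cong₂ _,_ (ℕP.+-identityʳ s) (ℕP.+-identityʳ (suc r)))
          (≃ᴹ-reflexive (Shift.Ω-shift τ σ̃ s (suc r) (p ℕ.+ q) (0 , 0) agree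
            (s≤s (ℕP.≤-reflexive (ℕP.+-identityʳ (p ℕ.+ q)))))))
        (≃ᴹ-sym (HalfTurn.Ω-transpose p q prim))
        where
        σ̃ = isLeft≤ (suc p) (suc q)
        inside : ∀ h → h ℕ.≤ 2 ℕ.* suc (p ℕ.+ q) → h ℕ.< 2 ℕ.* (suc p ℕ.+ suc q)
        inside h le = lin≤ (le ⊞ z≤n {1}) (solveℕ (h ∷ p ∷ q ∷ []))
        agree : Shift.Agree τ σ̃ s (suc r) (suc (p ℕ.+ q))
        agree x y h>0 h≤ = left-concat₂ (suc p) (suc q) (suc r) s x y bez (s≤s z≤n) h>0 (inside (x ℕ.+ y) h≤)

      turn-step : ∀ m → step τ (s , r) · Ω τ m (next τ (s , r)) ≃ᴹ L · (GH false · U) · Ω τ m (s , suc r)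
      turn-step m = ≃ᴹ-reflexive (cong₂ _·_ step≡ (cong (Ω τ m) next≡))
        where
        corner : (suc q ℕ.+ s) ℕ.* (2 ℕ.* suc r) ℕ.≤ (suc p ℕ.+ suc r) ℕ.* (2 ℕ.* suc s)
        corner = lin≤ (scale≤ 2 bez≥ ⊞ z≤n {2 ℕ.* (p ℕ.+ suc r)}) (solveℕ (p ∷ q ∷ r ∷ s ∷ []))
        bit : (suc q ℕ.+ s) ℕ.* (2 ℕ.* suc r) ℕ.≤ (suc p ℕ.+ suc r) ℕ.* suc (2 ℕ.* s)
        bit = lin≤ (scale≤ 2 bez≥ ⊞ z≤n {p ℕ.+ r}) (solveℕ (p ∷ q ∷ r ∷ s ∷ []))
        next≡ : next τ (s , r) ≡ (s , suc r)
        next≡ = cong (λ b → if b then (suc s , r) else (s , suc r)) (outside (even s) (even r) corner)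
        step≡ : step τ (s , r) ≡ L · (GH false · U)
        step≡ = cong₂ (λ b c → stepOf b (τ (even s) (odd r)) c) (outside (even s) (even r) corner) (outside (odd s) (even r) bit)

    module Prefix (p q r s : ℕ) (bez : suc r ℕ.* suc q ≡ 1 ℕ.+ p ℕ.* suc s) where

      private
        τ : Side
        τ = isLeft (p ℕ.+ suc r) (suc q ℕ.+ suc s)

        bez≤ : 1 ℕ.+ p ℕ.* suc s ℕ.≤ suc r ℕ.* suc q
        bez≤ = ℕP.≤-reflexive (sym bez)

        bez≥ : suc r ℕ.* suc q ℕ.≤ 1 ℕ.+ p ℕ.* suc s
        bez≥ = ℕP.≤-reflexive bez

        outside : ∀ x y → (suc q ℕ.+ suc s) ℕ.* y ℕ.≤ (p ℕ.+ suc r) ℕ.* x → τ x y ≡ false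
        outside x y le = dec-false ((p ℕ.+ suc r) ℕ.* x ℕ.<? (suc q ℕ.+ suc s) ℕ.* y) (ℕP.≤⇒≯ le)

      -- Up to height r + s the sides are those for the line to (suc s , suc r), with its tie moved.
      -- Then the square (s , r) is left through its right side, because the lattice point (suc s ,
      -- suc r) is left of the line, and the midpoint of that side counts as right.
      prefix : Primitive (suc r) (suc s) → ∀ m → Ω τ (r ℕ.+ s ℕ.+ suc m) (0 , 0) ≃ᴹ
        transpose (Ω (isLeft (suc r) (suc s)) (r ℕ.+ s) (0 , 0)) · (U · (GV false · L) · Ω τ m (suc s , r))
      prefix prim m = ≃ᴹ-trans (Ω-split τ (r ℕ.+ s) m (0 , 0)) (·-cong
        (≃ᴹ-trans (≃ᴹ-reflexive Ω≡) (≃ᴹ-sym (HalfTurn.Ω-transpose r s prim)))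
        (≃ᴹ-reflexive (cong₂ _·_ (trans (cong (step τ) walk≡) step≡)
          (cong (Ω τ m) (trans (walk-suc τ (r ℕ.+ s) (0 , 0)) (trans (cong (next τ) walk≡) next≡))))))
        where
        σ̃ = isLeft≤ (suc r) (suc s)
        agree : Shift.Agree τ σ̃ 0 0 (suc r ℕ.+ suc s)
        agree x y h>0 h≤ = left-concat₁ p (suc q) (suc r) (suc s) x y bez
          (ℕP.≤-trans (s≤s z≤n) (ℕP.m≤n+m (suc q) p)) h>0 h≤
        room : suc (r ℕ.+ s ℕ.+ 0) ℕ.≤ suc r ℕ.+ suc s
        room = lin≤ (z≤n {1}) (solveℕ (r ∷ s ∷ []))
        Ω≡ : Ω τ (r ℕ.+ s) (0 , 0) ≡ Ω σ̃ (r ℕ.+ s) (0 , 0)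
        Ω≡ = Shift.Ω-shift τ σ̃ 0 0 (r ℕ.+ s) (0 , 0) agree room
        walk≡ : walk τ (r ℕ.+ s) (0 , 0) ≡ (s , r)
        walk≡ = trans (Shift.walk-shift τ σ̃ 0 0 (r ℕ.+ s) (0 , 0) agree room) (walk-end (isLeft≤-separates prim))
        corner : (p ℕ.+ suc r) ℕ.* (2 ℕ.* suc s) ℕ.< (suc q ℕ.+ suc s) ℕ.* (2 ℕ.* suc r)
        corner = lin≤ (scale≤ 2 bez≤ ⊞ z≤n {1}) (solveℕ (p ∷ q ∷ r ∷ s ∷ []))
        corner≡ : τ (even s) (even r) ≡ true
        corner≡ = dec-true ((p ℕ.+ suc r) ℕ.* even s ℕ.<? (suc q ℕ.+ suc s) ℕ.* even r) corner
        bit : (suc q ℕ.+ suc s) ℕ.* suc (2 ℕ.* r) ℕ.≤ (p ℕ.+ suc r) ℕ.* (2 ℕ.* suc s)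
        bit = lin≤ (scale≤ 2 bez≥ ⊞ z≤n {q ℕ.+ s}) (solveℕ (p ∷ q ∷ r ∷ s ∷ []))
        next≡ : next τ (s , r) ≡ (suc s , r)
        next≡ = cong (λ b → if b then (suc s , r) else (s , suc r)) corner≡
        step≡ : step τ (s , r) ≡ U · (GV false · L)
        step≡ = cong₂ (λ b c → stepOf b c (τ (odd s) (even r))) corner≡ (outside (even s) (odd r) bit)

      turn : diagonal τ (suc s , r) ≡ GD false
      turn = cong GD (outside (odd (suc s)) (odd r) le)
        where
        le : (suc q ℕ.+ suc s) ℕ.* suc (2 ℕ.* r) ℕ.≤ (p ℕ.+ suc r) ℕ.* suc (2 ℕ.* suc s)
        le = lin≤ (scale≤ 2 bez≥ ⊞ z≤n {q ℕ.+ s ℕ.+ (p ℕ.+ suc r)}) (solveℕ (p ∷ q ∷ r ∷ s ∷ []))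

    Ωof : ℕ → ℕ → Matrix
    Ωof zero    q       = Ω₀₁
    Ωof (suc p) zero    = Ω₁₀
    Ωof (suc p) (suc q) = Ω (isLeft (suc p) (suc q)) (p ℕ.+ q) (0 , 0)

    private
      Vᵀ : transpose (U · (GV false · L)) ≃ᴹ U · (GV true · L)
      Vᵀ = transpose-stepOf true false false
      Hᵀ : transpose (L · (GH false · U)) ≃ᴹ L · (GH true · U)
      Hᵀ = transpose-stepOf false false false

      assoc-middle : ∀ X Y Z W → (X · Y) · (Z · W) ≃ᴹ X · (Y · Z · W)
      assoc-middle X Y Z W = ≃ᴹ-trans (·-assoc X Y (Z · W)) (·-cong ≃ᴹ-refl (≃ᴹ-sym (·-assoc Y Z W)))

    -- The line to the mediant follows the line to (s , r) first and picks up both parts transposed.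
    -- Transposing the whole removes the inner transposes and makes p/q come first, as in M_{p/q}⁻¹
    -- T M_{r/s}⁻¹.
    Concatenates : ℕ → ℕ → ℕ → ℕ → Set
    Concatenates p q r s = transpose (Ωof (p ℕ.+ r) (q ℕ.+ s)) ≃ᴹ Ωof p q · (around · Ωof r s)

    concat₀₀ : Concatenates 0 1 1 0
    concat₀₀ = begin
      GD true                                 ≈⟨ ≃ᴹ-sym (·-identityʳ (GD true)) ⟩
      GD true · I                             ≈⟨ ·-cong ≃ᴹ-refl (≃ᴹ-sym Ω₁₀-inverse) ⟩
      GD true · (U · (GV true · L) · Ω₁₀)     ≈⟨ ≃ᴹ-sym (·-assoc (GD true) (U · (GV true · L)) Ω₁₀) ⟩
      GD true · (U · (GV true · L)) · Ω₁₀     ≈⟨ ·-cong (≃ᴹ-sym Ω₀₁-around) ≃ᴹ-refl ⟩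
      Ω₀₁ · around · Ω₁₀                      ≈⟨ ·-assoc Ω₀₁ around Ω₁₀ ⟩
      Ω₀₁ · (around · Ω₁₀) ∎
      where open MR

    concat₀ : ∀ s → Concatenates 0 1 1 (suc s)
    concat₀ s = begin
      transpose (Ω τ (suc s) (0 , 0))
        ≈⟨ transpose-cong (subst (λ n → Ω τ n (0 , 0) ≃ᴹ transpose Ωrs · (V · GD false)) (ℕP.+-comm s 1)
             (≃ᴹ-trans (C.prefix prim 0) (·-cong ≃ᴹ-refl (·-cong (≃ᴹ-refl {V})
               (subst (_≃ᴹ GD false) (sym (C.turn)) ≃ᴹ-refl))))) ⟩
      transpose (transpose Ωrs · (V · GD false))     ≈⟨ transpose-·₃ (transpose Ωrs) V (GD false) ⟩
      GD true · (transpose V · Ωrs)                  ≈⟨ ·-cong ≃ᴹ-refl (·-cong Vᵀ ≃ᴹ-refl) ⟩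
      GD true · (U · (GV true · L) · Ωrs)            ≈⟨ ≃ᴹ-sym (·-assoc (GD true) (U · (GV true · L)) Ωrs) ⟩
      GD true · (U · (GV true · L)) · Ωrs            ≈⟨ ·-cong (≃ᴹ-sym Ω₀₁-around) ≃ᴹ-refl ⟩
      Ω₀₁ · around · Ωrs                             ≈⟨ ·-assoc Ω₀₁ around Ωrs ⟩
      Ω₀₁ · (around · Ωrs) ∎
      where
      open MR
      module C = Prefix 0 0 0 s refl
      τ = isLeft 1 (suc (suc s))
      V = U · (GV false · L)
      Ωrs = Ω (isLeft 1 (suc s)) s (0 , 0)
      prim : Primitive 1 (suc s)
      prim = bezout⇒primitive {1} {suc s} 0 1 (inj₂ refl)

    concat₁ : ∀ p → 1 ≡ 1 ℕ.+ p ℕ.* 0 → Concatenates (suc p) 1 1 0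
    concat₁ p bez = begin
      transpose (Ω τ (p ℕ.+ 1 ℕ.+ 0) (0 , 0))
        ≈⟨ transpose-cong (subst (λ n → Ω τ n (0 , 0) ≃ᴹ GD false · (H · transpose Ωpq)) (size p)
             (·-cong (≃ᴹ-reflexive diagonal₀) (≃ᴹ-trans (C.turn-step (p ℕ.+ 0)) (·-cong (≃ᴹ-refl {H}) (C.suffix prim))))) ⟩
      transpose (GD false · (H · transpose Ωpq))     ≈⟨ transpose-·₃ (GD false) H (transpose Ωpq) ⟩
      Ωpq · (transpose H · GD true)                  ≈⟨ ·-cong ≃ᴹ-refl (·-cong Hᵀ ≃ᴹ-refl) ⟩
      Ωpq · (L · (GH true · U) · GD true)            ≈⟨ ·-cong ≃ᴹ-refl (·-assoc L (GH true · U) (GD true)) ⟩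
      Ωpq · (L · (GH true · U · GD true))            ≈⟨ ·-cong ≃ᴹ-refl (·-cong ≃ᴹ-refl (·-assoc (GH true) U (GD true))) ⟩
      Ωpq · (L · (GH true · (U · GD true)))          ≈⟨ ·-cong ≃ᴹ-refl (≃ᴹ-sym around-Ω₁₀) ⟩
      Ωpq · (around · Ω₁₀) ∎
      where
      open MR
      module C = Suffix p 0 0 0 bez
      τ = isLeft (suc p ℕ.+ 1) 1
      H = L · (GH false · U)
      Ωpq = Ω (isLeft (suc p) 1) (p ℕ.+ 0) (0 , 0)
      prim : Primitive (suc p) 1
      prim = bezout⇒primitive {suc p} {1} 1 0 (inj₁ bez)
      size : ∀ p → suc (p ℕ.+ 0) ≡ p ℕ.+ 1 ℕ.+ 0
      size p = solveℕ (p ∷ [])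
      diagonal₀ : diagonal τ (0 , 0) ≡ GD false
      diagonal₀ = cong GD (dec-false ((suc p ℕ.+ 1) ℕ.* 1 ℕ.<? 1) (ℕP.≤⇒≯ (s≤s z≤n)))

    concat₂ : ∀ p q r s → suc r ℕ.* suc q ≡ 1 ℕ.+ suc p ℕ.* suc s → Concatenates (suc p) (suc q) (suc r) (suc s)
    concat₂ p q r s bez = begin
      transpose (Ω τ (p ℕ.+ suc r ℕ.+ (q ℕ.+ suc s)) (0 , 0))
        ≈⟨ transpose-cong (subst (λ n → Ω τ n (0 , 0) ≃ᴹ transpose Ωrs · (V · (GD false · (H · transpose Ωpq)))) (size p q r s)
             (≃ᴹ-trans (C.prefix primrs (suc (p ℕ.+ q))) (·-cong ≃ᴹ-refl (·-cong (≃ᴹ-refl {V})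
               (·-cong (≃ᴹ-reflexive (C.turn))
                 (≃ᴹ-trans (D.turn-step (p ℕ.+ q)) (·-cong (≃ᴹ-refl {H}) (D.suffix primpq)))))))) ⟩
      transpose (transpose Ωrs · (V · (GD false · (H · transpose Ωpq))))
        ≈⟨ transpose-·₃ (transpose Ωrs) V (GD false · (H · transpose Ωpq)) ⟩
      transpose (GD false · (H · transpose Ωpq)) · (transpose V · Ωrs)
        ≈⟨ ·-cong (transpose-·₃ (GD false) H (transpose Ωpq)) (·-cong Vᵀ ≃ᴹ-refl) ⟩
      (Ωpq · (transpose H · GD true)) · (U · (GV true · L) · Ωrs)
        ≈⟨ ·-cong (·-cong ≃ᴹ-refl (·-cong Hᵀ ≃ᴹ-refl)) ≃ᴹ-refl ⟩
      (Ωpq · (L · (GH true · U) · GD true)) · (U · (GV true · L) · Ωrs)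
        ≈⟨ assoc-middle Ωpq (L · (GH true · U) · GD true) (U · (GV true · L)) Ωrs ⟩
      Ωpq · ((L · (GH true · U) · GD true) · (U · (GV true · L)) · Ωrs)
        ≈⟨ ·-cong ≃ᴹ-refl (·-cong (≃ᴹ-sym around-split) ≃ᴹ-refl) ⟩
      Ωpq · (around · Ωrs) ∎
      where
      open MR
      module C = Prefix (suc p) q r s bez
      module D = Suffix p q r (suc s) bez
      τ = isLeft (suc p ℕ.+ suc r) (suc q ℕ.+ suc s)
      V = U · (GV false · L)
      H = L · (GH false · U)
      Ωrs = Ω (isLeft (suc r) (suc s)) (r ℕ.+ s) (0 , 0)
      Ωpq = Ω (isLeft (suc p) (suc q)) (p ℕ.+ q) (0 , 0)
      primpq : Primitive (suc p) (suc q)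
      primpq = bezout⇒primitive {suc p} {suc q} (suc r) (suc s) (inj₁ bez)
      primrs : Primitive (suc r) (suc s)
      primrs = bezout⇒primitive {suc r} {suc s} (suc p) (suc q) (inj₂ bez)
      size : ∀ p q r s → r ℕ.+ s ℕ.+ suc (suc (p ℕ.+ q)) ≡ p ℕ.+ suc r ℕ.+ (q ℕ.+ suc s)
      size p q r s = solveℕ (p ∷ q ∷ r ∷ s ∷ [])

    Ω-concat : ∀ p q r s → r ℕ.* q ≡ 1 ℕ.+ p ℕ.* s → Concatenates p q r s
    Ω-concat p q zero s ()
    Ω-concat p zero (suc r) s bez = contradiction (trans (sym (ℕP.*-zeroʳ r)) bez) λ ()
    -- Here r q = 1, so the neighbours are 0/1 and 1/s.
    Ω-concat zero (suc q) (suc r) s bez = dispatch q r s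
      (ℕP.m*n≡1⇒n≡1 (suc r) (suc q) bez) (ℕP.m*n≡1⇒m≡1 (suc r) (suc q) bez)
      where
      dispatch : ∀ q r s → suc q ≡ 1 → suc r ≡ 1 → Concatenates 0 (suc q) (suc r) s
      dispatch q r zero refl refl = concat₀₀
      dispatch q r (suc s) refl refl = concat₀ s
    Ω-concat (suc p) (suc q) (suc r) zero bez = dispatch q r (ℕP.m*n≡1⇒n≡1 (suc r) (suc q) bez′) (ℕP.m*n≡1⇒m≡1 (suc r) (suc q) bez′)
      where
      bez′ = trans bez (cong suc (ℕP.*-zeroʳ p))
      dispatch : ∀ q r → suc q ≡ 1 → suc r ≡ 1 → Concatenates (suc p) (suc q) (suc r) 0
      dispatch q r refl refl = concat₁ p (cong suc (sym (ℕP.*-zeroʳ p)))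
    Ω-concat (suc p) (suc q) (suc r) (suc s) bez = concat₂ p q r s bez

    module FromΩ (m m′ : Carrier) (mm′ : m * m′ ≃ 1#) where

      fromΩ : Carrier → Matrix → Matrix
      fromΩ s X = conj m m′ (ψ s X)

      -- The transpose in `Ω-concat` is the one that `ψ-product` expects, and `around≃Φ` provides
      -- its middle factor. Conjugation is multiplicative and commutes with `adj`, so it passes to
      -- each factor.
      fromΩ-concat : ∀ {s s′ s″} p q r t → r ℕ.* q ≡ 1 ℕ.+ p ℕ.* t → s″ ≃ s * s′ →
        fromΩ s″ (Ωof (p ℕ.+ r) (q ℕ.+ t)) ≃ᴹ
        adj (fromΩ s (Ωof p q)) · (conj m m′ (T-of N) · adj (fromΩ s′ (Ωof r t)))
      fromΩ-concat {s} {s′} {s″} p q r t bez hs = begin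
        conj m m′ (ψ s″ (Ωof (p ℕ.+ r) (q ℕ.+ t)))
          ≈⟨ conj-cong (ψ-cong hs (transpose-cong (≃ᴹ-trans (Ω-concat p q r t bez) (·-cong ≃ᴹ-refl (·-cong around≃Φ ≃ᴹ-refl))))) ⟩
        conj m m′ (ψ (s * s′) (transpose (Ωof p q · (Φ-of N · Ωof r t))))
          ≈⟨ conj-cong (ψ-product s s′ N (Ωof p q) (Ωof r t)) ⟩
        conj m m′ (adj X · (T-of N · adj Y))                              ≈⟨ ≃ᴹ-sym (conj-· mm′ (adj X) (T-of N · adj Y)) ⟩
        conj m m′ (adj X) · conj m m′ (T-of N · adj Y)                    ≈⟨ ·-cong ≃ᴹ-refl (≃ᴹ-sym (conj-· mm′ (T-of N) (adj Y))) ⟩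
        conj m m′ (adj X) · (conj m m′ (T-of N) · conj m m′ (adj Y))      ≈⟨ ·-cong (≃ᴹ-sym (adj-conj m m′ X)) (·-cong ≃ᴹ-refl (≃ᴹ-sym (adj-conj m m′ Y))) ⟩
        adj (conj m m′ X) · (conj m m′ (T-of N) · adj (conj m m′ Y)) ∎
        where
        open MR
        X = ψ s (Ωof p q)
        Y = ψ s′ (Ωof r t)

      fromΩ-Ω₀₁ : ∀ s → s * u ≃ 1# →
        fromΩ s Ω₀₁ ≃ᴹ (s , m * s , - ((m′ * s) * (1# + k₃ * u + u * u)) , - s + - k₃)
      fromΩ-Ω₀₁ s su = entries
        (solve 3 (λ s k u → s :* ((one :+ k :* u :+ u :* u) :+ :- (k :* u :+ u :* u)) := s) CR.refl s k₃ u)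
        (solve 4 (λ m s k u → m :* (s :* ((one :+ k :* u :+ u :* u) :+ :- (k :* u :+ u :* u) :+ :- (u :* u) :+ u :* u)) := m :* s) CR.refl m s k₃ u)
        (solve 3 (λ m s x → m :* (:- (s :* x)) := :- ((m :* s) :* x)) CR.refl m′ s (1# + k₃ * u + u * u))
        (CR.trans (solve 3 (λ s k u → :- (s :* ((one :+ k :* u :+ u :* u) :+ :- (u :* u))) := :- s :+ :- (k :* (s :* u))) CR.refl s k₃ u)
          (CR.+-cong CR.refl (CR.-‿cong (unit k₃ su))))

      fromΩ-Ω₁₀ : fromΩ v Ω₁₀ ≃ᴹ (- k₂ , m * w , - (m′ * v) , 0#)
      fromΩ-Ω₁₀ = entries
        (CR.trans (solve 3 (λ v k w → v :* (one :+ :- (one :+ k :* w)) := :- (k :* (v :* w))) CR.refl v k₂ w) (CR.-‿cong (unit k₂ vw)))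
        (CR.trans (solve 4 (λ m v k w → m :* (v :* (one :+ :- (one :+ k :* w) :+ :- one :+ (one :+ k :* w :+ w :* w))) := (m :* w) :* (v :* w)) CR.refl m v k₂ w)
          (unit (m * w) vw))
        (solve 2 (λ m v → m :* (:- (v :* one)) := :- (m :* v)) CR.refl m′ v)
        (solve 1 (λ v → :- (v :* (one :+ :- one)) := zer) CR.refl v)

      conj-T : conj m m′ (T-of N) ≃ᴹ T-of (m′ + m′ * (u * u) + m′ * (v * v) + k₁ * (m′ * (v * u)) + k₂ * (m′ * v) + k₃ * (m′ * u))
      conj-T = entries CR.refl (CR.zeroʳ m)
        (solve 6 (λ m k₁ k₂ k₃ v u → m :* (one :+ u :* u :+ v :* v :+ k₁ :* (v :* u) :+ k₂ :* v :+ k₃ :* u)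
          := m :+ m :* (u :* u) :+ m :* (v :* v) :+ k₁ :* (m :* (v :* u)) :+ k₂ :* (m :* v) :+ k₃ :* (m :* u)) CR.refl m′ k₁ k₂ k₃ v u)
        CR.refl

      -- The vector (1 , 1) leaves the last element of the fence free and (1 , 0) excludes it. In
      -- the resulting pair the first coordinate excludes the first element, and the sum of both
      -- leaves it free. These four choices are the four sums in M_{p/q}.
      fromΩ-entries : ∀ {s b c fo fi xo xi} X → b ≃ m * s → c ≃ m′ * s →
        (fo , fi) ≃ᵛ act X (1# , 1#) → (xo , xi) ≃ᵛ act X (1# , 0#) →
        (s * fo , b * (fo + fi) , - (c * xo) , - (s * (xo + xi))) ≃ᴹ fromΩ s X
      fromΩ-entries {s} (a , b′ , c′ , d′) hb hc (both f₀ f₁) (both x₀ x₁) = entries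
        (CR.trans (CR.*-cong CR.refl f₀) (solve 3 (λ s a b → s :* (a :* one :+ b :* one) := s :* (a :+ b)) CR.refl s a b′))
        (CR.trans (CR.*-cong hb (CR.+-cong f₀ f₁))
          (solve 6 (λ m s a b c d → (m :* s) :* ((a :* one :+ b :* one) :+ (c :* one :+ d :* one)) := m :* (s :* (a :+ b :+ c :+ d))) CR.refl m s a b′ c′ d′))
        (CR.trans (CR.-‿cong (CR.*-cong hc x₀)) (solve 4 (λ m s a b → :- ((m :* s) :* (a :* one :+ b :* zer)) := m :* (:- (s :* a))) CR.refl m′ s a b′))
        (CR.trans (CR.-‿cong (CR.*-cong CR.refl (CR.+-cong x₀ x₁)))
          (solve 5 (λ s a b c d → :- (s :* ((a :* one :+ b :* zer) :+ (c :* one :+ d :* zer))) := :- (s :* (a :+ c))) CR.refl s a b′ c′ d′))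

      det-fromΩ : ∀ s X → det (fromΩ s X) ≃ (s * s) * det X
      det-fromΩ s (a , b , c , d) = CR.trans
        (solve 7 (λ m m′ s a b c d → (s :* (a :+ b)) :* (:- (s :* (a :+ c))) :+ :- ((m :* (s :* (a :+ b :+ c :+ d))) :* (m′ :* (:- (s :* a))))
          := (s :* (a :+ b)) :* (:- (s :* (a :+ c))) :+ ((s :* (a :+ b :+ c :+ d)) :* (s :* a)) :* (m :* m′)) CR.refl m m′ s a b c d)
        (CR.trans (CR.+-cong CR.refl (unit ((s * (a + b + c + d)) * (s * a)) mm′))
          (solve 5 (λ s a b c d → (s :* (a :+ b)) :* (:- (s :* (a :+ c))) :+ (s :* (a :+ b :+ c :+ d)) :* (s :* a)
            := (s :* s) :* (a :* d :+ :- (b :* c))) CR.refl s a b c d))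

      trace-fromΩ : ∀ s X → trace (fromΩ s X) ≃ s * (ent₁₂ X + - ent₁₂ (transpose X))
      trace-fromΩ s (a , b , c , d) = solve 4 (λ s a b c → s :* (a :+ b) :+ :- (s :* (a :+ c)) := s :* (b :+ :- c)) CR.refl s a b c

      private
        square-unit : ∀ {x y} → x * y ≃ 1# → (x * x) * (y * y) ≃ 1#
        square-unit {x} {y} h = CR.trans (solve 2 (λ x y → (x :* x) :* (y :* y) := (x :* y) :* (x :* y)) CR.refl x y)
          (CR.trans (CR.*-cong h h) (CR.*-identityˡ 1#))

      det-fromΩ₀₁ : ∀ s → s * u ≃ 1# → det (fromΩ s Ω₀₁) ≃ 1#
      det-fromΩ₀₁ s su = CR.trans (det-fromΩ s Ω₀₁) (CR.trans (CR.*-cong CR.refl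
        (solve 2 (λ k u → (one :+ k :* u :+ u :* u) :* (u :* u) :+ :- ((:- (k :* u :+ u :* u)) :* (:- (u :* u))) := u :* u) CR.refl k₃ u))
        (square-unit su))

      trace-fromΩ₀₁ : ∀ s → s * u ≃ 1# → trace (fromΩ s Ω₀₁) ≃ - k₃
      trace-fromΩ₀₁ s su = CR.trans (trace-fromΩ s Ω₀₁) (CR.trans
        (solve 3 (λ s k u → s :* (:- (k :* u :+ u :* u) :+ :- (:- (u :* u))) := :- (k :* (s :* u))) CR.refl s k₃ u)
        (CR.-‿cong (unit k₃ su)))

      det-fromΩ₁₀ : det (fromΩ v Ω₁₀) ≃ 1#
      det-fromΩ₁₀ = CR.trans (det-fromΩ v Ω₁₀) (CR.trans (CR.*-cong CR.refl
        (solve 2 (λ k w → one :* (one :+ k :* w :+ w :* w) :+ :- ((:- (one :+ k :* w)) :* (:- one)) := w :* w) CR.refl k₂ w))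
        (square-unit vw))

      trace-fromΩ₁₀ : trace (fromΩ v Ω₁₀) ≃ - k₂
      trace-fromΩ₁₀ = CR.trans (trace-fromΩ v Ω₁₀) (CR.trans
        (solve 3 (λ v k w → v :* (:- (one :+ k :* w) :+ :- (:- one)) := :- (k :* (v :* w))) CR.refl v k₂ w)
        (CR.-‿cong (unit k₂ vw)))

      trace-fromΩ₁₁ : ∀ s → s * d ≃ 1# → trace (fromΩ s (GD false)) ≃ - k₁
      trace-fromΩ₁₁ s sd = CR.trans (trace-fromΩ s (GD false)) (CR.trans
        (solve 3 (λ s k d → s :* (zer :+ :- (k :* d)) := :- (k :* (s :* d))) CR.refl s k₁ d)
        (CR.-‿cong (unit k₁ sd)))

      ent₁₂-fromΩ₁₁ : ∀ s x → x * ent₁₂ (fromΩ s (GD false)) ≃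
        (x * (m * s)) * (d * d) + k₁ * ((x * (m * s)) * d) + x * (m * s)
      ent₁₂-fromΩ₁₁ s x = solve 5 (λ m s x k d → x :* (m :* (s :* (one :+ zer :+ k :* d :+ d :* d)))
        := (x :* (m :* s)) :* (d :* d) :+ k :* ((x :* (m :* s)) :* d) :+ x :* (m :* s)) CR.refl m s x k₁ d

open import Defs

-- Laurent polynomials

exp≡ : ∀ {a b c a′ b′ c′ : ℤ} → a ≡ a′ → b ≡ b′ → c ≡ c′ → (a , b , c) ≡ (a′ , b′ , c′)
exp≡ refl refl refl = refl

+ᵉ-comm : ∀ e f → e +ᵉ f ≡ f +ᵉ e
+ᵉ-comm (a , b , c) (a′ , b′ , c′) = exp≡ (ℤP.+-comm a a′) (ℤP.+-comm b b′) (ℤP.+-comm c c′)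

+ᵉ-assoc : ∀ e f g → (e +ᵉ f) +ᵉ g ≡ e +ᵉ (f +ᵉ g)
+ᵉ-assoc (a , b , c) (a′ , b′ , c′) (a″ , b″ , c″) =
  exp≡ (ℤP.+-assoc a a′ a″) (ℤP.+-assoc b b′ b″) (ℤP.+-assoc c c′ c″)

+ᵉ-identityˡ : ∀ e → 0ᵉ +ᵉ e ≡ e
+ᵉ-identityˡ (a , b , c) = exp≡ (ℤP.+-identityˡ a) (ℤP.+-identityˡ b) (ℤP.+-identityˡ c)

[e+f]-e≡f : ∀ e f → (e +ᵉ f) -ᵉ e ≡ f
[e+f]-e≡f (a , b , c) (a′ , b′ , c′) = exp≡ (lem a a′) (lem b b′) (lem c c′)
  where
  lem : ∀ x y → (x ℤ.+ y) ℤ.- x ≡ y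
  lem = solve 2 (λ x y → (x :+ y) :- x := y) refl where open ℤSolver

e+[f-e]≡f : ∀ e f → e +ᵉ (f -ᵉ e) ≡ f
e+[f-e]≡f (a , b , c) (a′ , b′ , c′) = exp≡ (lem a a′) (lem b b′) (lem c c′)
  where
  lem : ∀ x y → x ℤ.+ (y ℤ.- x) ≡ y
  lem = solve 2 (λ x y → x :+ (y :- x) := y) refl where open ℤSolver

coeff-++ : ∀ p q e → coeff (p ++ q) e ≡ coeff p e ℚ.+ coeff q e
coeff-++ [] q e = sym (ℚP.+-identityˡ _)
coeff-++ ((c , f) ∷ p) q e with does (f ≟ᵉ e)
... | true  = trans (cong (c ℚ.+_) (coeff-++ p q e)) (sym (ℚP.+-assoc c _ _))
... | false = coeff-++ p q e

coeff-⊝ : ∀ p e → coeff (⊝ p) e ≡ ℚ.- coeff p e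
coeff-⊝ [] e = refl
coeff-⊝ ((c , f) ∷ p) e with does (f ≟ᵉ e)
... | true  = trans (cong (ℚ.- c ℚ.+_) (coeff-⊝ p e)) (sym (ℚP.neg-distrib-+ c _))
... | false = coeff-⊝ p e

coeff-term⊗ : ∀ c f q e → coeff (term c f ⊗ q) e ≡ c ℚ.* coeff q (e -ᵉ f)
coeff-term⊗ c f [] e = sym (ℚP.*-zeroʳ c)
coeff-term⊗ c f ((d , g) ∷ q) e with (f +ᵉ g) ≟ᵉ e | g ≟ᵉ (e -ᵉ f)
... | yes _ | yes _ = trans (cong (c ℚ.* d ℚ.+_) (coeff-term⊗ c f q e)) (sym (ℚP.*-distribˡ-+ c d _))
... | yes p | no ¬q = contradiction (trans (sym ([e+f]-e≡f f g)) (cong (_-ᵉ f) p)) ¬q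
... | no ¬p | yes q = contradiction (trans (cong (f +ᵉ_) q) (e+[f-e]≡f f e)) ¬p
... | no _ | no _ = coeff-term⊗ c f q e

⊗-∷ : ∀ c f p q → ((c , f) ∷ p) ⊗ q ≡ (term c f ⊗ q) ++ (p ⊗ q)
⊗-∷ c f p q = cong (_++ (p ⊗ q)) (sym (ListP.++-identityʳ _))

infix 4 _≋_

-- Wrapping _≈_ in a record keeps its two sides recoverable by unification.
record _≋_ (p q : LP) : Set where
  constructor ≈⇒≋
  field ≋⇒≈ : p ≈ q
open _≋_ public

≡⇒≋ : ∀ {p q} → p ≡ q → p ≋ q
≡⇒≋ refl = ≈⇒≋ λ e → refl

≋-refl : ∀ {p} → p ≋ p
≋-refl = ≡⇒≋ refl

≋-sym : ∀ {p q} → p ≋ q → q ≋ p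
≋-sym (≈⇒≋ eq) = ≈⇒≋ λ e → sym (eq e)

≋-trans : ∀ {p q r} → p ≋ q → q ≋ r → p ≋ r
≋-trans (≈⇒≋ eq) (≈⇒≋ eq′) = ≈⇒≋ λ e → trans (eq e) (eq′ e)

⊕-cong : ∀ {p p′ q q′} → p ≋ p′ → q ≋ q′ → p ⊕ q ≋ p′ ⊕ q′
⊕-cong {p} {p′} {q} {q′} (≈⇒≋ eq) (≈⇒≋ eq′) = ≈⇒≋ λ e →
  trans (coeff-++ p q e) (trans (cong₂ ℚ._+_ (eq e) (eq′ e)) (sym (coeff-++ p′ q′ e)))

⊕-comm : ∀ p q → p ⊕ q ≋ q ⊕ p
⊕-comm p q = ≈⇒≋ λ e →
  trans (coeff-++ p q e) (trans (ℚP.+-comm (coeff p e) _) (sym (coeff-++ q p e)))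

⊝-cong : ∀ {p q} → p ≋ q → ⊝ p ≋ ⊝ q
⊝-cong {p} {q} (≈⇒≋ eq) = ≈⇒≋ λ e →
  trans (coeff-⊝ p e) (trans (cong ℚ.-_ (eq e)) (sym (coeff-⊝ q e)))

⊝-inverseʳ : ∀ p → p ⊕ (⊝ p) ≋ 𝟘
⊝-inverseʳ p = ≈⇒≋ λ e →
  trans (coeff-++ p (⊝ p) e) (trans (cong (coeff p e ℚ.+_) (coeff-⊝ p e)) (ℚP.+-inverseʳ (coeff p e)))

coeff-⊗-∷ : ∀ c f p q e → coeff (((c , f) ∷ p) ⊗ q) e ≡ c ℚ.* coeff q (e -ᵉ f) ℚ.+ coeff (p ⊗ q) e
coeff-⊗-∷ c f p q e rewrite ⊗-∷ c f p q | coeff-++ (term c f ⊗ q) (p ⊗ q) e | coeff-term⊗ c f q e = refl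

⊗-congʳ : ∀ p {q q′} → q ≋ q′ → p ⊗ q ≋ p ⊗ q′
⊗-congʳ [] eq = ≋-refl
⊗-congʳ ((c , f) ∷ p) {q} {q′} (≈⇒≋ eq) = ≈⇒≋ λ e →
  trans (coeff-⊗-∷ c f p q e)
    (trans (cong₂ ℚ._+_ (cong (c ℚ.*_) (eq (e -ᵉ f))) (≋⇒≈ (⊗-congʳ p (≈⇒≋ eq)) e))
           (sym (coeff-⊗-∷ c f p q′ e)))

⊗-distribʳ : ∀ r p q → (p ⊕ q) ⊗ r ≡ (p ⊗ r) ⊕ (q ⊗ r)
⊗-distribʳ r [] q = refl
⊗-distribʳ r ((c , f) ∷ p) q =
  trans (cong (map _ r ++_) (⊗-distribʳ r p q)) (sym (ListP.++-assoc (map _ r) (p ⊗ r) (q ⊗ r)))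

⊗-zeroʳ : ∀ p → p ⊗ 𝟘 ≡ 𝟘
⊗-zeroʳ [] = refl
⊗-zeroʳ (t ∷ p) = ⊗-zeroʳ p

⊕-swap : ∀ p q r s → (p ⊕ q) ⊕ (r ⊕ s) ≋ (p ⊕ r) ⊕ (q ⊕ s)
⊕-swap p q r s = ≈⇒≋ lem
  where
  lem : (p ⊕ q) ⊕ (r ⊕ s) ≈ (p ⊕ r) ⊕ (q ⊕ s)
  lem e
    rewrite coeff-++ (p ++ q) (r ++ s) e | coeff-++ (p ++ r) (q ++ s) e | coeff-++ p q e | coeff-++ r s e
    | coeff-++ p r e | coeff-++ q s e
    = solve 4 (λ a b c d → (a :+ b) :+ (c :+ d) := (a :+ c) :+ (b :+ d)) refl (coeff p e) (coeff q e) (coeff r e) (coeff s e)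
    where open ℚSolver

term⊗-distribˡ : ∀ c f p q → term c f ⊗ (p ⊕ q) ≡ (term c f ⊗ p) ⊕ (term c f ⊗ q)
term⊗-distribˡ c f [] q = refl
term⊗-distribˡ c f (t ∷ p) q = cong (_ ∷_) (term⊗-distribˡ c f p q)

⊗-distribˡ : ∀ r p q → r ⊗ (p ⊕ q) ≋ (r ⊗ p) ⊕ (r ⊗ q)
⊗-distribˡ [] p q = ≋-refl
⊗-distribˡ ((c , f) ∷ r) p q
  rewrite ⊗-∷ c f r (p ⊕ q) | ⊗-∷ c f r p | ⊗-∷ c f r q | term⊗-distribˡ c f p q
  = ≋-trans (⊕-cong ≋-refl (⊗-distribˡ r p q)) (⊕-swap (term c f ⊗ p) (term c f ⊗ q) (r ⊗ p) (r ⊗ q))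

term-⊗-comm : ∀ c f q → term c f ⊗ q ≡ q ⊗ term c f
term-⊗-comm c f [] = refl
term-⊗-comm c f ((d , g) ∷ q) =
  cong₂ _∷_ (cong₂ _,_ (ℚP.*-comm c d) (+ᵉ-comm f g)) (term-⊗-comm c f q)

⊗-comm : ∀ p q → p ⊗ q ≋ q ⊗ p
⊗-comm [] q = ≡⇒≋ (sym (⊗-zeroʳ q))
⊗-comm ((c , f) ∷ p) q =
  ≋-trans (≡⇒≋ (⊗-∷ c f p q))
    (≋-trans (⊕-cong (≡⇒≋ (term-⊗-comm c f q)) (⊗-comm p q))
             (≋-sym (⊗-distribˡ q (term c f) p)))

⊗-cong : ∀ {p p′ q q′} → p ≋ p′ → q ≋ q′ → p ⊗ q ≋ p′ ⊗ q′
⊗-cong {p} {p′} {q} {q′} eq eq′ =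
  ≋-trans (⊗-congʳ p eq′) (≋-trans (⊗-comm p q′) (≋-trans (⊗-congʳ q′ eq) (⊗-comm q′ p′)))

term-⊗-assoc₂ : ∀ c f d g r → (term c f ⊗ term d g) ⊗ r ≡ term c f ⊗ (term d g ⊗ r)
term-⊗-assoc₂ c f d g [] = refl
term-⊗-assoc₂ c f d g ((a , h) ∷ r) =
  cong₂ _∷_ (cong₂ _,_ (ℚP.*-assoc c d a) (+ᵉ-assoc f g h)) (term-⊗-assoc₂ c f d g r)

term-⊗-assoc : ∀ c f q r → (term c f ⊗ q) ⊗ r ≡ term c f ⊗ (q ⊗ r)
term-⊗-assoc c f [] r = refl
term-⊗-assoc c f ((d , g) ∷ q) r =
  trans (⊗-∷ (c ℚ.* d) (f +ᵉ g) (term c f ⊗ q) r)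
    (trans (cong₂ _⊕_ (term-⊗-assoc₂ c f d g r) (term-⊗-assoc c f q r))
      (trans (sym (term⊗-distribˡ c f (term d g ⊗ r) (q ⊗ r)))
             (cong (term c f ⊗_) (sym (⊗-∷ d g q r)))))

⊗-assoc : ∀ p q r → (p ⊗ q) ⊗ r ≡ p ⊗ (q ⊗ r)
⊗-assoc [] q r = refl
⊗-assoc ((c , f) ∷ p) q r =
  trans (cong (_⊗ r) (⊗-∷ c f p q))
    (trans (⊗-distribʳ r (term c f ⊗ q) (p ⊗ q))
      (trans (cong₂ _⊕_ (term-⊗-assoc c f q r) (⊗-assoc p q r))
             (sym (⊗-∷ c f p (q ⊗ r)))))

⊗-identityˡ : ∀ p → 𝟙 ⊗ p ≡ p
⊗-identityˡ [] = refl
⊗-identityˡ ((c , f) ∷ p) = cong₂ _∷_ (cong₂ _,_ (ℚP.*-identityˡ c) (+ᵉ-identityˡ f)) (⊗-identityˡ p)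

term-cong : ∀ {c d e f} → c ≡ d → e ≡ f → term c e ≋ term d f
term-cong refl refl = ≋-refl

term-+ : ∀ c d e → term (c ℚ.+ d) e ≋ term c e ⊕ term d e
term-+ c d e = ≈⇒≋ lem
  where
  lem : term (c ℚ.+ d) e ≈ term c e ⊕ term d e
  lem f with does (e ≟ᵉ f)
  ... | true = ℚP.+-assoc c d 0ℚ
  ... | false = refl

term-0 : ∀ e → term 0ℚ e ≋ 𝟘
term-0 e = ≈⇒≋ lem
  where
  lem : term 0ℚ e ≈ 𝟘
  lem f with does (e ≟ᵉ f)
  ... | true = refl
  ... | false = refl

-- The zero is represented by the constant cst 0ℚ, so that both units of the ring are
-- definitionally values of the coefficient embedding cst.
LP-isCommutativeRing : IsCommutativeRing _≋_ _⊕_ _⊗_ ⊝_ (cst 0ℚ) (cst 1ℚ)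
LP-isCommutativeRing = record
  { isRing = record
    { +-isAbelianGroup = record
      { isGroup = record
        { isMonoid = record
          { isSemigroup = record
            { isMagma = record
              { isEquivalence = record { refl = ≋-refl ; sym = ≋-sym ; trans = ≋-trans }
              ; ∙-cong = ⊕-cong }
            ; assoc = λ p q r → ≡⇒≋ (ListP.++-assoc p q r) }
          ; identity = (λ p → ⊕-cong (term-0 0ᵉ) (≋-refl {p})) , λ p →
              ≋-trans (⊕-comm p (cst 0ℚ)) (⊕-cong (term-0 0ᵉ) (≋-refl {p})) }
        ; inverse = (λ p → ≋-trans (⊕-comm (⊝ p) p) (⊝-inverseʳ′ p)) , ⊝-inverseʳ′
        ; ⁻¹-cong = ⊝-cong }
      ; comm = ⊕-comm }
    ; *-cong = ⊗-cong
    ; *-assoc = λ p q r → ≡⇒≋ (⊗-assoc p q r)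
    ; *-identity = (λ p → ≡⇒≋ (⊗-identityˡ p)) , λ p → ≋-trans (⊗-comm p 𝟙) (≡⇒≋ (⊗-identityˡ p))
    ; distrib = ⊗-distribˡ , λ r p q → ≡⇒≋ (⊗-distribʳ r p q) }
  ; *-comm = ⊗-comm }
  where
  ⊝-inverseʳ′ : ∀ p → p ⊕ (⊝ p) ≋ cst 0ℚ
  ⊝-inverseʳ′ p = ≋-trans (⊝-inverseʳ p) (≋-sym (term-0 0ᵉ))

-- Sorted lists of crossings

module Sorting where

  open import Data.List.Relation.Unary.All using ([]; _∷_)
  open import Data.List.Relation.Unary.AllPairs using ([]; _∷_)

  _<ₜ_ : Crossing → Crossing → Set
  c <ₜ d = Crossing.t c ℚ.< Crossing.t d

  insertC-∈⁺ : ∀ {x} c ds → x ≡ c ⊎ x ∈ ds → x ∈ insertC c ds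
  insertC-∈⁺ c [] (inj₁ refl) = here refl
  insertC-∈⁺ c (d ∷ ds) h with Crossing.t c ℚP.≤? Crossing.t d | h
  ... | yes _  | inj₁ refl = here refl
  ... | yes _  | inj₂ x∈ = there x∈
  ... | no _ | inj₁ eq = there (insertC-∈⁺ c ds (inj₁ eq))
  ... | no _ | inj₂ (here eq) = here eq
  ... | no _ | inj₂ (there x∈) = there (insertC-∈⁺ c ds (inj₂ x∈))

  insertC-∈⁻ : ∀ {x} c ds → x ∈ insertC c ds → x ≡ c ⊎ x ∈ ds
  insertC-∈⁻ c [] (here eq) = inj₁ eq
  insertC-∈⁻ c (d ∷ ds) h with Crossing.t c ℚP.≤? Crossing.t d | h
  ... | yes _  | here eq = inj₁ eq
  ... | yes _  | there x∈ = inj₂ x∈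
  ... | no _ | here eq = inj₂ (here eq)
  ... | no _ | there x∈ with insertC-∈⁻ c ds x∈
  ...   | inj₁ eq = inj₁ eq
  ...   | inj₂ x∈′ = inj₂ (there x∈′)

  sortC-∈⁺ : ∀ {x} cs → x ∈ cs → x ∈ sortC cs
  sortC-∈⁺ (c ∷ cs) (here eq) = insertC-∈⁺ c (sortC cs) (inj₁ eq)
  sortC-∈⁺ (c ∷ cs) (there x∈) = insertC-∈⁺ c (sortC cs) (inj₂ (sortC-∈⁺ cs x∈))

  sortC-∈⁻ : ∀ {x} cs → x ∈ sortC cs → x ∈ cs
  sortC-∈⁻ (c ∷ cs) x∈ with insertC-∈⁻ c (sortC cs) x∈
  ... | inj₁ eq = here eq
  ... | inj₂ x∈′ = there (sortC-∈⁻ cs x∈′)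

  insertC-sorted : ∀ c ds → AllPairs _<ₜ_ ds → All (λ d → Crossing.t c ≢ Crossing.t d) ds → AllPairs _<ₜ_ (insertC c ds)
  insertC-sorted c [] [] [] = [] ∷ []
  insertC-sorted c (d ∷ ds) (d< ∷ ds<) (c≢d ∷ c≢) with Crossing.t c ℚP.≤? Crossing.t d
  ... | yes c≤d = (c<d ∷ All.map (ℚP.<-trans c<d) d<) ∷ (d< ∷ ds<)
    where c<d = ℚP.≰⇒> λ d≤c → c≢d (ℚP.≤-antisym c≤d d≤c)
  ... | no c≰d = All.tabulate below ∷ insertC-sorted c ds ds< c≢
    where
    below : ∀ {x} → x ∈ insertC c ds → d <ₜ x
    below x∈ with insertC-∈⁻ c ds x∈
    ... | inj₁ refl = ℚP.≰⇒> c≰d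
    ... | inj₂ x∈ds = All.lookup d< x∈ds

  sortC-sorted : ∀ cs → AllPairs (λ c d → Crossing.t c ≢ Crossing.t d) cs → AllPairs _<ₜ_ (sortC cs)
  sortC-sorted [] [] = []
  sortC-sorted (c ∷ cs) (c≢ ∷ cs≢) = insertC-sorted c (sortC cs) (sortC-sorted cs cs≢)
    (All.tabulate λ x∈ → All.lookup c≢ (sortC-∈⁻ cs x∈))

  -- Used to identify the sorted list of intersections with the list of crossings along the walk,
  -- whose order is known geometrically.
  sorted-unique : ∀ {xs ys} → AllPairs _<ₜ_ xs → AllPairs _<ₜ_ ys →
                  (∀ {x} → x ∈ xs → x ∈ ys) → (∀ {x} → x ∈ ys → x ∈ xs) → xs ≡ ys
  sorted-unique {[]} {[]} _ _ _ _ = refl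
  sorted-unique {[]} {y ∷ ys} _ _ _ ⊇ with ⊇ (here refl)
  ... | ()
  sorted-unique {x ∷ xs} {[]} _ _ ⊆ _ with ⊆ (here refl)
  ... | ()
  sorted-unique {x ∷ xs} {y ∷ ys} (x< ∷ xs<) (y< ∷ ys<) ⊆ ⊇ with ⊆ (here refl) | ⊇ (here refl)
  ... | there x∈ys | there y∈xs = contradiction (ℚP.<-trans (All.lookup x< y∈xs) (All.lookup y< x∈ys)) (ℚP.<-irrefl refl)
  ... | there x∈ys | here refl = contradiction (All.lookup y< x∈ys) (ℚP.<-irrefl refl)
  ... | here refl | _ = cong (x ∷_) (sorted-unique xs< ys< (λ z∈ → drop (λ { refl → All.lookup x< z∈ }) (⊆ (there z∈)))
                                                          (λ z∈ → drop (λ { refl → All.lookup y< z∈ }) (⊇ (there z∈))))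
    where
    drop : ∀ {z} {zs} → (z ≡ x → x <ₜ x) → z ∈ x ∷ zs → z ∈ zs
    drop irr (here eq) = contradiction (irr eq) (ℚP.<-irrefl refl)
    drop irr (there z∈) = z∈

  collect-∈⁺ : ∀ {A B : Set} (f : A → Maybe B) {x y} xs → x ∈ xs → f x ≡ just y → y ∈ collect (map f xs)
  collect-∈⁺ f (x ∷ xs) (here refl) eq rewrite eq = here refl
  collect-∈⁺ f (x ∷ xs) (there x∈) eq with f x
  ... | just _ = there (collect-∈⁺ f xs x∈ eq)
  ... | nothing = collect-∈⁺ f xs x∈ eq

  collect-∈⁻ : ∀ {A B : Set} (f : A → Maybe B) {y} xs → y ∈ collect (map f xs) → ∃ λ x → x ∈ xs × f x ≡ just y
  collect-∈⁻ f (x ∷ xs) y∈ with f x in eq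
  collect-∈⁻ f (x ∷ xs) (here refl) | just _ = x , here refl , eq
  collect-∈⁻ f (x ∷ xs) (there y∈) | just _ with collect-∈⁻ f xs y∈
  ... | x′ , x′∈ , eq′ = x′ , there x′∈ , eq′
  collect-∈⁻ f (x ∷ xs) y∈ | nothing with collect-∈⁻ f xs y∈
  ... | x′ , x′∈ , eq′ = x′ , there x′∈ , eq′

  -- A crossing remembers its segment, so distinctness passes from the candidate segments to their
  -- crossings.
  collect-unique : ∀ {A B : Set} (f : A → Maybe B) (g : B → A) → (∀ x y → f x ≡ just y → g y ≡ x) →
                   ∀ xs → Unique xs → Unique (collect (map f xs))
  collect-unique f g inv [] [] = []
  collect-unique f g inv (x ∷ xs) (x∉ ∷ u) with f x in eq
  ... | nothing = collect-unique f g inv xs u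
  ... | just y = All.tabulate distinct ∷ collect-unique f g inv xs u
    where
    distinct : ∀ {z} → z ∈ collect (map f xs) → y ≢ z
    distinct z∈ refl with collect-∈⁻ f xs z∈
    ... | x′ , x′∈ , eq′ = All.lookup x∉ x′∈ (trans (sym (inv x y eq)) (inv x′ y eq′))

  range-unique : ∀ n → Unique (range n)
  range-unique n = AllP.map⁺ (All.tabulate λ _ ()) ∷ UniqueP.map⁺ ℤP.+-injective (UniqueP.upTo⁺ (suc n))

  concatMap-unique : ∀ {A B : Set} (f : A → List B) (key : B → A) → (∀ a {b} → b ∈ f a → key b ≡ a) →
                     (∀ a → Unique (f a)) → ∀ {as} → Unique as → Unique (concatMap f as)
  concatMap-unique f key hkey hf {as} u = UniqueP.concat⁺ (AllP.map⁺ (All.tabulate λ {a} _ → hf a))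
    (AllPairsP.map⁺ (AllPairs.map apart u))
    where
    apart : ∀ {a a′} → a ≢ a′ → Disjoint (f a) (f a′)
    apart {a} {a′} a≢a′ (b∈ , b∈′) = a≢a′ (trans (sym (hkey a b∈)) (hkey a′ b∈′))

  candidates-unique : ∀ p q → Unique (candidates p q)
  candidates-unique p q = concatMap-unique (λ m → concatMap (λ n → segsAt m n) (range p)) column column-row
    (λ m → concatMap-unique (segsAt m) row (row-segs m) (segs-unique m) (range-unique p)) (range-unique q)
    where
    column row : Seg → ℤ
    column (seg _ (x , _) _) = x
    -- A diagonal starts at height n + 1, so its row is read off its second end.
    row (seg ①' _ (_ , y)) = y
    row (seg ②' (_ , y) _) = y
    row (seg ③' (_ , y) _) = y
    column-segs : ∀ m n {τ} → τ ∈ segsAt m n → column τ ≡ m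
    column-segs m n (here refl) = refl
    column-segs m n (there (here refl)) = refl
    column-segs m n (there (there (here refl))) = refl
    row-segs : ∀ m n {τ} → τ ∈ segsAt m n → row τ ≡ n
    row-segs m n (here refl) = refl
    row-segs m n (there (here refl)) = refl
    row-segs m n (there (there (here refl))) = refl
    column-row : ∀ m {τ} → τ ∈ concatMap (λ n → segsAt m n) (range p) → column τ ≡ m
    column-row m τ∈ with find (∈-concatMap⁻ (segsAt m) {xs = range p} τ∈)
    ... | n , _ , τ∈′ = column-segs m n τ∈′
    segs-unique : ∀ m n → Unique (segsAt m n)
    segs-unique m n = ((λ ()) ∷ (λ ()) ∷ []) ∷ ((λ ()) ∷ []) ∷ [] ∷ []

  candidates-∈⁻ : ∀ p q {τ} → τ ∈ candidates p q → ∃₂ λ m n → m ∈ range q × n ∈ range p × τ ∈ segsAt m n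
  candidates-∈⁻ p q τ∈ with find (∈-concatMap⁻ (λ m → concatMap (λ n → segsAt m n) (range p)) {xs = range q} τ∈)
  ... | m , m∈ , τ∈′ with find (∈-concatMap⁻ (segsAt m) {xs = range p} τ∈′)
  ... | n , n∈ , τ∈″ = m , n , m∈ , n∈ , τ∈″

  candidates-∈⁺ : ∀ p q {τ} i j → i ℕ.≤ q → j ℕ.≤ p → τ ∈ segsAt (+ i) (+ j) → τ ∈ candidates p q
  candidates-∈⁺ p q i j i≤ j≤ τ∈ =
    ∈-concatMap⁺ (λ m → concatMap (λ n → segsAt m n) (range p)) (lose (in-range i≤)
      (∈-concatMap⁺ (segsAt (+ i)) (lose (in-range j≤) τ∈)))
    where
    in-range : ∀ {i n} → i ℕ.≤ n → + i ∈ range n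
    in-range i≤n = there (∈-map⁺ +_ (∈-upTo⁺ (s≤s i≤n)))

  range-∈⁻ : ∀ {n m} → m ∈ range n → m ≡ -[1+ 0 ] ⊎ ∃ λ i → m ≡ + i
  range-∈⁻ (here eq) = inj₁ eq
  range-∈⁻ (there m∈) with ∈-map⁻ +_ m∈
  ... | i , _ , eq = inj₂ (i , eq)

  /-<⁺ : ∀ a b m n → a ℤ.* + suc n ℤ.< b ℤ.* + suc m → a ℚ./ suc m ℚ.< b ℚ./ suc n
  /-<⁺ a b m n h = ℚP.toℚᵘ-cancel-< (ℚᵘP.<-respˡ-≃ (ℚᵘP.≃-sym (ℚP.toℚᵘ-fromℚᵘ (ℚᵘ.mkℚᵘ a m)))
    (ℚᵘP.<-respʳ-≃ (ℚᵘP.≃-sym (ℚP.toℚᵘ-fromℚᵘ (ℚᵘ.mkℚᵘ b n))) (ℚᵘ.*<* h)))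

  /-<⁻ : ∀ a b m n → a ℚ./ suc m ℚ.< b ℚ./ suc n → a ℤ.* + suc n ℤ.< b ℤ.* + suc m
  /-<⁻ a b m n h = ℚᵘP.drop-*<* (ℚᵘP.<-respˡ-≃ (ℚP.toℚᵘ-fromℚᵘ (ℚᵘ.mkℚᵘ a m))
    (ℚᵘP.<-respʳ-≃ (ℚP.toℚᵘ-fromℚᵘ (ℚᵘ.mkℚᵘ b n)) (ℚP.toℚᵘ-mono-< h)))

  /-≤⁺ : ∀ a b m n → a ℤ.* + suc n ℤ.≤ b ℤ.* + suc m → a ℚ./ suc m ℚ.≤ b ℚ./ suc n
  /-≤⁺ a b m n h = ℚP.toℚᵘ-cancel-≤ (ℚᵘP.≤-respˡ-≃ (ℚᵘP.≃-sym (ℚP.toℚᵘ-fromℚᵘ (ℚᵘ.mkℚᵘ a m)))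
    (ℚᵘP.≤-respʳ-≃ (ℚᵘP.≃-sym (ℚP.toℚᵘ-fromℚᵘ (ℚᵘ.mkℚᵘ b n))) (ℚᵘ.*≤* h)))

  /-≤⁻ : ∀ a b m n → a ℚ./ suc m ℚ.≤ b ℚ./ suc n → a ℤ.* + suc n ℤ.≤ b ℤ.* + suc m
  /-≤⁻ a b m n h = ℚᵘP.drop-*≤* (ℚᵘP.≤-respˡ-≃ (ℚP.toℚᵘ-fromℚᵘ (ℚᵘ.mkℚᵘ a m))
    (ℚᵘP.≤-respʳ-≃ (ℚP.toℚᵘ-fromℚᵘ (ℚᵘ.mkℚᵘ b n)) (ℚP.toℚᵘ-mono-≤ h)))

  0</ : ∀ a n → 0ℚ ℚ.< a ℚ./ suc n ⇔ + 0 ℤ.< a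
  0</ a n = mk⇔ (λ h → subst (+ 0 ℤ.<_) (ℤP.*-identityʳ a) (/-<⁻ (+ 0) a 0 n h))
                (λ h → /-<⁺ (+ 0) a 0 n (subst (+ 0 ℤ.<_) (sym (ℤP.*-identityʳ a)) h))

  /<1 : ∀ a n → a ℚ./ suc n ℚ.< 1ℚ ⇔ a ℤ.< + suc n
  /<1 a n = mk⇔ (λ h → subst₂ ℤ._<_ (ℤP.*-identityʳ a) (ℤP.*-identityˡ (+ suc n)) (/-<⁻ a (+ 1) n 0 h))
                (λ h → /-<⁺ a (+ 1) n 0 (subst₂ ℤ._<_ (sym (ℤP.*-identityʳ a)) (sym (ℤP.*-identityˡ (+ suc n))) h))

  0≤/ : ∀ a n → 0ℚ ℚ.≤ a ℚ./ suc n ⇔ + 0 ℤ.≤ a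
  0≤/ a n = mk⇔ (λ h → subst (+ 0 ℤ.≤_) (ℤP.*-identityʳ a) (/-≤⁻ (+ 0) a 0 n h))
                (λ h → /-≤⁺ (+ 0) a 0 n (subst (+ 0 ℤ.≤_) (sym (ℤP.*-identityʳ a)) h))

  /≤1 : ∀ a n → a ℚ./ suc n ℚ.≤ 1ℚ ⇔ a ℤ.≤ + suc n
  /≤1 a n = mk⇔ (λ h → subst₂ ℤ._≤_ (ℤP.*-identityʳ a) (ℤP.*-identityˡ (+ suc n)) (/-≤⁻ a (+ 1) n 0 h))
                (λ h → /-≤⁺ a (+ 1) n 0 (subst₂ ℤ._≤_ (sym (ℤP.*-identityʳ a)) (sym (ℤP.*-identityˡ (+ suc n))) h))

  sorted-injective : ∀ {xs x y} → AllPairs _<ₜ_ xs → x ∈ xs → y ∈ xs → Crossing.t x ≡ Crossing.t y → x ≡ y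
  sorted-injective (x< ∷ _) (here refl) (here refl) eq = refl
  sorted-injective (x< ∷ _) (here refl) (there y∈) eq = contradiction (All.lookup x< y∈) (ℚP.<-irrefl eq)
  sorted-injective (x< ∷ _) (there x∈) (here refl) eq = contradiction (All.lookup x< x∈) (ℚP.<-irrefl (sym eq))
  sorted-injective (_ ∷ s) (there x∈) (there y∈) eq = sorted-injective s x∈ y∈ eq

  unique⇒distinct-times : ∀ xs → Unique xs → (∀ {x y} → x ∈ xs → y ∈ xs → Crossing.t x ≡ Crossing.t y → x ≡ y) →
                          AllPairs (λ c d → Crossing.t c ≢ Crossing.t d) xs
  unique⇒distinct-times [] [] inj = []
  unique⇒distinct-times (x ∷ xs) (x∉ ∷ u) inj =
    All.tabulate (λ y∈ eq → All.lookup x∉ y∈ (inj (here refl) (there y∈) eq)) ∷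
    unique⇒distinct-times xs u (λ x∈ y∈ → inj (there x∈) (there y∈))

open Sorting

-- Intersections with the segments of Λ

at : ℕ → ℕ → Seg → ℚ → Crossing
at p q τ t = crossing τ t (t ℚ.* ℕ→ℚ q) (t ℚ.* ℕ→ℚ p)

-- The decision made inside `intersect`, with both quotients as arguments: they can be simplified
-- for each kind of segment before the cases are distinguished.
meet : ℕ → ℕ → Seg → Maybe ℚ → Maybe ℚ → Maybe Crossing
meet p q τ (just t) (just l) =
  if ⌊ 0ℚ ℚP.<? t ⌋ ∧ ⌊ t ℚP.<? 1ℚ ⌋ ∧ ⌊ 0ℚ ℚP.≤? l ⌋ ∧ ⌊ l ℚP.≤? 1ℚ ⌋ then just (at p q τ t) else nothing
meet p q τ _ _ = nothing

intersect≡meet : ∀ p q τ → let d = Seg.B τ -ᵖ Seg.A τ in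
  intersect p q τ ≡ meet p q τ (cross (Seg.A τ) d ÷ℤ cross (+ q , + p) d) (cross (Seg.A τ) (+ q , + p) ÷ℤ cross (+ q , + p) d)
intersect≡meet p q τ
  with cross (Seg.A τ) (Seg.B τ -ᵖ Seg.A τ) ÷ℤ cross (+ q , + p) (Seg.B τ -ᵖ Seg.A τ)
     | cross (Seg.A τ) (+ q , + p) ÷ℤ cross (+ q , + p) (Seg.B τ -ᵖ Seg.A τ)
... | just t | just l = refl
... | just t | nothing = refl
... | nothing | _ = refl

-- The four guards on t = a / (n + 1) and λ = b / (n + 1), cleared of the common denominator.
record Inside (a b : ℤ) (n : ℕ) : Set where
  constructor inside
  field
    0<a : + 0 ℤ.< a
    a<n : a ℤ.< + suc n
    0≤b : + 0 ℤ.≤ b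
    b≤n : b ℤ.≤ + suc n

meet-just : ∀ p q τ {a b n} → Inside a b n → meet p q τ (just (a ℚ./ suc n)) (just (b ℚ./ suc n)) ≡ just (at p q τ (a ℚ./ suc n))
meet-just p q τ {a} {b} {n} (inside h₁ h₂ h₃ h₄)
  with 0ℚ ℚP.<? a ℚ./ suc n | a ℚ./ suc n ℚP.<? 1ℚ | 0ℚ ℚP.≤? b ℚ./ suc n | b ℚ./ suc n ℚP.≤? 1ℚ
... | yes _ | yes _ | yes _ | yes _ = refl
... | no ¬h | _ | _ | _ = contradiction (Equivalence.from (0</ a n) h₁) ¬h
... | yes _ | no ¬h | _ | _ = contradiction (Equivalence.from (/<1 a n) h₂) ¬h
... | yes _ | yes _ | no ¬h | _ = contradiction (Equivalence.from (0≤/ b n) h₃) ¬h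
... | yes _ | yes _ | yes _ | no ¬h = contradiction (Equivalence.from (/≤1 b n) h₄) ¬h

meet-inside : ∀ p q τ {a b n c} → meet p q τ (just (a ℚ./ suc n)) (just (b ℚ./ suc n)) ≡ just c →
              Inside a b n × at p q τ (a ℚ./ suc n) ≡ c
meet-inside p q τ {a} {b} {n} eq
  with 0ℚ ℚP.<? a ℚ./ suc n | a ℚ./ suc n ℚP.<? 1ℚ | 0ℚ ℚP.≤? b ℚ./ suc n | b ℚ./ suc n ℚP.≤? 1ℚ | eq
... | yes h₁ | yes h₂ | yes h₃ | yes h₄ | refl = inside (Equivalence.to (0</ a n) h₁) (Equivalence.to (/<1 a n) h₂)
                                            (Equivalence.to (0≤/ b n) h₃) (Equivalence.to (/≤1 b n) h₄) , refl
... | no _ | _ | _ | _ | ()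
... | yes _ | no _ | _ | _ | ()
... | yes _ | yes _ | no _ | _ | ()
... | yes _ | yes _ | yes _ | no _ | ()

module _ (p q : ℕ) (m n : ℤ) where

  private
    P Q : ℤ
    P = + suc p
    Q = + suc q
    open ℤSolver

  intersect-② : intersect (suc p) (suc q) (seg ②' (m , n) (m , n ℤ.+ + 1)) ≡
    meet (suc p) (suc q) (seg ②' (m , n) (m , n ℤ.+ + 1)) (just (m ℚ./ suc q)) (just ((m ℤ.* P ℤ.- n ℤ.* Q) ℚ./ suc q))
  intersect-② = trans (intersect≡meet (suc p) (suc q) τ) (cong₂ (meet (suc p) (suc q) τ)
    (cong₂ _÷ℤ_ (solve 2 (λ m n → m :* ((n :+ con (+ 1)) :- n) :- n :* (m :- m) := m) refl m n) den)
    (cong (cross (Seg.A τ) (Q , P) ÷ℤ_) den))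
    where
    τ = seg ②' (m , n) (m , n ℤ.+ + 1)
    den : Q ℤ.* ((n ℤ.+ + 1) ℤ.- n) ℤ.- P ℤ.* (m ℤ.- m) ≡ Q
    den = solve 4 (λ m n P Q → Q :* ((n :+ con (+ 1)) :- n) :- P :* (m :- m) := Q) refl m n P Q

  intersect-③ : intersect (suc p) (suc q) (seg ③' (m , n) (m ℤ.+ + 1 , n)) ≡
    meet (suc p) (suc q) (seg ③' (m , n) (m ℤ.+ + 1 , n)) (just (n ℚ./ suc p)) (just ((n ℤ.* Q ℤ.- m ℤ.* P) ℚ./ suc p))
  intersect-③ = trans (intersect≡meet (suc p) (suc q) τ) (cong₂ (meet (suc p) (suc q) τ)
    (trans (cong (cross (Seg.A τ) (Seg.B τ -ᵖ Seg.A τ) ÷ℤ_) den) (cong (λ a → just (a ℚ./ suc p)) num))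
    (trans (cong (cross (Seg.A τ) (Q , P) ÷ℤ_) den) (cong (λ a → just (a ℚ./ suc p)) num′)))
    where
    τ = seg ③' (m , n) (m ℤ.+ + 1 , n)
    -- The determinant is negative, so `÷ℤ` negates the numerator and divides by the absolute value.
    den : Q ℤ.* (n ℤ.- n) ℤ.- P ℤ.* ((m ℤ.+ + 1) ℤ.- m) ≡ -[1+ p ]
    den = solve 4 (λ m n P Q → Q :* (n :- n) :- P :* ((m :+ con (+ 1)) :- m) := :- P) refl m n P Q
    num : ℤ.- (m ℤ.* (n ℤ.- n) ℤ.- n ℤ.* ((m ℤ.+ + 1) ℤ.- m)) ≡ n
    num = solve 2 (λ m n → :- (m :* (n :- n) :- n :* ((m :+ con (+ 1)) :- m)) := n) refl m n
    num′ : ℤ.- (m ℤ.* P ℤ.- n ℤ.* Q) ≡ n ℤ.* Q ℤ.- m ℤ.* P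
    num′ = solve 4 (λ m n P Q → :- (m :* P :- n :* Q) := n :* Q :- m :* P) refl m n P Q

  intersect-① : intersect (suc p) (suc q) (seg ①' (m , n ℤ.+ + 1) (m ℤ.+ + 1 , n)) ≡
    meet (suc p) (suc q) (seg ①' (m , n ℤ.+ + 1) (m ℤ.+ + 1 , n))
      (just ((m ℤ.+ n ℤ.+ + 1) ℚ./ suc (p ℕ.+ suc q))) (just (((n ℤ.+ + 1) ℤ.* Q ℤ.- m ℤ.* P) ℚ./ suc (p ℕ.+ suc q)))
  intersect-① = trans (intersect≡meet (suc p) (suc q) τ) (cong₂ (meet (suc p) (suc q) τ)
    (trans (cong (cross (Seg.A τ) (Seg.B τ -ᵖ Seg.A τ) ÷ℤ_) den) (cong (λ a → just (a ℚ./ suc (p ℕ.+ suc q))) num))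
    (trans (cong (cross (Seg.A τ) (Q , P) ÷ℤ_) den) (cong (λ a → just (a ℚ./ suc (p ℕ.+ suc q))) num′)))
    where
    τ = seg ①' (m , n ℤ.+ + 1) (m ℤ.+ + 1 , n)
    den : Q ℤ.* (n ℤ.- (n ℤ.+ + 1)) ℤ.- P ℤ.* ((m ℤ.+ + 1) ℤ.- m) ≡ -[1+ p ℕ.+ suc q ]
    den = solve 4 (λ m n P Q → Q :* (n :- (n :+ con (+ 1))) :- P :* ((m :+ con (+ 1)) :- m) := :- (P :+ Q)) refl m n P Q
    num : ℤ.- (m ℤ.* (n ℤ.- (n ℤ.+ + 1)) ℤ.- (n ℤ.+ + 1) ℤ.* ((m ℤ.+ + 1) ℤ.- m)) ≡ m ℤ.+ n ℤ.+ + 1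
    num = solve 2 (λ m n → :- (m :* (n :- (n :+ con (+ 1))) :- (n :+ con (+ 1)) :* ((m :+ con (+ 1)) :- m)) := m :+ n :+ con (+ 1)) refl m n
    num′ : ℤ.- (m ℤ.* P ℤ.- (n ℤ.+ + 1) ℤ.* Q) ≡ (n ℤ.+ + 1) ℤ.* Q ℤ.- m ℤ.* P
    num′ = solve 4 (λ m n P Q → :- (m :* P :- (n :+ con (+ 1)) :* Q) := (n :+ con (+ 1)) :* Q :- m :* P) refl m n P Q

*-difference : ∀ i j x y → + i ℤ.* + x ℤ.- + j ℤ.* + y ≡ + (x ℕ.* i) ℤ.- + (y ℕ.* j)
*-difference i j x y = cong₂ ℤ._-_ (lem i x) (lem j y)
  where
  lem : ∀ i x → + i ℤ.* + x ≡ + (x ℕ.* i)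
  lem i x = trans (ℤP.*-comm (+ i) (+ x)) (sym (ℤP.pos-* x i))

record Insideℕ (a u v n : ℕ) : Set where
  constructor insideℕ
  field
    0<a : 0 ℕ.< a
    a<n : a ℕ.< n
    v≤u : v ℕ.≤ u
    u≤n+v : u ℕ.≤ n ℕ.+ v

insideℕ⇒inside : ∀ {a u v n b} → b ≡ + u ℤ.- + v → Insideℕ a u v (suc n) → Inside (+ a) b n
insideℕ⇒inside {a} {u} {v} {n} refl (insideℕ h₁ h₂ h₃ h₄) = inside (ℤ.+<+ h₁) (ℤ.+<+ h₂) (ℤP.i≤j⇒0≤j-i (ℤ.+≤+ h₃))
  (subst (+ u ℤ.- + v ℤ.≤_) (solve 2 (λ x y → x :+ y :- y := x) refl (+ suc n) (+ v)) (ℤP.+-monoˡ-≤ (ℤ.- + v) (ℤ.+≤+ h₄)))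
  where open ℤSolver

inside⇒insideℕ : ∀ {a u v n b} → b ≡ + u ℤ.- + v → Inside (+ a) b n → Insideℕ a u v (suc n)
inside⇒insideℕ {a} {u} {v} {n} refl (inside h₁ h₂ h₃ h₄) = insideℕ (ℤP.drop‿+<+ h₁) (ℤP.drop‿+<+ h₂)
  (ℤP.drop‿+≤+ (ℤP.0≤i-j⇒j≤i h₃))
  (ℤP.drop‿+≤+ (subst (ℤ._≤ + suc n ℤ.+ + v) (solve 2 (λ x y → x :- y :+ y := x) refl (+ u) (+ v)) (ℤP.+-monoˡ-≤ (+ v) h₄)))
  where open ℤSolver

①-height : ∀ f g p q → f ℕ.+ g ℕ.+ 1 ℕ.< suc p ℕ.+ suc q → f ℕ.+ g ℕ.≤ p ℕ.+ q
①-height f g p q h = lin≤ h (solveℕ (f ∷ g ∷ p ∷ q ∷ []))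

①-below : ∀ f g p q → q ℕ.* (g ℕ.+ 1) ℕ.≤ p ℕ.+ q ℕ.+ p ℕ.* f → q ℕ.* g ℕ.≤ p ℕ.* suc f
①-below f g p q h = lin≤ h (solveℕ (f ∷ g ∷ p ∷ q ∷ []))

-- The crossings of γ in the order of the walk

module Crossings (p q : ℕ) (prim : Primitive (suc p) (suc q)) where

  P Q : ℕ
  P = suc p
  Q = suc q

  σ : Side
  σ = isLeft P Q

  segD segV segH : ℕ → ℕ → Seg
  segD f g = seg ①' (+ f , + g ℤ.+ + 1) (+ f ℤ.+ + 1 , + g)
  segV f g = seg ②' (+ suc f , + g) (+ suc f , + g ℤ.+ + 1)
  segH f g = seg ③' (+ f , + suc g) (+ f ℤ.+ + 1 , + suc g)

  -- γ(t) = (t Q , t P) reaches the right side of the square when t Q = suc f and its top when t P =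
  -- suc g. The diagonal satisfies x + y = f + g + 1, whence t (P + Q) = f + g + 1 there.
  crossD crossV crossH : ℕ → ℕ → Crossing
  crossD f g = at P Q (segD f g) (+ (f ℕ.+ g ℕ.+ 1) ℚ./ suc (p ℕ.+ suc q))
  crossV f g = at P Q (segV f g) (+ suc f ℚ./ suc q)
  crossH f g = at P Q (segH f g) (+ suc g ℚ./ suc p)

  exit : ℕ × ℕ → Crossing
  exit (f , g) = if σ (even f) (even g) then crossV f g else crossH f g

  diagonalAt : ℕ × ℕ → Crossing
  diagonalAt (f , g) = crossD f g

  trail : ℕ → ℕ × ℕ → List Crossing
  trail zero    S = diagonalAt S ∷ []
  trail (suc m) S = diagonalAt S ∷ exit S ∷ trail m (next σ S)

  module Sep = Separates (left-separates prim)

  square : ∀ m f g → suc m ℕ.+ (f ℕ.+ g) ℕ.+ 2 ℕ.≤ suc p ℕ.+ suc q → suc f ℕ.+ suc g ℕ.< suc p ℕ.+ suc q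
  square m f g h = lin≤ (h ⊞ z≤n {m}) (solveℕ (p ∷ q ∷ m ∷ f ∷ g ∷ []))

  -- The walk visits one square of each height, and `crosses-unique` identifies it with any crossed
  -- square R of that height.
  ∈-trail : ∀ m S R → m ℕ.+ height S ℕ.+ 2 ℕ.≤ P ℕ.+ Q → Crosses P Q S → Crosses P Q R →
    height S ℕ.≤ height R → height R ℕ.≤ m ℕ.+ height S →
    diagonalAt R ∈ trail m S × (height R ℕ.< m ℕ.+ height S → exit R ∈ trail m S)
  ∈-trail zero S R room cS c lo hi =
    subst (λ R → diagonalAt R ∈ trail zero S) (crosses-unique {P} {Q} {S} cS c (ℕP.≤-antisym lo hi)) (here refl) ,
    λ lt → contradiction (ℕP.<-≤-trans lt lo) (ℕP.n≮n _)
  ∈-trail (suc m) S R room cS c lo hi = later (height S ℕ.≟ height R)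
    where
    shift≡ : suc m ℕ.+ height S ≡ m ℕ.+ height (next σ S)
    shift≡ = trans (sym (ℕP.+-suc m (height S))) (cong (m ℕ.+_) (sym (height-next σ S)))
    Goal : Set
    Goal = diagonalAt R ∈ trail (suc m) S × (height R ℕ.< suc m ℕ.+ height S → exit R ∈ trail (suc m) S)
    later : Dec (height S ≡ height R) → Goal
    later (yes eq) = subst (λ R → diagonalAt R ∈ trail (suc m) S) S≡R (here refl) ,
                     λ _ → subst (λ R → exit R ∈ trail (suc m) S) S≡R (there (here refl))
      where S≡R = crosses-unique {P} {Q} {S} cS c eq
    later (no neq) = there (there (proj₁ ih)) , λ lt → there (there (proj₂ ih (subst (height R ℕ.<_) shift≡ lt)))
      where
      ih = ∈-trail m (next σ S) R (subst (λ z → z ℕ.+ 2 ℕ.≤ P ℕ.+ Q) shift≡ room)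
             (Sep.crosses-next (proj₁ S) (proj₂ S) (square m (proj₁ S) (proj₂ S) room) cS) c
             (subst (ℕ._≤ height R) (sym (height-next σ S)) (ℕP.≤∧≢⇒< lo neq)) (subst (height R ℕ.≤_) shift≡ hi)

  private
    room₀ : p ℕ.+ q ℕ.+ 0 ℕ.+ 2 ℕ.≤ suc p ℕ.+ suc q
    room₀ = ℕP.≤-reflexive (walk-size p q)

  full : List Crossing
  full = trail (p ℕ.+ q) (0 , 0)

  crossD∈full : ∀ f g → Crosses P Q (f , g) → f ℕ.+ g ℕ.≤ p ℕ.+ q → crossD f g ∈ full
  crossD∈full f g c h = proj₁ (∈-trail (p ℕ.+ q) (0 , 0) (f , g) room₀ (crosses-first p q) c z≤n
    (subst (f ℕ.+ g ℕ.≤_) (sym (ℕP.+-identityʳ (p ℕ.+ q))) h))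

  exit∈full : ∀ f g → Crosses P Q (f , g) → f ℕ.+ g ℕ.< p ℕ.+ q → exit (f , g) ∈ full
  exit∈full f g c h = proj₂ (∈-trail (p ℕ.+ q) (0 , 0) (f , g) room₀ (crosses-first p q) c z≤n
    (subst (f ℕ.+ g ℕ.≤_) (sym (ℕP.+-identityʳ (p ℕ.+ q))) (ℕP.<⇒≤ h)))
    (subst (f ℕ.+ g ℕ.<_) (sym (ℕP.+-identityʳ (p ℕ.+ q))) h)

  exit-V : ∀ f g → P ℕ.* suc f ℕ.< Q ℕ.* suc g → suc f ℕ.+ suc g ℕ.< P ℕ.+ Q → exit (f , g) ≡ crossV f g
  exit-V f g lt h = cong (λ b → if b then crossV f g else crossH f g) (lem (Sep.corner f g h))
    where
    lem : (σ (even f) (even g) ≡ true × _) ⊎ (_ × Q ℕ.* suc g ℕ.< P ℕ.* suc f) → σ (even f) (even g) ≡ true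
    lem (inj₁ (eq , _)) = eq
    lem (inj₂ (_ , gt)) = contradiction lt (ℕP.<-asym gt)

  exit-H : ∀ f g → Q ℕ.* suc g ℕ.< P ℕ.* suc f → suc f ℕ.+ suc g ℕ.< P ℕ.+ Q → exit (f , g) ≡ crossH f g
  exit-H f g lt h = cong (λ b → if b then crossV f g else crossH f g) (lem (Sep.corner f g h))
    where
    lem : (_ × P ℕ.* suc f ℕ.< Q ℕ.* suc g) ⊎ (σ (even f) (even g) ≡ false × _) → σ (even f) (even g) ≡ false
    lem (inj₁ (_ , gt)) = contradiction lt (ℕP.<-asym gt)
    lem (inj₂ (eq , _)) = eq

  -- The guards admit λ = 0 and λ = 1, but then γ would pass through a lattice point before its
  -- endpoint. Primitivity makes both inequalities strict, and the segment becomes the exit of a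
  -- crossed square.
  ②∈full : ∀ f j → Insideℕ (suc f) (P ℕ.* suc f) (Q ℕ.* j) Q → crossV f j ∈ full
  ②∈full f j (insideℕ _ f<q lo hi) = subst (_∈ full) (exit-V f j above room)
    (exit∈full f j (ℕP.≤-<-trans (ℕP.*-monoʳ-≤ P (ℕP.n≤1+n f)) above , below) height<)
    where
    hi′ : P ℕ.* suc f ℕ.≤ Q ℕ.* suc j
    hi′ = subst (P ℕ.* suc f ℕ.≤_) (sym (ℕP.*-suc Q j)) hi
    PF<PQ : P ℕ.* suc f ℕ.< P ℕ.* Q
    PF<PQ = ℕP.*-monoʳ-< P f<q
    j<p : j ℕ.< P
    j<p = ℕP.*-cancelˡ-< Q j P (ℕP.≤-<-trans lo (subst (P ℕ.* suc f ℕ.<_) (ℕP.*-comm P Q) PF<PQ))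
    below : Q ℕ.* j ℕ.< P ℕ.* suc f
    below = ℕP.≤∧≢⇒< lo λ eq → prim (suc f) j (s≤s z≤n)
      (ℕP.<-≤-trans (ℕP.+-monoˡ-< j f<q) (subst (Q ℕ.+ j ℕ.≤_) (ℕP.+-comm Q P) (ℕP.+-monoʳ-≤ Q (ℕP.<⇒≤ j<p)))) (sym eq)
    height< : f ℕ.+ j ℕ.< p ℕ.+ q
    height< = ℕP.<-≤-trans (ℕP.+-monoˡ-< j (ℕ.s≤s⁻¹ f<q)) (subst (q ℕ.+ j ℕ.≤_) (ℕP.+-comm q p) (ℕP.+-monoʳ-≤ q (ℕ.s≤s⁻¹ j<p)))
    room : suc f ℕ.+ suc j ℕ.< P ℕ.+ Q
    room = subst₂ ℕ._<_ (sym (ℕP.+-suc (suc f) j)) (sym (ℕP.+-suc P q)) (s≤s (s≤s height<))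
    above : P ℕ.* suc f ℕ.< Q ℕ.* suc j
    above = ℕP.≤∧≢⇒< hi′ (prim (suc f) (suc j) (s≤s z≤n) room)

  ③∈full : ∀ i g → Insideℕ (suc g) (Q ℕ.* suc g) (P ℕ.* i) P → crossH i g ∈ full
  ③∈full i g (insideℕ _ g<p lo hi) = subst (_∈ full) (exit-H i g below room)
    (exit∈full i g (above , ℕP.≤-<-trans (ℕP.*-monoʳ-≤ Q (ℕP.n≤1+n g)) below) height<)
    where
    hi′ : Q ℕ.* suc g ℕ.≤ P ℕ.* suc i
    hi′ = subst (Q ℕ.* suc g ℕ.≤_) (sym (ℕP.*-suc P i)) hi
    QG<QP : Q ℕ.* suc g ℕ.< Q ℕ.* P
    QG<QP = ℕP.*-monoʳ-< Q g<p
    i<q : i ℕ.< Q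
    i<q = ℕP.*-cancelˡ-< P i Q (ℕP.≤-<-trans lo (subst (Q ℕ.* suc g ℕ.<_) (ℕP.*-comm Q P) QG<QP))
    height< : i ℕ.+ g ℕ.< p ℕ.+ q
    height< = ℕP.<-≤-trans (ℕP.+-monoʳ-< i (ℕ.s≤s⁻¹ g<p)) (subst (i ℕ.+ p ℕ.≤_) (ℕP.+-comm q p) (ℕP.+-monoˡ-≤ p (ℕ.s≤s⁻¹ i<q)))
    room : suc i ℕ.+ suc g ℕ.< P ℕ.+ Q
    room = subst₂ ℕ._<_ (sym (ℕP.+-suc (suc i) g)) (sym (ℕP.+-suc P q)) (s≤s (s≤s height<))
    above : P ℕ.* i ℕ.< Q ℕ.* suc g
    above = ℕP.≤∧≢⇒< lo (prim i (suc g) (subst (0 ℕ.<_) (sym (ℕP.+-suc i g)) (s≤s z≤n)) (ℕP.<-trans (ℕP.n<1+n _) room))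
    below : Q ℕ.* suc g ℕ.< P ℕ.* suc i
    below = ℕP.≤∧≢⇒< hi′ λ eq → prim (suc i) (suc g) (s≤s z≤n) room (sym eq)

  ①∈full : ∀ f g → Insideℕ (f ℕ.+ g ℕ.+ 1) (Q ℕ.* (g ℕ.+ 1)) (P ℕ.* f) (P ℕ.+ Q) → crossD f g ∈ full
  ①∈full f g (insideℕ _ h< lo hi) = crossD∈full f g (above , below) (①-height f g p q h<)
    where
    above : P ℕ.* f ℕ.< Q ℕ.* suc g
    above = ℕP.≤∧≢⇒< (subst (λ z → P ℕ.* f ℕ.≤ Q ℕ.* z) (ℕP.+-comm g 1) lo)
      (prim f (suc g) (subst (0 ℕ.<_) (sym (ℕP.+-suc f g)) (s≤s z≤n)) (subst (ℕ._< P ℕ.+ Q) (trans (ℕP.+-comm (f ℕ.+ g) 1) (sym (ℕP.+-suc f g))) h<))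
    below : Q ℕ.* g ℕ.< P ℕ.* suc f
    below = ℕP.≤∧≢⇒< (①-below f g P Q hi) λ eq → prim (suc f) g (s≤s z≤n) (subst (ℕ._< P ℕ.+ Q) (ℕP.+-comm (f ℕ.+ g) 1) h<) (sym eq)

  private
    -1*-difference : ∀ i x y → + i ℤ.* + x ℤ.- -[1+ 0 ] ℤ.* + y ≡ + (x ℕ.* i ℕ.+ y) ℤ.- + 0
    -1*-difference i x y = trans
      (solve 3 (λ i x y → i :* x :- con -[1+ 0 ] :* y := x :* i :+ y :- con (+ 0)) refl (+ i) (+ x) (+ y))
      (cong (λ z → z ℤ.+ + y ℤ.- + 0) (sym (ℤP.pos-* x i)))
      where open ℤSolver

    too-large : ∀ x i y → ¬ (suc x ℕ.* suc i ℕ.+ y ℕ.≤ y ℕ.+ 0)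
    too-large x i y h = contradiction (ℕP.≤-trans h (ℕP.≤-reflexive (ℕP.+-identityʳ y))) (ℕP.<⇒≱ (s≤s (ℕP.m≤n+m y _)))

    Range : ℤ → Set
    Range m = m ≡ -[1+ 0 ] ⊎ ∃ λ i → m ≡ + i

  -- Candidates also start in column and row - 1. In that column the guard 0 < t fails, and in that
  -- row the guard λ ≤ 1 does.
  ②-complete : ∀ m n → Range m → Range n → Inside m (m ℤ.* + P ℤ.- n ℤ.* + Q) q →
    at P Q (seg ②' (m , n) (m , n ℤ.+ + 1)) (m ℚ./ suc q) ∈ full
  ②-complete m n (inj₁ refl) _ (inside () _ _ _)
  ②-complete m n (inj₂ (zero , refl)) _ (inside (ℤ.+<+ ()) _ _ _)
  ②-complete m n (inj₂ (suc f , refl)) (inj₁ refl) ins =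
    contradiction (Insideℕ.u≤n+v (inside⇒insideℕ (-1*-difference (suc f) P Q) ins)) (too-large p f Q)
  ②-complete m n (inj₂ (suc f , refl)) (inj₂ (j , refl)) ins = ②∈full f j (inside⇒insideℕ (*-difference (suc f) j P Q) ins)

  ③-complete : ∀ m n → Range m → Range n → Inside n (n ℤ.* + Q ℤ.- m ℤ.* + P) p →
    at P Q (seg ③' (m , n) (m ℤ.+ + 1 , n)) (n ℚ./ suc p) ∈ full
  ③-complete m n _ (inj₁ refl) (inside () _ _ _)
  ③-complete m n _ (inj₂ (zero , refl)) (inside (ℤ.+<+ ()) _ _ _)
  ③-complete m n (inj₁ refl) (inj₂ (suc g , refl)) ins =
    contradiction (Insideℕ.u≤n+v (inside⇒insideℕ (-1*-difference (suc g) Q P) ins)) (too-large q g P)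
  ③-complete m n (inj₂ (i , refl)) (inj₂ (suc g , refl)) ins = ③∈full i g (inside⇒insideℕ (*-difference (suc g) i Q P) ins)

  ①-complete : ∀ m n → Range m → Range n → Inside (m ℤ.+ n ℤ.+ + 1) ((n ℤ.+ + 1) ℤ.* + Q ℤ.- m ℤ.* + P) (p ℕ.+ suc q) →
    at P Q (seg ①' (m , n ℤ.+ + 1) (m ℤ.+ + 1 , n)) ((m ℤ.+ n ℤ.+ + 1) ℚ./ suc (p ℕ.+ suc q)) ∈ full
  ①-complete m n (inj₁ refl) (inj₁ refl) (inside () _ _ _)
  ①-complete m n (inj₁ refl) (inj₂ (zero , refl)) (inside (ℤ.+<+ ()) _ _ _)
  ①-complete m n (inj₁ refl) (inj₂ (suc j , refl)) ins =
    contradiction (Insideℕ.u≤n+v (inside⇒insideℕ {a = j ℕ.+ 1} (-1*-difference (suc j ℕ.+ 1) Q P) ins)) (excess j p q)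
    where
    excess : ∀ j p q → ¬ (suc q ℕ.* (suc j ℕ.+ 1) ℕ.+ suc p ℕ.≤ suc p ℕ.+ suc q ℕ.+ 0)
    excess j p q h = contradiction {A = 1 ℕ.≤ 0} (lin≤ (h ⊞ z≤n {j ℕ.+ q ℕ.* j ℕ.+ q}) (solveℕ (j ∷ p ∷ q ∷ []))) λ ()
  ①-complete m n (inj₂ (zero , refl)) (inj₁ refl) (inside (ℤ.+<+ ()) _ _ _)
  ①-complete m n (inj₂ (suc i , refl)) (inj₁ refl) (inside _ _ () _)
  ①-complete m n (inj₂ (i , refl)) (inj₂ (j , refl)) ins = ①∈full i j (inside⇒insideℕ (*-difference (j ℕ.+ 1) i Q P) ins)

  hits : List Crossing
  hits = collect (map (intersect P Q) (candidates P Q))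

  complete : ∀ {c} → c ∈ hits → c ∈ full
  complete c∈ =
    let τ , τ∈ , eq = collect-∈⁻ (intersect P Q) (candidates P Q) c∈
        m , n , m∈ , n∈ , τ∈′ = candidates-∈⁻ P Q τ∈
    in byKind m n (range-∈⁻ m∈) (range-∈⁻ n∈) τ∈′ eq
    where
    byKind : ∀ m n {τ c} → Range m → Range n → τ ∈ segsAt m n → intersect P Q τ ≡ just c → c ∈ full
    byKind m n rm rn (here refl) eq =
      let ins , at≡ = meet-inside P Q (seg ③' (m , n) (m ℤ.+ + 1 , n)) (trans (sym (intersect-③ p q m n)) eq)
      in subst (_∈ full) at≡ (③-complete m n rm rn ins)
    byKind m n rm rn (there (here refl)) eq =
      let ins , at≡ = meet-inside P Q (seg ②' (m , n) (m , n ℤ.+ + 1)) (trans (sym (intersect-② p q m n)) eq)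
      in subst (_∈ full) at≡ (②-complete m n rm rn ins)
    byKind m n rm rn (there (there (here refl))) eq =
      let ins , at≡ = meet-inside P Q (seg ①' (m , n ℤ.+ + 1) (m ℤ.+ + 1 , n)) (trans (sym (intersect-① p q m n)) eq)
      in subst (_∈ full) at≡ (①-complete m n rm rn ins)

  private
    -- If x ≥ Q, the bound on x + y gives y ≤ P, and then Q y ≤ Q P ≤ P x.
    bound : ∀ {P Q x y} → P ℕ.* x ℕ.< Q ℕ.* y → x ℕ.+ y ℕ.≤ P ℕ.+ Q → x ℕ.< Q
    bound {P} {Q} {x} {y} lt h = ℕP.≰⇒> λ Q≤x → contradiction (begin-strict
      P ℕ.* x  <⟨ lt ⟩
      Q ℕ.* y  ≤⟨ ℕP.*-monoʳ-≤ Q (ℕP.+-cancelˡ-≤ Q y P (ℕP.≤-trans (ℕP.+-monoˡ-≤ y Q≤x) (ℕP.≤-trans h (ℕP.≤-reflexive (ℕP.+-comm P Q))))) ⟩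
      Q ℕ.* P  ≡⟨ ℕP.*-comm Q P ⟩
      P ℕ.* Q  ≤⟨ ℕP.*-monoʳ-≤ P Q≤x ⟩
      P ℕ.* x ∎) (ℕP.n≮n _)
      where open ℕP.≤-Reasoning

    hit : ∀ {τ c} i j → i ℕ.≤ Q → j ℕ.≤ P → τ ∈ segsAt (+ i) (+ j) → intersect P Q τ ≡ just c → c ∈ hits
    hit i j i≤ j≤ τ∈ = collect-∈⁺ (intersect P Q) (candidates P Q) (candidates-∈⁺ P Q i j i≤ j≤ τ∈)

  crossD-sound : ∀ f g → Crosses P Q (f , g) → suc f ℕ.+ suc g ℕ.≤ P ℕ.+ Q → crossD f g ∈ hits
  crossD-sound f g (above , below) h = hit f g (ℕP.<⇒≤ f<) (ℕP.<⇒≤ g<) (there (there (here refl)))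
    (trans (intersect-① p q (+ f) (+ g)) (meet-just P Q (segD f g) (insideℕ⇒inside (*-difference (g ℕ.+ 1) f Q P)
      (insideℕ (subst (0 ℕ.<_) (ℕP.+-comm 1 (f ℕ.+ g)) (s≤s z≤n))
        (subst (ℕ._≤ P ℕ.+ Q) (trans (ℕP.+-suc (suc f) g) (cong suc (ℕP.+-comm 1 (f ℕ.+ g)))) h)
        (subst (λ z → P ℕ.* f ℕ.≤ Q ℕ.* z) (ℕP.+-comm 1 g) (ℕP.<⇒≤ above))
        (top f g P Q (ℕP.<⇒≤ below))))))
    where
    f< : f ℕ.< Q
    f< = bound above (ℕP.≤-trans (ℕP.n≤1+n _) h)
    g< : g ℕ.< P
    g< = bound below (ℕP.≤-trans (ℕP.≤-reflexive (ℕP.+-comm g (suc f)))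
           (ℕP.≤-trans (ℕP.+-monoʳ-≤ (suc f) (ℕP.n≤1+n g)) (ℕP.≤-trans h (ℕP.≤-reflexive (ℕP.+-comm P Q)))))
    top : ∀ f g P Q → Q ℕ.* g ℕ.≤ P ℕ.* suc f → Q ℕ.* (g ℕ.+ 1) ℕ.≤ P ℕ.+ Q ℕ.+ P ℕ.* f
    top f g P Q h = lin≤ h (solveℕ (f ∷ g ∷ P ∷ Q ∷ []))

  crossV-sound : ∀ f g → P ℕ.* suc f ℕ.< Q ℕ.* suc g → Q ℕ.* g ℕ.< P ℕ.* suc f → suc f ℕ.+ suc g ℕ.≤ P ℕ.+ Q → crossV f g ∈ hits
  crossV-sound f g above below h = hit (suc f) g (ℕP.<⇒≤ f<) (ℕP.<⇒≤ g<) (there (here refl))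
    (trans (intersect-② p q (+ suc f) (+ g)) (meet-just P Q (segV f g) (insideℕ⇒inside (*-difference (suc f) g P Q)
      (insideℕ (s≤s z≤n) f< (ℕP.<⇒≤ below) (subst (P ℕ.* suc f ℕ.≤_) (ℕP.*-suc Q g) (ℕP.<⇒≤ above))))))
    where
    f< : suc f ℕ.< Q
    f< = bound above h
    g< : g ℕ.< P
    g< = bound below (ℕP.≤-trans (ℕP.≤-reflexive (ℕP.+-comm g (suc f)))
           (ℕP.≤-trans (ℕP.+-monoʳ-≤ (suc f) (ℕP.n≤1+n g)) (ℕP.≤-trans h (ℕP.≤-reflexive (ℕP.+-comm P Q)))))

  crossH-sound : ∀ f g → P ℕ.* f ℕ.< Q ℕ.* suc g → Q ℕ.* suc g ℕ.< P ℕ.* suc f → suc f ℕ.+ suc g ℕ.≤ P ℕ.+ Q → crossH f g ∈ hits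
  crossH-sound f g above below h = hit f (suc g) (ℕP.<⇒≤ f<) (ℕP.<⇒≤ g<) (here refl)
    (trans (intersect-③ p q (+ f) (+ suc g)) (meet-just P Q (segH f g) (insideℕ⇒inside (*-difference (suc g) f Q P)
      (insideℕ (s≤s z≤n) g< (ℕP.<⇒≤ above) (subst (Q ℕ.* suc g ℕ.≤_) (ℕP.*-suc P f) (ℕP.<⇒≤ below))))))
    where
    f< : f ℕ.< Q
    f< = bound above (ℕP.≤-trans (ℕP.n≤1+n _) h)
    g< : suc g ℕ.< P
    g< = bound below (ℕP.≤-trans (ℕP.≤-reflexive (ℕP.+-comm (suc g) (suc f))) (ℕP.≤-trans h (ℕP.≤-reflexive (ℕP.+-comm P Q))))

  exit-sound : ∀ f g → Crosses P Q (f , g) → suc f ℕ.+ suc g ℕ.< P ℕ.+ Q → exit (f , g) ∈ hits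
  exit-sound f g (above , below) h = byCorner (Sep.corner f g h)
    where
    byCorner : _ → exit (f , g) ∈ hits
    byCorner (inj₁ (eq , lt)) = subst (_∈ hits) (sym (exit-V f g lt h)) (crossV-sound f g lt below (ℕP.<⇒≤ h))
    byCorner (inj₂ (eq , gt)) = subst (_∈ hits) (sym (exit-H f g gt h)) (crossH-sound f g above gt (ℕP.<⇒≤ h))

  private
    corner≤ : ∀ m f g → m ℕ.+ (f ℕ.+ g) ℕ.+ 2 ℕ.≤ P ℕ.+ Q → suc f ℕ.+ suc g ℕ.≤ P ℕ.+ Q
    corner≤ m f g = ℕP.≤-trans (lem m f g)
      where
      lem : ∀ m f g → suc f ℕ.+ suc g ℕ.≤ m ℕ.+ (f ℕ.+ g) ℕ.+ 2
      lem m f g = lin≤ (z≤n {m}) (solveℕ (m ∷ f ∷ g ∷ []))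

    descend : ∀ m S → suc m ℕ.+ height S ℕ.+ 2 ℕ.≤ P ℕ.+ Q → m ℕ.+ height (next σ S) ℕ.+ 2 ℕ.≤ P ℕ.+ Q
    descend m S h = subst (ℕ._≤ P ℕ.+ Q)
      (cong (ℕ._+ 2) (trans (sym (ℕP.+-suc m (height S))) (cong (m ℕ.+_) (sym (height-next σ S))))) h

  trail-sound : ∀ m S {c} → m ℕ.+ height S ℕ.+ 2 ℕ.≤ P ℕ.+ Q → Crosses P Q S → c ∈ trail m S → c ∈ hits
  trail-sound zero (f , g) h cS (here refl) = crossD-sound f g cS (corner≤ 0 f g h)
  trail-sound (suc m) (f , g) h cS (here refl) = crossD-sound f g cS (corner≤ (suc m) f g h)
  trail-sound (suc m) (f , g) h cS (there (here refl)) = exit-sound f g cS (square m f g h)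
  trail-sound (suc m) (f , g) h cS (there (there c∈)) =
    trail-sound m (next σ (f , g)) (descend m (f , g) h) (Sep.crosses-next f g (square m f g h) cS) c∈

  private
    frac< : ∀ a b m n → a ℕ.* suc n ℕ.< b ℕ.* suc m → + a ℚ./ suc m ℚ.< + b ℚ./ suc n
    frac< a b m n h = /-<⁺ (+ a) (+ b) m n (subst₂ ℤ._<_ (ℤP.pos-* a (suc n)) (ℤP.pos-* b (suc m)) (ℤ.+<+ h))

  D<V : ∀ f g → Q ℕ.* g ℕ.< P ℕ.* suc f → diagonalAt (f , g) <ₜ crossV f g
  D<V f g lt = frac< (f ℕ.+ g ℕ.+ 1) (suc f) (p ℕ.+ suc q) q (lem f g (suc p) (suc q) lt)
    where
    lem : ∀ f g P Q → Q ℕ.* g ℕ.< P ℕ.* suc f → (f ℕ.+ g ℕ.+ 1) ℕ.* Q ℕ.< suc f ℕ.* (P ℕ.+ Q)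
    lem f g P Q lt = lin≤ lt (solveℕ (f ∷ g ∷ P ∷ Q ∷ []))

  D<H : ∀ f g → P ℕ.* f ℕ.< Q ℕ.* suc g → diagonalAt (f , g) <ₜ crossH f g
  D<H f g lt = frac< (f ℕ.+ g ℕ.+ 1) (suc g) (p ℕ.+ suc q) p (lem f g (suc p) (suc q) lt)
    where
    lem : ∀ f g P Q → P ℕ.* f ℕ.< Q ℕ.* suc g → (f ℕ.+ g ℕ.+ 1) ℕ.* P ℕ.< suc g ℕ.* (P ℕ.+ Q)
    lem f g P Q lt = lin≤ lt (solveℕ (f ∷ g ∷ P ∷ Q ∷ []))

  V<D : ∀ f g → P ℕ.* suc f ℕ.< Q ℕ.* suc g → crossV f g <ₜ diagonalAt (suc f , g)
  V<D f g lt = frac< (suc f) (suc f ℕ.+ g ℕ.+ 1) q (p ℕ.+ suc q) (lem f g (suc p) (suc q) lt)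
    where
    lem : ∀ f g P Q → P ℕ.* suc f ℕ.< Q ℕ.* suc g → suc f ℕ.* (P ℕ.+ Q) ℕ.< (suc f ℕ.+ g ℕ.+ 1) ℕ.* Q
    lem f g P Q lt = lin≤ lt (solveℕ (f ∷ g ∷ P ∷ Q ∷ []))

  H<D : ∀ f g → Q ℕ.* suc g ℕ.< P ℕ.* suc f → crossH f g <ₜ diagonalAt (f , suc g)
  H<D f g lt = frac< (suc g) (f ℕ.+ suc g ℕ.+ 1) p (p ℕ.+ suc q) (lem f g (suc p) (suc q) lt)
    where
    lem : ∀ f g P Q → Q ℕ.* suc g ℕ.< P ℕ.* suc f → suc g ℕ.* (P ℕ.+ Q) ℕ.< (f ℕ.+ suc g ℕ.+ 1) ℕ.* P
    lem f g P Q lt = lin≤ lt (solveℕ (f ∷ g ∷ P ∷ Q ∷ []))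

  exit-between : ∀ f g → Crosses P Q (f , g) → suc f ℕ.+ suc g ℕ.< P ℕ.+ Q →
    diagonalAt (f , g) <ₜ exit (f , g) × exit (f , g) <ₜ diagonalAt (next σ (f , g))
  exit-between f g (above , below) h = byCorner (Sep.corner f g h)
    where
    Between : Bool → Set
    Between b = diagonalAt (f , g) <ₜ (if b then crossV f g else crossH f g) ×
                (if b then crossV f g else crossH f g) <ₜ diagonalAt (if b then (suc f , g) else (f , suc g))
    byCorner : _ → Between (σ (even f) (even g))
    byCorner (inj₁ (eq , lt)) = subst Between (sym eq) (D<V f g below , V<D f g lt)
    byCorner (inj₂ (eq , gt)) = subst Between (sym eq) (D<H f g above , H<D f g gt)

  trail-linked : ∀ m S → m ℕ.+ height S ℕ.+ 2 ℕ.≤ P ℕ.+ Q → Crosses P Q S → Linked _<ₜ_ (trail m S)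
  trail-linked zero S h cS = [-]
  trail-linked (suc m) S@(f , g) h cS = proj₁ between Linked.∷ prepend m (proj₂ between)
    (trail-linked m (next σ S) (descend m S h) (Sep.crosses-next f g (square m f g h) cS))
    where
    between = exit-between f g cS (square m f g h)
    prepend : ∀ m {c S} → c <ₜ diagonalAt S → Linked _<ₜ_ (trail m S) → Linked _<ₜ_ (c ∷ trail m S)
    prepend zero lt l = lt Linked.∷ l
    prepend (suc m) lt l = lt Linked.∷ l

  -- Both lists increase strictly in time and have the same members. That different intersections
  -- have different times need not be examined segment by segment: they all occur in `full`, where
  -- times are distinct.
  crossings≡trail : crossings P Q ≡ full
  crossings≡trail = sorted-unique (sortC-sorted hits (unique⇒distinct-times hits hits-unique
      λ x∈ y∈ → sorted-injective full-sorted (complete x∈) (complete y∈))) full-sorted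
    (λ x∈ → complete (sortC-∈⁻ hits x∈)) (λ x∈ → sortC-∈⁺ hits (trail-sound (p ℕ.+ q) (0 , 0) room₀ (crosses-first p q) x∈))
    where
    full-sorted : AllPairs _<ₜ_ full
    full-sorted = Linked⇒AllPairs ℚP.<-trans (trail-linked (p ℕ.+ q) (0 , 0) room₀ (crosses-first p q))
    hits-unique = collect-unique (intersect P Q) Crossing.τ τ-intersect (candidates P Q) (candidates-unique P Q)
      where
      τ-intersect : ∀ τ c → intersect P Q τ ≡ just c → Crossing.τ c ≡ τ
      τ-intersect τ c eq = meet-τ (cross (Seg.A τ) d ÷ℤ cross (+ Q , + P) d) (cross (Seg.A τ) (+ Q , + P) ÷ℤ cross (+ Q , + P) d)
        (trans (sym (intersect≡meet P Q τ)) eq)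
        where
        d = Seg.B τ -ᵖ Seg.A τ
        meet-τ : ∀ s t {c} → meet P Q τ s t ≡ just c → Crossing.τ c ≡ τ
        meet-τ (just s) (just t) eq with ⌊ 0ℚ ℚP.<? s ⌋ ∧ ⌊ s ℚP.<? 1ℚ ⌋ ∧ ⌊ 0ℚ ℚP.≤? t ⌋ ∧ ⌊ t ℚP.≤? 1ℚ ⌋
        meet-τ (just s) (just t) refl | true = refl

-- Integers inside ℚ

fromℚᵘ-+ : ∀ a b → ℚ.fromℚᵘ a ℚ.+ ℚ.fromℚᵘ b ≡ ℚ.fromℚᵘ (a ℚᵘ.+ b)
fromℚᵘ-+ a b = ℚP.toℚᵘ-injective (ℚᵘP.≃-trans (ℚP.toℚᵘ-homo-+ (ℚ.fromℚᵘ a) (ℚ.fromℚᵘ b))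
  (ℚᵘP.≃-trans (ℚᵘP.+-cong (ℚP.toℚᵘ-fromℚᵘ a) (ℚP.toℚᵘ-fromℚᵘ b)) (ℚᵘP.≃-sym (ℚP.toℚᵘ-fromℚᵘ (a ℚᵘ.+ b)))))

fromℚᵘ-* : ∀ a b → ℚ.fromℚᵘ a ℚ.* ℚ.fromℚᵘ b ≡ ℚ.fromℚᵘ (a ℚᵘ.* b)
fromℚᵘ-* a b = ℚP.toℚᵘ-injective (ℚᵘP.≃-trans (ℚP.toℚᵘ-homo-* (ℚ.fromℚᵘ a) (ℚ.fromℚᵘ b))
  (ℚᵘP.≃-trans (ℚᵘP.*-cong (ℚP.toℚᵘ-fromℚᵘ a) (ℚP.toℚᵘ-fromℚᵘ b)) (ℚᵘP.≃-sym (ℚP.toℚᵘ-fromℚᵘ (a ℚᵘ.* b)))))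

ℤ→ℚ-+ : ∀ a b → ℤ→ℚ (a ℤ.+ b) ≡ ℤ→ℚ a ℚ.+ ℤ→ℚ b
ℤ→ℚ-+ a b = sym (trans (fromℚᵘ-+ (ℚᵘ.mkℚᵘ a 0) (ℚᵘ.mkℚᵘ b 0)) (ℚP.fromℚᵘ-cong {ℚᵘ.mkℚᵘ a 0 ℚᵘ.+ ℚᵘ.mkℚᵘ b 0} {ℚᵘ.mkℚᵘ (a ℤ.+ b) 0} (ℚᵘ.*≡*
  (solve 2 (λ a b → (a :* con (+ 1) :+ b :* con (+ 1)) :* con (+ 1) := (a :+ b) :* con (+ 1)) refl a b))))
  where open ℤSolver

ℤ→ℚ-* : ∀ a b → ℤ→ℚ (a ℤ.* b) ≡ ℤ→ℚ a ℚ.* ℤ→ℚ b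
ℤ→ℚ-* a b = sym (fromℚᵘ-* (ℚᵘ.mkℚᵘ a 0) (ℚᵘ.mkℚᵘ b 0))

ℕ→ℚ-+ : ∀ m n → ℕ→ℚ (m ℕ.+ n) ≡ ℕ→ℚ m ℚ.+ ℕ→ℚ n
ℕ→ℚ-+ m n = ℤ→ℚ-+ (+ m) (+ n)

ℕ→ℚ-* : ∀ m n → ℕ→ℚ (m ℕ.* n) ≡ ℕ→ℚ m ℚ.* ℕ→ℚ n
ℕ→ℚ-* m n = trans (cong ℤ→ℚ (ℤP.pos-* m n)) (ℤ→ℚ-* (+ m) (+ n))

ℕ→ℚ-suc : ∀ n → ℕ→ℚ (suc n) ≡ 1ℚ ℚ.+ ℕ→ℚ n
ℕ→ℚ-suc = ℕ→ℚ-+ 1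

ℕ→ℚ-*-/ : ∀ n a → ℕ→ℚ (suc n) ℚ.* (+ a ℚ./ suc n) ≡ ℕ→ℚ a
ℕ→ℚ-*-/ n a = trans (fromℚᵘ-* (ℚᵘ.mkℚᵘ (+ suc n) 0) (ℚᵘ.mkℚᵘ (+ a) n)) (ℚP.fromℚᵘ-cong {ℚᵘ.mkℚᵘ (+ suc n) 0 ℚᵘ.* ℚᵘ.mkℚᵘ (+ a) n} {ℚᵘ.mkℚᵘ (+ a) 0} (ℚᵘ.*≡*
  (trans (solve 2 (λ n a → n :* a :* con (+ 1) := a :* n) refl (+ suc n) (+ a))
         (cong (λ z → + a ℤ.* + suc z) (sym (ℕP.+-identityʳ n))))))
  where open ℤSolver

ℕ→ℚ-mono-< : ∀ {m n} → m ℕ.< n → ℕ→ℚ m ℚ.< ℕ→ℚ n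
ℕ→ℚ-mono-< {m} {n} h = /-<⁺ (+ m) (+ n) 0 0 (subst₂ ℤ._<_ (sym (ℤP.*-identityʳ (+ m))) (sym (ℤP.*-identityʳ (+ n))) (ℤ.+<+ h))

ℕ→ℚ-mono-≤ : ∀ {m n} → m ℕ.≤ n → ℕ→ℚ m ℚ.≤ ℕ→ℚ n
ℕ→ℚ-mono-≤ {m} {n} h = /-≤⁺ (+ m) (+ n) 0 0 (subst₂ ℤ._≤_ (sym (ℤP.*-identityʳ (+ m))) (sym (ℤP.*-identityʳ (+ n))) (ℤ.+≤+ h))

-- c·y − c·x = v − u with c > 0, so x < y exactly when u < v.
compare : ∀ n {x y} u v → ℕ→ℚ (suc n) ℚ.* y ℚ.+ ℕ→ℚ u ≡ ℕ→ℚ (suc n) ℚ.* x ℚ.+ ℕ→ℚ v →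
          ⌊ x ℚP.<? y ⌋ ≡ does (u ℕ.<? v)
compare n {x} {y} u v eq = trans (isYes≗does (x ℚP.<? y)) (does-⇔ (mk⇔ to from) (x ℚP.<? y) (u ℕ.<? v))
  where
  c = ℕ→ℚ (suc n)
  instance
    c>0 : ℚ.Positive c
    c>0 = ℚ.positive {c} (ℕ→ℚ-mono-< {0} {suc n} (s≤s z≤n))
    c≥0 : ℚ.NonNegative c
    c≥0 = ℚP.pos⇒nonNeg c
  to : x ℚ.< y → u ℕ.< v
  to x<y = ℕP.≰⇒> λ v≤u → ℚP.<-irrefl (sym eq) (ℚP.+-mono-<-≤ (ℚP.*-monoʳ-<-pos c x<y) (ℕ→ℚ-mono-≤ v≤u))
  from : u ℕ.< v → x ℚ.< y
  from u<v = ℚP.≰⇒> λ y≤x → ℚP.<-irrefl eq (ℚP.+-mono-≤-< (ℚP.*-monoˡ-≤-nonNeg c y≤x) (ℕ→ℚ-mono-< u<v))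

-- Sides of endpoints and midpoints relative to γ

module Bits (p q : ℕ) (prim : Primitive (suc p) (suc q)) where

  open Crossings p q prim

  private
    cross-sign : ∀ x y → cross (+ Q , + P) (+ x , + y) ≡ + (Q ℕ.* y) ℤ.- + (P ℕ.* x)
    cross-sign x y = cong₂ ℤ._-_ (sym (ℤP.pos-* Q y)) (sym (ℤP.pos-* P x))

  rightOf-true : ∀ x y → Q ℕ.* y ℕ.< P ℕ.* x → rightOf P Q (+ x , + y) ≡ true
  rightOf-true x y lt = trans (isYes≗does (cross (+ Q , + P) (+ x , + y) ℤP.<? + 0))
    (dec-true (cross (+ Q , + P) (+ x , + y) ℤP.<? + 0) (subst (ℤ._< + 0) (sym (cross-sign x y))
      (ℤP.≤∧≢⇒< (ℤP.i≤j⇒i-j≤0 (ℤ.+≤+ (ℕP.<⇒≤ lt))) λ eq → ℕP.<⇒≢ lt (ℤP.+-injective (ℤP.i-j≡0⇒i≡j _ _ eq)))))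

  rightOf-false : ∀ x y → P ℕ.* x ℕ.< Q ℕ.* y → rightOf P Q (+ x , + y) ≡ false
  rightOf-false x y lt = trans (isYes≗does (cross (+ Q , + P) (+ x , + y) ℤP.<? + 0))
    (dec-false (cross (+ Q , + P) (+ x , + y) ℤP.<? + 0)
      (λ neg → ℤP.<⇒≱ (subst (ℤ._< + 0) (cross-sign x y) neg) (ℤP.i≤j⇒0≤j-i (ℤ.+≤+ (ℕP.<⇒≤ lt)))))

  private
    closer : ∀ {c R L b} → rightEnd P Q (Crossing.τ c) ≡ R → leftEnd P Q (Crossing.τ c) ≡ L →
      ⌊ dist² (Crossing.Cx c) (Crossing.Cy c) R ℚP.<? dist² (Crossing.Cx c) (Crossing.Cy c) L ⌋ ≡ b → closerToRight P Q c ≡ b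
    closer refl refl eq = eq

    ends-right : ∀ {τ} → rightOf P Q (Seg.A τ) ≡ true → rightEnd P Q τ ≡ Seg.A τ × leftEnd P Q τ ≡ Seg.B τ
    ends-right {τ} eq = cong (λ b → if b then Seg.A τ else Seg.B τ) eq , cong (λ b → if b then Seg.B τ else Seg.A τ) eq

    ends-left : ∀ {τ} → rightOf P Q (Seg.A τ) ≡ false → rightEnd P Q τ ≡ Seg.B τ × leftEnd P Q τ ≡ Seg.A τ
    ends-left {τ} eq = cong (λ b → if b then Seg.A τ else Seg.B τ) eq , cong (λ b → if b then Seg.B τ else Seg.A τ) eq

    e : ℕ → ℚ
    e = ℕ→ℚ
    e-odd : ∀ n → e (suc (2 ℕ.* n)) ≡ 1ℚ ℚ.+ (1ℚ ℚ.+ 1ℚ) ℚ.* e n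
    e-odd n = trans (ℕ→ℚ-suc (2 ℕ.* n)) (cong (1ℚ ℚ.+_) (ℕ→ℚ-* 2 n))
    e+1 : ∀ n → e (n ℕ.+ 1) ≡ e n ℚ.+ 1ℚ
    e+1 n = ℕ→ℚ-+ n 1

  open ≡-Reasoning

  -- At height y the squared distances to the upper and the lower end differ by 2 g + 1 - 2 y. So
  -- the crossing is closer to the lower end, which is the right one, exactly when it lies below the
  -- midpoint, that is, when the midpoint is left of γ. The factor Q clears the denominator of y.
  closer-V : ∀ f g → Q ℕ.* g ℕ.< P ℕ.* suc f → closerToRight P Q (crossV f g) ≡ σ (even f) (odd g)
  closer-V f g below = closer {crossV f g} (proj₁ ends) (proj₂ ends) (compare q (P ℕ.* even f) (Q ℕ.* odd g) equation)
    where
    ends = ends-right {segV f g} (rightOf-true (suc f) g below)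
    t = + suc f ℚ./ suc q
    cx = t ℚ.* e Q
    cy = t ℚ.* e P
    dx = (cx ℚ.- e (suc f)) ℚ.* (cx ℚ.- e (suc f))
    equation : e Q ℚ.* (dx ℚ.+ (cy ℚ.- e (g ℕ.+ 1)) ℚ.* (cy ℚ.- e (g ℕ.+ 1))) ℚ.+ e (P ℕ.* even f)
             ≡ e Q ℚ.* (dx ℚ.+ (cy ℚ.- e g) ℚ.* (cy ℚ.- e g)) ℚ.+ e (Q ℕ.* odd g)
    equation = begin
      e Q ℚ.* (dx ℚ.+ (cy ℚ.- e (g ℕ.+ 1)) ℚ.* (cy ℚ.- e (g ℕ.+ 1))) ℚ.+ e (P ℕ.* even f)
        ≡⟨ cong₂ (λ a b → e Q ℚ.* (dx ℚ.+ (cy ℚ.- a) ℚ.* (cy ℚ.- a)) ℚ.+ b) (e+1 g)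
             (trans (ℕ→ℚ-* P (even f)) (cong (e P ℚ.*_) (trans (ℕ→ℚ-* 2 (suc f)) (cong ((1ℚ ℚ.+ 1ℚ) ℚ.*_) (sym (ℕ→ℚ-*-/ q (suc f))))))) ⟩
      e Q ℚ.* (dx ℚ.+ (cy ℚ.- (e g ℚ.+ 1ℚ)) ℚ.* (cy ℚ.- (e g ℚ.+ 1ℚ))) ℚ.+ e P ℚ.* ((1ℚ ℚ.+ 1ℚ) ℚ.* (e Q ℚ.* t))
        ≡⟨ solve 5 (λ P Q t G D → Q :* (D :+ (t :* P :- (G :+ con 1ℚ)) :* (t :* P :- (G :+ con 1ℚ))) :+ P :* ((con 1ℚ :+ con 1ℚ) :* (Q :* t))
             := Q :* (D :+ (t :* P :- G) :* (t :* P :- G)) :+ Q :* (con 1ℚ :+ (con 1ℚ :+ con 1ℚ) :* G)) refl (e P) (e Q) t (e g) dx ⟩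
      e Q ℚ.* (dx ℚ.+ (cy ℚ.- e g) ℚ.* (cy ℚ.- e g)) ℚ.+ e Q ℚ.* (1ℚ ℚ.+ (1ℚ ℚ.+ 1ℚ) ℚ.* e g)
        ≡⟨ cong (e Q ℚ.* (dx ℚ.+ (cy ℚ.- e g) ℚ.* (cy ℚ.- e g)) ℚ.+_) (sym (trans (ℕ→ℚ-* Q (odd g)) (cong (e Q ℚ.*_) (e-odd g)))) ⟩
      e Q ℚ.* (dx ℚ.+ (cy ℚ.- e g) ℚ.* (cy ℚ.- e g)) ℚ.+ e (Q ℕ.* odd g) ∎
      where open ℚSolver

  closer-H : ∀ f g → P ℕ.* f ℕ.< Q ℕ.* suc g → closerToRight P Q (crossH f g) ≡ σ (odd f) (even g)
  closer-H f g above = closer {crossH f g} (proj₁ ends) (proj₂ ends) (compare p (P ℕ.* odd f) (Q ℕ.* even g) equation)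
    where
    ends = ends-left {segH f g} (rightOf-false f (suc g) above)
    t = + suc g ℚ./ suc p
    cx = t ℚ.* e Q
    cy = t ℚ.* e P
    dy = (cy ℚ.- e (suc g)) ℚ.* (cy ℚ.- e (suc g))
    equation : e P ℚ.* ((cx ℚ.- e f) ℚ.* (cx ℚ.- e f) ℚ.+ dy) ℚ.+ e (P ℕ.* odd f)
             ≡ e P ℚ.* ((cx ℚ.- e (f ℕ.+ 1)) ℚ.* (cx ℚ.- e (f ℕ.+ 1)) ℚ.+ dy) ℚ.+ e (Q ℕ.* even g)
    equation = begin
      e P ℚ.* ((cx ℚ.- e f) ℚ.* (cx ℚ.- e f) ℚ.+ dy) ℚ.+ e (P ℕ.* odd f)
        ≡⟨ cong (e P ℚ.* ((cx ℚ.- e f) ℚ.* (cx ℚ.- e f) ℚ.+ dy) ℚ.+_) (trans (ℕ→ℚ-* P (odd f)) (cong (e P ℚ.*_) (e-odd f))) ⟩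
      e P ℚ.* ((cx ℚ.- e f) ℚ.* (cx ℚ.- e f) ℚ.+ dy) ℚ.+ e P ℚ.* (1ℚ ℚ.+ (1ℚ ℚ.+ 1ℚ) ℚ.* e f)
        ≡⟨ solve 5 (λ P Q t F D → P :* ((t :* Q :- F) :* (t :* Q :- F) :+ D) :+ P :* (con 1ℚ :+ (con 1ℚ :+ con 1ℚ) :* F)
             := P :* ((t :* Q :- (F :+ con 1ℚ)) :* (t :* Q :- (F :+ con 1ℚ)) :+ D) :+ Q :* ((con 1ℚ :+ con 1ℚ) :* (P :* t))) refl (e P) (e Q) t (e f) dy ⟩
      e P ℚ.* ((cx ℚ.- (e f ℚ.+ 1ℚ)) ℚ.* (cx ℚ.- (e f ℚ.+ 1ℚ)) ℚ.+ dy) ℚ.+ e Q ℚ.* ((1ℚ ℚ.+ 1ℚ) ℚ.* (e P ℚ.* t))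
        ≡⟨ sym (cong₂ (λ a b → e P ℚ.* ((cx ℚ.- a) ℚ.* (cx ℚ.- a) ℚ.+ dy) ℚ.+ b) (e+1 f)
             (trans (ℕ→ℚ-* Q (even g)) (cong (e Q ℚ.*_) (trans (ℕ→ℚ-* 2 (suc g)) (cong ((1ℚ ℚ.+ 1ℚ) ℚ.*_) (sym (ℕ→ℚ-*-/ p (suc g)))))))) ⟩
      e P ℚ.* ((cx ℚ.- e (f ℕ.+ 1)) ℚ.* (cx ℚ.- e (f ℕ.+ 1)) ℚ.+ dy) ℚ.+ e (Q ℕ.* even g) ∎
      where open ℚSolver

  closer-D : ∀ f g → P ℕ.* f ℕ.< Q ℕ.* suc g → closerToRight P Q (crossD f g) ≡ σ (odd f) (odd g)
  closer-D f g above = closer {crossD f g} (proj₁ ends) (proj₂ ends)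
    (trans (compare (p ℕ.+ suc q) (2 ℕ.* (P ℕ.* odd f)) (2 ℕ.* (Q ℕ.* odd g)) equation)
      (does-⇔ (mk⇔ (ℕP.*-cancelˡ-< 2 (P ℕ.* odd f) (Q ℕ.* odd g)) (ℕP.*-monoʳ-< 2)) (_ ℕ.<? _) (P ℕ.* odd f ℕ.<? Q ℕ.* odd g)))
    where
    ends = ends-left {segD f g} (trans (cong (λ z → rightOf P Q (+ f , + z)) (ℕP.+-comm g 1)) (rightOf-false f (suc g) above))
    N = suc (p ℕ.+ suc q)
    t = + (f ℕ.+ g ℕ.+ 1) ℚ./ N
    cx = t ℚ.* e Q
    cy = t ℚ.* e P
    two = 1ℚ ℚ.+ 1ℚ
    N≡ : e N ≡ e P ℚ.+ e Q
    N≡ = ℕ→ℚ-+ P Q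
    -- `equation` depends on this value of (P + Q) t, which is substituted between two polynomial
    -- identities.
    t≡ : (e P ℚ.+ e Q) ℚ.* t ≡ e f ℚ.+ e g ℚ.+ 1ℚ
    t≡ = trans (cong (ℚ._* t) (sym N≡)) (trans (ℕ→ℚ-*-/ (p ℕ.+ suc q) (f ℕ.+ g ℕ.+ 1)) (trans (e+1 (f ℕ.+ g)) (cong (ℚ._+ 1ℚ) (ℕ→ℚ-+ f g))))
    2* : ∀ m n → e (2 ℕ.* (m ℕ.* odd n)) ≡ two ℚ.* (e m ℚ.* (1ℚ ℚ.+ two ℚ.* e n))
    2* m n = trans (ℕ→ℚ-* 2 (m ℕ.* odd n)) (cong (two ℚ.*_) (trans (ℕ→ℚ-* m (odd n)) (cong (e m ℚ.*_) (e-odd n))))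
    R = (cx ℚ.- (e f ℚ.+ 1ℚ)) ℚ.* (cx ℚ.- (e f ℚ.+ 1ℚ)) ℚ.+ (cy ℚ.- e g) ℚ.* (cy ℚ.- e g)
    L = (cx ℚ.- e f) ℚ.* (cx ℚ.- e f) ℚ.+ (cy ℚ.- (e g ℚ.+ 1ℚ)) ℚ.* (cy ℚ.- (e g ℚ.+ 1ℚ))
    equation : e N ℚ.* ((cx ℚ.- e f) ℚ.* (cx ℚ.- e f) ℚ.+ (cy ℚ.- e (g ℕ.+ 1)) ℚ.* (cy ℚ.- e (g ℕ.+ 1))) ℚ.+ e (2 ℕ.* (P ℕ.* odd f))
             ≡ e N ℚ.* ((cx ℚ.- e (f ℕ.+ 1)) ℚ.* (cx ℚ.- e (f ℕ.+ 1)) ℚ.+ (cy ℚ.- e g) ℚ.* (cy ℚ.- e g)) ℚ.+ e (2 ℕ.* (Q ℕ.* odd g))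
    equation = begin
      e N ℚ.* ((cx ℚ.- e f) ℚ.* (cx ℚ.- e f) ℚ.+ (cy ℚ.- e (g ℕ.+ 1)) ℚ.* (cy ℚ.- e (g ℕ.+ 1))) ℚ.+ e (2 ℕ.* (P ℕ.* odd f))
        ≡⟨ cong₂ (λ a b → a ℚ.* ((cx ℚ.- e f) ℚ.* (cx ℚ.- e f) ℚ.+ (cy ℚ.- b) ℚ.* (cy ℚ.- b)) ℚ.+ e (2 ℕ.* (P ℕ.* odd f))) N≡ (e+1 g) ⟩
      (e P ℚ.+ e Q) ℚ.* L ℚ.+ e (2 ℕ.* (P ℕ.* odd f))
        ≡⟨ cong ((e P ℚ.+ e Q) ℚ.* L ℚ.+_) (2* P f) ⟩
      (e P ℚ.+ e Q) ℚ.* L ℚ.+ two ℚ.* (e P ℚ.* (1ℚ ℚ.+ two ℚ.* e f))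
        ≡⟨ solve 5 (λ P Q t F G →
             let two = con 1ℚ :+ con 1ℚ ; L = (t :* Q :- F) :* (t :* Q :- F) :+ (t :* P :- (G :+ con 1ℚ)) :* (t :* P :- (G :+ con 1ℚ))
                 R = (t :* Q :- (F :+ con 1ℚ)) :* (t :* Q :- (F :+ con 1ℚ)) :+ (t :* P :- G) :* (t :* P :- G) in
             (P :+ Q) :* L :+ two :* (P :* (con 1ℚ :+ two :* F))
             := (P :+ Q) :* R :+ two :* ((Q :- P) :* ((P :+ Q) :* t) :- (P :+ Q) :* (F :- G) :+ P :* (con 1ℚ :+ two :* F))) refl (e P) (e Q) t (e f) (e g) ⟩
      (e P ℚ.+ e Q) ℚ.* R ℚ.+ two ℚ.* ((e Q ℚ.- e P) ℚ.* ((e P ℚ.+ e Q) ℚ.* t) ℚ.- (e P ℚ.+ e Q) ℚ.* (e f ℚ.- e g) ℚ.+ e P ℚ.* (1ℚ ℚ.+ two ℚ.* e f))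
        ≡⟨ cong (λ z → (e P ℚ.+ e Q) ℚ.* R ℚ.+ two ℚ.* ((e Q ℚ.- e P) ℚ.* z ℚ.- (e P ℚ.+ e Q) ℚ.* (e f ℚ.- e g) ℚ.+ e P ℚ.* (1ℚ ℚ.+ two ℚ.* e f))) t≡ ⟩
      (e P ℚ.+ e Q) ℚ.* R ℚ.+ two ℚ.* ((e Q ℚ.- e P) ℚ.* (e f ℚ.+ e g ℚ.+ 1ℚ) ℚ.- (e P ℚ.+ e Q) ℚ.* (e f ℚ.- e g) ℚ.+ e P ℚ.* (1ℚ ℚ.+ two ℚ.* e f))
        ≡⟨ cong ((e P ℚ.+ e Q) ℚ.* R ℚ.+_) (solve 4 (λ P Q F G → let two = con 1ℚ :+ con 1ℚ in
             two :* ((Q :- P) :* (F :+ G :+ con 1ℚ) :- (P :+ Q) :* (F :- G) :+ P :* (con 1ℚ :+ two :* F)) := two :* (Q :* (con 1ℚ :+ two :* G))) refl (e P) (e Q) (e f) (e g)) ⟩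
      (e P ℚ.+ e Q) ℚ.* R ℚ.+ two ℚ.* (e Q ℚ.* (1ℚ ℚ.+ two ℚ.* e g))
        ≡⟨ cong ((e P ℚ.+ e Q) ℚ.* R ℚ.+_) (sym (2* Q g)) ⟩
      (e P ℚ.+ e Q) ℚ.* R ℚ.+ e (2 ℕ.* (Q ℕ.* odd g))
        ≡⟨ sym (cong₂ (λ a b → a ℚ.* ((cx ℚ.- b) ℚ.* (cx ℚ.- b) ℚ.+ (cy ℚ.- e g) ℚ.* (cy ℚ.- e g)) ℚ.+ e (2 ℕ.* (Q ℕ.* odd g))) N≡ (e+1 f)) ⟩
      e N ℚ.* ((cx ℚ.- e (f ℕ.+ 1)) ℚ.* (cx ℚ.- e (f ℕ.+ 1)) ℚ.+ (cy ℚ.- e g) ℚ.* (cy ℚ.- e g)) ℚ.+ e (2 ℕ.* (Q ℕ.* odd g)) ∎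
      where open ℚSolver

-- Order ideals of fences

module LM = Matrices _≋_ _⊕_ _⊗_ ⊝_ cst LP-isCommutativeRing
  (λ c d → term-+ c d 0ᵉ) (λ _ _ → ≋-refl) (λ _ → ≋-refl)
open LM using
  ( Matrix; _≃ᴹ_; entries; ≃ᴹ-refl; ≃ᴹ-sym; ≃ᴹ-trans; _·_; ·-cong; adj; adj-cong; trace; ent₁₂; T-of; G; U; L; J
  ; Vector; _≃ᵛ_; both; ≃ᵛ-sym; ≃ᵛ-trans; act; act-cong; act-·; act-U; act-L )

S : (List Bool → Bool) → List LP → LP
S R ws = foldr (λ s acc → if R s then weightOf ws s ⊕ acc else acc) 𝟘 (subsets (length ws))

S-cong : ∀ {R R′} ws → (∀ s → R s ≡ R′ s) → S R ws ≡ S R′ ws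
S-cong {R} {R′} ws eq = go (subsets (length ws))
  where
  go : ∀ ss → foldr (λ s acc → if R s then weightOf ws s ⊕ acc else acc) 𝟘 ss ≡
              foldr (λ s acc → if R′ s then weightOf ws s ⊕ acc else acc) 𝟘 ss
  go [] = refl
  go (s ∷ ss) = cong₂ (λ b acc → if b then weightOf ws s ⊕ acc else acc) (eq s) (go ss)

S-none : ∀ ws → S (λ _ → false) ws ≡ 𝟘
S-none ws = go (subsets (length ws))
  where
  go : ∀ ss → foldr (λ s acc → acc) 𝟘 ss ≡ 𝟘
  go [] = refl
  go (s ∷ ss) = go ss

S-∷ : ∀ R w ws → S R (w ∷ ws) ≋ w ⊗ S (λ s → R (true ∷ s)) ws ⊕ S (λ s → R (false ∷ s)) ws
S-∷ R w ws = go (subsets (length ws))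
  where
  sum : (List Bool → Bool) → List LP → List (List Bool) → LP
  sum R ws ss = foldr (λ s acc → if R s then weightOf ws s ⊕ acc else acc) 𝟘 ss
  go : ∀ ss → sum R (w ∷ ws) (concatMap (λ s → (true ∷ s) ∷ (false ∷ s) ∷ []) ss) ≋
              w ⊗ sum (λ s → R (true ∷ s)) ws ss ⊕ sum (λ s → R (false ∷ s)) ws ss
  go [] = ≋-sym (≡⇒≋ (cong (_⊕ 𝟘) (⊗-zeroʳ w)))
  go (s ∷ ss) = LM.insertTerm-step (R (true ∷ s)) (R (false ∷ s)) w (weightOf ws s)
    (sum (λ s → R (true ∷ s)) ws ss) (sum (λ s → R (false ∷ s)) ws ss)
    (sum R (w ∷ ws) (concatMap (λ s → (true ∷ s) ∷ (false ∷ s) ∷ []) ss)) (go ss)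

data End : Set where
  free excluded : End

endOK : End → List Bool → Bool
endOK free     s = true
endOK excluded s = lastFalse s

endVector : End → Vector
endVector free     = (𝟙 , 𝟙)
endVector excluded = (𝟙 , 𝟘)

-- Sums over the ideals which avoid, respectively contain, the first element.
rest : End → Bool → List LP → List Bool → LP
rest ℓ x ws rs = S (λ s → isIdeal (x ∷ s) rs ∧ endOK ℓ (x ∷ s)) ws

states : End → Fence → Vector
states ℓ (fence [] rs) = (𝟘 , 𝟘)
states ℓ (fence (w ∷ ws) rs) = (rest ℓ false ws rs , w ⊗ rest ℓ true ws rs)

private
  ∧-reassoc : ∀ a b c → (a ∧ b) ∧ c ≡ a ∧ (b ∧ c)
  ∧-reassoc = BoolP.∧-assoc

  endOK-∷ : ∀ ℓ x y s → endOK ℓ (x ∷ y ∷ s) ≡ endOK ℓ (y ∷ s)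
  endOK-∷ free x y s = refl
  endOK-∷ excluded x y s = refl

  when : Bool → LP → LP
  when true  x = x
  when false x = 𝟘


  rest-next : ∀ ℓ x y r ws rs → S (λ s → isIdeal (x ∷ y ∷ s) (r ∷ rs) ∧ endOK ℓ (x ∷ y ∷ s)) ws ≡
              when (if r then x ⇒ᵇ y else y ⇒ᵇ x) (rest ℓ y ws rs)
  rest-next ℓ x y r ws rs = trans (S-cong ws λ s → trans (∧-reassoc ok _ _) (cong (λ b → ok ∧ (isIdeal (y ∷ s) rs ∧ b)) (endOK-∷ ℓ x y s))) (pull ok)
    where
    ok = if r then x ⇒ᵇ y else y ⇒ᵇ x
    pull : ∀ b → S (λ s → b ∧ (isIdeal (y ∷ s) rs ∧ endOK ℓ (y ∷ s))) ws ≡ when b (rest ℓ y ws rs)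
    pull true = refl
    pull false = S-none ws

  rest-∷ : ∀ ℓ x r w ws rs → rest ℓ x (w ∷ ws) (r ∷ rs) ≋
    w ⊗ when (if r then x ⇒ᵇ true else true ⇒ᵇ x) (rest ℓ true ws rs) ⊕ when (if r then x ⇒ᵇ false else false ⇒ᵇ x) (rest ℓ false ws rs)
  rest-∷ ℓ x r w ws rs = ≋-trans (S-∷ _ w ws)
    (≡⇒≋ (cong₂ (λ X Y → w ⊗ X ⊕ Y) (rest-next ℓ x true r ws rs) (rest-next ℓ x false r ws rs)))

⊕-identityʳ : ∀ x → x ⊕ 𝟘 ≋ x
⊕-identityʳ x = ⊕-comm x 𝟘

prepend : LP → Vector → Vector
prepend w (o , i) = (o , w ⊗ i)

prepend-cong : ∀ w {u v} → u ≃ᵛ v → prepend w u ≃ᵛ prepend w v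
prepend-cong w (both x y) = both x (⊗-congʳ w y)

-- If the new element is greater, an ideal containing it contains the old first element; if it is
-- smaller, an ideal avoiding it avoids the old first element. Of the four combinations one is lost,
-- and it is the zero entry of `J r`.
states-∷ : ∀ ℓ w r w′ ws rs → states ℓ (fence (w ∷ w′ ∷ ws) (r ∷ rs)) ≃ᵛ prepend w (act (J r) (states ℓ (fence (w′ ∷ ws) rs)))
states-∷ ℓ w true w′ ws rs = ≃ᵛ-trans
  (both (≋-trans (rest-∷ ℓ false true w′ ws rs) (⊕-comm i o))
        (⊗-congʳ w (≋-trans (rest-∷ ℓ true true w′ ws rs) (⊕-identityʳ i))))
  (prepend-cong w (≃ᵛ-sym (act-U o i)))
  where
  o = rest ℓ false ws rs
  i = w′ ⊗ rest ℓ true ws rs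
states-∷ ℓ w false w′ ws rs = ≃ᵛ-trans
  (both (≋-trans (rest-∷ ℓ false false w′ ws rs) (≡⇒≋ (cong (_⊕ o) (⊗-zeroʳ w′))))
        (⊗-congʳ w (≋-trans (rest-∷ ℓ true false w′ ws rs) (⊕-comm i o))))
  (prepend-cong w (≃ᵛ-sym (act-L o i)))
  where
  o = rest ℓ false ws rs
  i = w′ ⊗ rest ℓ true ws rs

states-[-] : ∀ ℓ w → states ℓ (fence (w ∷ []) []) ≡ prepend w (endVector ℓ)
states-[-] free w = refl
states-[-] excluded w = refl

𝒲-states : ∀ w ws rs → 𝒲 (fence (w ∷ ws) rs) ≋ proj₁ (states free (fence (w ∷ ws) rs)) ⊕ proj₂ (states free (fence (w ∷ ws) rs))
𝒲-states w ws rs = ≋-trans (S-∷ _ w ws) (⊕-comm (w ⊗ rest free true ws rs) (rest free false ws rs))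

𝒲¬R-states : ∀ w ws rs → 𝒲¬R (fence (w ∷ ws) rs) ≋ proj₁ (states excluded (fence (w ∷ ws) rs)) ⊕ proj₂ (states excluded (fence (w ∷ ws) rs))
𝒲¬R-states w ws rs = ≋-trans (S-∷ _ w ws) (⊕-comm (w ⊗ rest excluded true ws rs) (rest excluded false ws rs))

private
  none-first : ∀ (R : List Bool → Bool) w ws → (∀ s → R (true ∷ s) ≡ false) →
               S R (w ∷ ws) ≋ S (λ s → R (false ∷ s)) ws
  none-first R w ws h = ≋-trans (S-∷ R w ws)
    (≡⇒≋ (cong (_⊕ S (λ s → R (false ∷ s)) ws) (trans (cong (w ⊗_) (trans (S-cong ws h) (S-none ws))) (⊗-zeroʳ w))))

𝒲¬L-states : ∀ w ws rs → 𝒲¬L (fence (w ∷ ws) rs) ≋ proj₁ (states free (fence (w ∷ ws) rs))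
𝒲¬L-states w ws rs = none-first _ w ws (λ s → BoolP.∧-zeroʳ _)

𝒲¬L¬R-states : ∀ w ws rs → 𝒲¬L¬R (fence (w ∷ ws) rs) ≋ proj₁ (states excluded (fence (w ∷ ws) rs))
𝒲¬L¬R-states w ws rs = none-first _ w ws (λ s → BoolP.∧-zeroʳ _)

join : Fence → Bool → Fence → Fence
join (fence w₁ r₁) b (fence w₂ r₂) = fence (w₁ ++ w₂) (r₁ ++ (b ∷ r₂))

groupOf : ℕ → Bool → Pos → Fence
groupOf zero    b     a = fence (term 1ℚ (hatᵉ a +ᵉ hatᵉ a) ∷ []) []
groupOf (suc k) true  a = fence (term (+ 1 ℚ./ suc k) (hatᵉ a) ∷ term (ℕ→ℚ (suc k)) (hatᵉ a) ∷ []) (true ∷ [])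
groupOf (suc k) false a = fence (term (ℕ→ℚ (suc k)) (hatᵉ a) ∷ term (+ 1 ℚ./ suc k) (hatᵉ a) ∷ []) (false ∷ [])

groupMatrix : ℕ → Bool → Pos → Matrix
groupMatrix k b a = G b (cst (ℕ→ℚ k) ⊗ 𝐱^ (hatᵉ a)) (𝐱^ (hatᵉ a) ⊗ 𝐱^ (hatᵉ a))

private
  module _ (k : ℕ) (a : Pos) where
    small large : LP
    small = term (ℕ→ℚ (suc k)) (hatᵉ a)
    large = term (+ 1 ℚ./ suc k) (hatᵉ a)

    κ≋small : cst (ℕ→ℚ (suc k)) ⊗ 𝐱^ (hatᵉ a) ≋ small
    κ≋small = term-cong (ℚP.*-identityʳ _) (+ᵉ-identityˡ (hatᵉ a))

    -- An ideal containing the larger element contains the smaller one as well, so 1/k always meets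
    -- k and x̂² remains.
    large⊗small : large ⊗ small ≋ 𝐱^ (hatᵉ a) ⊗ 𝐱^ (hatᵉ a)
    large⊗small = term-cong (trans (ℚP.*-comm (+ 1 ℚ./ suc k) (ℕ→ℚ (suc k))) (ℕ→ℚ-*-/ k 1)) refl

    combine-true : ∀ v → prepend large (act U (prepend small v)) ≃ᵛ act (groupMatrix (suc k) true a) v
    combine-true (o , i) = ≃ᵛ-trans (prepend-cong large (act-U o (small ⊗ i)))
      (≃ᵛ-sym (LM.larger-first {large} {small} {𝐱^ (hatᵉ a) ⊗ 𝐱^ (hatᵉ a)} (cst (ℕ→ℚ (suc k)) ⊗ 𝐱^ (hatᵉ a)) o i κ≋small large⊗small))

    combine-false : ∀ v → prepend small (act L (prepend large v)) ≃ᵛ act (groupMatrix (suc k) false a) v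
    combine-false (o , i) = ≃ᵛ-trans (prepend-cong small (act-L o (large ⊗ i)))
      (≃ᵛ-sym (LM.smaller-first {large} {small} {𝐱^ (hatᵉ a) ⊗ 𝐱^ (hatᵉ a)} (cst (ℕ→ℚ (suc k)) ⊗ 𝐱^ (hatᵉ a)) o i κ≋small large⊗small))

  combine-zero : ∀ b a v → prepend (term 1ℚ (hatᵉ a +ᵉ hatᵉ a)) v ≃ᵛ act (groupMatrix 0 b a) v
  combine-zero b a (o , i) = ≃ᵛ-sym (LM.act-G-zero b (𝐱^ (hatᵉ a) ⊗ 𝐱^ (hatᵉ a)) o i
    (≋-trans (term-0 (0ᵉ +ᵉ hatᵉ a)) (≋-sym (term-0 0ᵉ))))

states-group : ∀ ℓ k b a → states ℓ (groupOf k b a) ≃ᵛ act (groupMatrix k b a) (endVector ℓ)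
states-group ℓ zero b a = subst (_≃ᵛ act (groupMatrix 0 b a) (endVector ℓ)) (sym (states-[-] ℓ (term 1ℚ (hatᵉ a +ᵉ hatᵉ a)))) (combine-zero b a (endVector ℓ))
states-group ℓ (suc k) true a = ≃ᵛ-trans (states-∷ ℓ (large k a) true (small k a) [] [])
  (subst (λ v → prepend (large k a) (act U v) ≃ᵛ act (groupMatrix (suc k) true a) (endVector ℓ)) (sym (states-[-] ℓ (small k a)))
    (combine-true k a (endVector ℓ)))
states-group ℓ (suc k) false a = ≃ᵛ-trans (states-∷ ℓ (small k a) false (large k a) [] [])
  (subst (λ v → prepend (small k a) (act L v) ≃ᵛ act (groupMatrix (suc k) false a) (endVector ℓ)) (sym (states-[-] ℓ (large k a)))
    (combine-false k a (endVector ℓ)))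

states-join : ∀ ℓ k b a r w ws rs → states ℓ (join (groupOf k b a) r (fence (w ∷ ws) rs)) ≃ᵛ
  act (groupMatrix k b a) (act (J r) (states ℓ (fence (w ∷ ws) rs)))
states-join ℓ zero b a r w ws rs = ≃ᵛ-trans (states-∷ ℓ (term 1ℚ (hatᵉ a +ᵉ hatᵉ a)) r w ws rs) (combine-zero b a (act (J r) (states ℓ (fence (w ∷ ws) rs))))
states-join ℓ (suc k) true a r w ws rs = ≃ᵛ-trans (states-∷ ℓ (large k a) true (small k a) (w ∷ ws) (r ∷ rs))
  (≃ᵛ-trans (prepend-cong (large k a) (act-cong U (states-∷ ℓ (small k a) r w ws rs))) (combine-true k a (act (J r) (states ℓ (fence (w ∷ ws) rs)))))
states-join ℓ (suc k) false a r w ws rs = ≃ᵛ-trans (states-∷ ℓ (small k a) false (large k a) (w ∷ ws) (r ∷ rs))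
  (≃ᵛ-trans (prepend-cong (small k a) (act-cong L (states-∷ ℓ (large k a) r w ws rs))) (combine-false k a (act (J r) (states ℓ (fence (w ∷ ws) rs)))))

data NonEmpty : Fence → Set where
  nonEmpty : ∀ {w ws rs} → NonEmpty (fence (w ∷ ws) rs)

join-nonEmpty : ∀ {F} r F′ → NonEmpty F → NonEmpty (join F r F′)
join-nonEmpty r F′ nonEmpty = nonEmpty

groupOf-nonEmpty : ∀ k b a → NonEmpty (groupOf k b a)
groupOf-nonEmpty zero b a = nonEmpty
groupOf-nonEmpty (suc k) true a = nonEmpty
groupOf-nonEmpty (suc k) false a = nonEmpty

states-join′ : ∀ ℓ k b a r {F} → NonEmpty F → states ℓ (join (groupOf k b a) r F) ≃ᵛ act (groupMatrix k b a) (act (J r) (states ℓ F))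
states-join′ ℓ k b a r (nonEmpty {w} {ws} {rs}) = states-join ℓ k b a r w ws rs

module _ (k₁ k₂ k₃ : ℕ) where

  -- `groupOf` takes the bit as an argument, so that the geometric comparison can be replaced by the
  -- side of the midpoint.
  group≡ : ∀ P Q c → group k₁ k₂ k₃ P Q c ≡ groupOf (kOf k₁ k₂ k₃ (Seg.lbl (Crossing.τ c))) (closerToRight P Q c) (Seg.lbl (Crossing.τ c))
  group≡ P Q c with kOf k₁ k₂ k₃ (Seg.lbl (Crossing.τ c))
  ... | zero = refl
  ... | suc k with closerToRight P Q c
  ...   | true = refl
  ...   | false = refl

  fenceOf-nonEmpty : ∀ P Q c cs → NonEmpty (fenceOf k₁ k₂ k₃ P Q (c ∷ cs))
  fenceOf-nonEmpty P Q c [] = subst NonEmpty (sym (group≡ P Q c)) (groupOf-nonEmpty _ _ _)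
  fenceOf-nonEmpty P Q c (d ∷ cs) = join-nonEmpty _ (fenceOf k₁ k₂ k₃ P Q (d ∷ cs))
    (subst NonEmpty (sym (group≡ P Q c)) (groupOf-nonEmpty _ _ _))

  x̂₁ x̂₂ x̂₃ x̂₂⁻¹ : LP
  x̂₁ = 𝐱^ (hatᵉ ①')
  x̂₂ = 𝐱^ (hatᵉ ②')
  x̂₃ = 𝐱^ (hatᵉ ③')
  x̂₂⁻¹ = 𝐱^ (+ 1 , + 0 , -[1+ 0 ])

  module T = LM.Transfer (cst (ℕ→ℚ k₁)) (cst (ℕ→ℚ k₂)) (cst (ℕ→ℚ k₃)) x̂₁ x̂₂ x̂₃ x̂₂⁻¹ ≋-refl ≋-refl

  states-∷∷ : ∀ ℓ P Q c d cs {bit r} → closerToRight P Q c ≡ bit →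
    rightOf P Q (sharedEnd (Crossing.τ c) (Crossing.τ d)) ≡ r →
    states ℓ (fenceOf k₁ k₂ k₃ P Q (c ∷ d ∷ cs)) ≃ᵛ
      act (groupMatrix (kOf k₁ k₂ k₃ (Seg.lbl (Crossing.τ c))) bit (Seg.lbl (Crossing.τ c)))
          (act (J r) (states ℓ (fenceOf k₁ k₂ k₃ P Q (d ∷ cs))))
  states-∷∷ ℓ P Q c d cs {bit} {r} refl refl =
    subst (λ F → states ℓ (join F r (fenceOf k₁ k₂ k₃ P Q (d ∷ cs))) ≃ᵛ
                 act (groupMatrix (kOf k₁ k₂ k₃ a) bit a) (act (J r) (states ℓ (fenceOf k₁ k₂ k₃ P Q (d ∷ cs)))))
      (sym (group≡ P Q c))
      (states-join′ ℓ (kOf k₁ k₂ k₃ a) bit a r (fenceOf-nonEmpty P Q d cs))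
    where a = Seg.lbl (Crossing.τ c)

  states-one : ∀ ℓ P Q c {bit} → closerToRight P Q c ≡ bit → states ℓ (fenceOf k₁ k₂ k₃ P Q (c ∷ [])) ≃ᵛ
    act (groupMatrix (kOf k₁ k₂ k₃ (Seg.lbl (Crossing.τ c))) bit (Seg.lbl (Crossing.τ c))) (endVector ℓ)
  states-one ℓ P Q c {bit} refl =
    subst (λ F → states ℓ F ≃ᵛ act (groupMatrix (kOf k₁ k₂ k₃ a) bit a) (endVector ℓ)) (sym (group≡ P Q c))
      (states-group ℓ (kOf k₁ k₂ k₃ a) bit a)
    where a = Seg.lbl (Crossing.τ c)

  module Trail (p q : ℕ) (prim : Primitive (suc p) (suc q)) where

    open Crossings p q prim
    open Bits p q prim

    private
      ≟-false : ∀ {x y} → x ≢ y → ⌊ + x ℤ.≟ + y ⌋ ≡ false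
      ≟-false {x} {y} x≢y = trans (isYes≗does (+ x ℤ.≟ + y)) (dec-false (+ x ℤ.≟ + y) (λ eq → x≢y (ℤP.+-injective eq)))
      ≟-true : ∀ {x y} → x ≡ y → ⌊ + x ℤ.≟ + y ⌋ ≡ true
      ≟-true {x} {y} x≡y = trans (isYes≗does (+ x ℤ.≟ + y)) (dec-true (+ x ℤ.≟ + y) (cong +_ x≡y))
      n≢n+1 : ∀ n → n ≢ n ℕ.+ 1
      n≢n+1 n eq = ℕP.1+n≢n (trans (ℕP.+-comm 1 n) (sym eq))
      choose : ∀ {A : Set} {b c} {x y : A} → b ≡ c → (if b then x else y) ≡ (if c then x else y)
      choose refl = refl

      rightOf-+1ˣ : ∀ x y → rightOf P Q (+ (x ℕ.+ 1) , + y) ≡ rightOf P Q (+ suc x , + y)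
      rightOf-+1ˣ x y = cong (λ z → rightOf P Q (+ z , + y)) (ℕP.+-comm x 1)
      rightOf-+1ʸ : ∀ x y → rightOf P Q (+ x , + (y ℕ.+ 1)) ≡ rightOf P Q (+ x , + suc y)
      rightOf-+1ʸ x y = cong (λ z → rightOf P Q (+ x , + z)) (ℕP.+-comm y 1)

    shared-DV : ∀ f g → Q ℕ.* g ℕ.< P ℕ.* suc f → rightOf P Q (sharedEnd (segD f g) (segV f g)) ≡ true
    shared-DV f g below = trans (cong (rightOf P Q) (choose {x = Seg.A (segD f g)} {y = Seg.B (segD f g)}
      (cong₂ (λ a b → (a ∧ ⌊ + (g ℕ.+ 1) ℤ.≟ + g ⌋) ∨ (b ∧ ⌊ + (g ℕ.+ 1) ℤ.≟ + (g ℕ.+ 1) ⌋))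
        (≟-false {f} {suc f} (λ eq → ℕP.1+n≢n (sym eq))) (≟-false {f} {suc f} (λ eq → ℕP.1+n≢n (sym eq))))))
      (trans (rightOf-+1ˣ f g) (rightOf-true (suc f) g below))

    shared-DH : ∀ f g → P ℕ.* f ℕ.< Q ℕ.* suc g → rightOf P Q (sharedEnd (segD f g) (segH f g)) ≡ false
    shared-DH f g above = trans (cong (rightOf P Q) (choose {x = Seg.A (segD f g)} {y = Seg.B (segD f g)}
      (cong₂ (λ a b → (a ∧ b) ∨ (segD f g .Seg.A ==ᵖ segH f g .Seg.B)) (≟-true {f} {f} refl) (≟-true {g ℕ.+ 1} {suc g} (ℕP.+-comm g 1)))))
      (trans (rightOf-+1ʸ f g) (rightOf-false f (suc g) above))

    shared-VD : ∀ f g → P ℕ.* suc f ℕ.< Q ℕ.* suc g → rightOf P Q (sharedEnd (segV f g) (segD (suc f) g)) ≡ false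
    shared-VD f g above = trans (cong (rightOf P Q) (choose {x = Seg.A (segV f g)} {y = Seg.B (segV f g)}
      (cong₂ _∨_ (trans (cong (⌊ + suc f ℤ.≟ + suc f ⌋ ∧_) (≟-false {g} {g ℕ.+ 1} (n≢n+1 g))) (BoolP.∧-zeroʳ ⌊ + suc f ℤ.≟ + suc f ⌋))
        (cong (_∧ ⌊ + g ℤ.≟ + g ⌋) (≟-false {suc f} {suc f ℕ.+ 1} (n≢n+1 (suc f)))))))
      (trans (rightOf-+1ʸ (suc f) g) (rightOf-false (suc f) (suc g) above))

    shared-HD : ∀ f g → Q ℕ.* suc g ℕ.< P ℕ.* suc f → rightOf P Q (sharedEnd (segH f g) (segD f (suc g))) ≡ true
    shared-HD f g below = trans (cong (rightOf P Q) (choose {x = Seg.A (segH f g)} {y = Seg.B (segH f g)}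
      (cong₂ _∨_ (trans (cong (⌊ + f ℤ.≟ + f ⌋ ∧_) (≟-false {suc g} {suc g ℕ.+ 1} (n≢n+1 (suc g)))) (BoolP.∧-zeroʳ ⌊ + f ℤ.≟ + f ⌋))
        (cong (_∧ ⌊ + suc g ℤ.≟ + suc g ⌋) (≟-false {f} {f ℕ.+ 1} (n≢n+1 f))))))
      (trans (rightOf-+1ˣ f (suc g)) (rightOf-true (suc f) (suc g) below))

    private
      fenceAt : List Crossing → Fence
      fenceAt = fenceOf k₁ k₂ k₃ P Q

    states-∷-trail : ∀ ℓ c m S {bit r} → closerToRight P Q c ≡ bit →
      rightOf P Q (sharedEnd (Crossing.τ c) (Crossing.τ (diagonalAt S))) ≡ r →
      states ℓ (fenceAt (c ∷ trail m S)) ≃ᵛ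
        act (groupMatrix (kOf k₁ k₂ k₃ (Seg.lbl (Crossing.τ c))) bit (Seg.lbl (Crossing.τ c))) (act (J r) (states ℓ (fenceAt (trail m S))))
    states-∷-trail ℓ c zero S hb hr = states-∷∷ ℓ P Q c (diagonalAt S) [] hb hr
    states-∷-trail ℓ c (suc m) S hb hr = states-∷∷ ℓ P Q c (diagonalAt S) (exit S ∷ trail m (next σ S)) hb hr

    act-step : ∀ A B C D E v → act A (act B (act C (act D (act E v)))) ≃ᵛ act (A · ((B · (C · D)) · E)) v
    act-step A B C D E v = ≃ᵛ-sym (≃ᵛ-trans (act-· A ((B · (C · D)) · E) v) (act-cong A
      (≃ᵛ-trans (act-· (B · (C · D)) E v) (≃ᵛ-trans (act-· B (C · D) (act E v)) (act-cong B (act-· C D (act E v)))))))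

    -- Geometry and transfer matrices meet here, square by square: `closer-D`, `closer-V` and
    -- `closer-H` give the bit of each group, while `shared-DV`, `shared-VD`, `shared-DH` and
    -- `shared-HD` decide between U and L from one group to the next.
    states-trail : ∀ ℓ m S → m ℕ.+ height S ℕ.+ 2 ℕ.≤ P ℕ.+ Q → Crosses P Q S →
      states ℓ (fenceAt (trail m S)) ≃ᵛ act (T.Ω σ m S) (endVector ℓ)
    states-trail ℓ zero (f , g) room (above , _) = states-one ℓ P Q (crossD f g) (closer-D f g above)
    states-trail ℓ (suc m) (f , g) room (above , below) = byCorner (Sep.corner f g (square m f g room))
      where
      K : Bool → Set
      K b = states ℓ (fenceAt (crossD f g ∷ (if b then crossV f g else crossH f g) ∷ trail m (if b then (suc f , g) else (f , suc g)))) ≃ᵛ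
            act (T.GD (σ (odd f) (odd g)) · (T.stepOf b (σ (even f) (odd g)) (σ (odd f) (even g)) · T.Ω σ m (if b then (suc f , g) else (f , suc g)))) (endVector ℓ)
      byCorner : _ → K (σ (even f) (even g))
      byCorner (inj₁ (eq , lt)) = subst K (sym eq) (≃ᵛ-trans
        (states-∷∷ ℓ P Q (crossD f g) (crossV f g) (trail m (suc f , g)) (closer-D f g above) (shared-DV f g below))
        (≃ᵛ-trans (act-cong (T.GD (σ (odd f) (odd g))) (act-cong U
          (≃ᵛ-trans (states-∷-trail ℓ (crossV f g) m (suc f , g) (closer-V f g below) (shared-VD f g lt))
            (act-cong (T.GV (σ (even f) (odd g))) (act-cong L (states-trail ℓ m (suc f , g) room′ crosses′))))))
          (act-step (T.GD (σ (odd f) (odd g))) U (T.GV (σ (even f) (odd g))) L (T.Ω σ m (suc f , g)) (endVector ℓ))))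
        where
        crosses′ : Crosses P Q (suc f , g)
        crosses′ = lt , ℕP.<-≤-trans below (scale≤ P (ℕP.n≤1+n (suc f)))
        room′ : m ℕ.+ (suc f ℕ.+ g) ℕ.+ 2 ℕ.≤ P ℕ.+ Q
        room′ = subst (λ z → z ℕ.+ 2 ℕ.≤ P ℕ.+ Q) (sym (ℕP.+-suc m (f ℕ.+ g))) room
      byCorner (inj₂ (eq , gt)) = subst K (sym eq) (≃ᵛ-trans
        (states-∷∷ ℓ P Q (crossD f g) (crossH f g) (trail m (f , suc g)) (closer-D f g above) (shared-DH f g above))
        (≃ᵛ-trans (act-cong (T.GD (σ (odd f) (odd g))) (act-cong L
          (≃ᵛ-trans (states-∷-trail ℓ (crossH f g) m (f , suc g) (closer-H f g above) (shared-HD f g gt))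
            (act-cong (T.GH (σ (odd f) (even g))) (act-cong U (states-trail ℓ m (f , suc g) room′ crosses′))))))
          (act-step (T.GD (σ (odd f) (odd g))) L (T.GH (σ (odd f) (even g))) U (T.Ω σ m (f , suc g)) (endVector ℓ))))
        where
        crosses′ : Crosses P Q (f , suc g)
        crosses′ = ℕP.<-≤-trans above (scale≤ Q (ℕP.n≤1+n (suc g))) , gt
        room′ : m ℕ.+ (f ℕ.+ suc g) ℕ.+ 2 ℕ.≤ P ℕ.+ Q
        room′ = subst (λ z → z ℕ.+ 2 ℕ.≤ P ℕ.+ Q) (trans (sym (ℕP.+-suc m (f ℕ.+ g))) (cong (m ℕ.+_) (sym (ℕP.+-suc f g)))) room

    states-𝒫 : ∀ ℓ → states ℓ (𝒫 k₁ k₂ k₃ P Q) ≃ᵛ act (T.Ωof P Q) (endVector ℓ)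
    states-𝒫 ℓ = subst (λ cs → states ℓ (fenceAt cs) ≃ᵛ act (T.Ωof P Q) (endVector ℓ)) (sym crossings≡trail)
      (states-trail ℓ (p ℕ.+ q) (0 , 0) (ℕP.≤-reflexive (walk-size p q)) (crosses-first p q))

    𝒫-nonEmpty : NonEmpty (𝒫 k₁ k₂ k₃ P Q)
    𝒫-nonEmpty = subst (λ cs → NonEmpty (fenceAt cs)) (sym crossings≡trail) (trail-nonEmpty (p ℕ.+ q))
      where
      trail-nonEmpty : ∀ m → NonEmpty (fenceAt (trail m (0 , 0)))
      trail-nonEmpty zero = fenceOf-nonEmpty P Q (diagonalAt (0 , 0)) []
      trail-nonEmpty (suc m) = fenceOf-nonEmpty P Q (diagonalAt (0 , 0)) (exit (0 , 0) ∷ trail m (next σ (0 , 0)))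

-- M_{p/q} as a product of transfer matrices

module _ (k₁ k₂ k₃ : ℕ) where

  open T k₁ k₂ k₃ using (Ωof; N; u; Ω₀₁; Ω₁₀)

  -- The exponent of m is g - g°, which is the same for all p/q; m′ is the inverse of m.
  m m′ : LP
  m  = 𝐱^ (-[1+ 0 ] , + 1 , + 1)
  m′ = 𝐱^ (+ 1 , -[1+ 0 ] , -[1+ 0 ])

  module F = T.FromΩ k₁ k₂ k₃ m m′ ≋-refl
  open F using (fromΩ)

  scale : ℕ → ℕ → LP
  scale p q = 𝐱^ (𝐠° k₁ k₂ k₃ p q)

  Represented : ℕ → ℕ → Set
  Represented p q = M k₁ k₂ k₃ p q ≃ᴹ fromΩ (scale p q) (Ωof p q)

  -- The exponent g° is linear in (p , q) whereas g is not. This is why g° serves as the scale and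
  -- the constant difference is left to the conjugation by m.
  scale-+ : ∀ p q r s → scale (p ℕ.+ r) (q ℕ.+ s) ≋ scale p q ⊗ scale r s
  scale-+ p q r s = term-cong refl (exp≡
    (solve 4 (λ p q r s → (q :+ s) :- (p :+ r) := (q :- p) :+ (s :- r)) refl (+ p) (+ q) (+ r) (+ s))
    (solve 2 (λ q s → :- (q :+ s) := (:- q) :+ (:- s)) refl (+ q) (+ s)) refl)
    where open ℤSolver

  represented₀₁ : Represented 0 1
  represented₀₁ = ≃ᴹ-sym (≃ᴹ-trans (F.fromΩ-Ω₀₁ (scale 0 1) ≋-refl) ≃ᴹ-refl)

  represented₁₀ : Represented 1 0
  represented₁₀ = ≃ᴹ-sym (≃ᴹ-trans F.fromΩ-Ω₁₀ (entries ≋-refl ≋-refl ≋-refl (term-0 0ᵉ)))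

  represented : ∀ p q → Primitive (suc p) (suc q) → Represented (suc p) (suc q)
  represented p q prim = ≃ᴹ-trans (byStates 𝒫-nonEmpty)
    (F.fromΩ-entries {s} {b} {c} {proj₁ (states free F)} {proj₂ (states free F)} {proj₁ (states excluded F)} {proj₂ (states excluded F)}
      (Ωof (suc p) (suc q)) 𝐠≡ 2𝐠°-𝐠≡ (states-𝒫 free)
      (≃ᵛ-trans (states-𝒫 excluded) (act-cong (Ωof (suc p) (suc q)) (both ≋-refl (≋-sym (term-0 0ᵉ))))))
    where
    open Trail k₁ k₂ k₃ p q prim
    open ℤSolver
    F = 𝒫 k₁ k₂ k₃ (suc p) (suc q)
    P = + suc p
    Q = + suc q
    s = scale (suc p) (suc q)
    b = 𝐱^ (𝐠 k₁ k₂ k₃ (suc p) (suc q))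
    c = 𝐱^ ((𝐠° k₁ k₂ k₃ (suc p) (suc q) +ᵉ 𝐠° k₁ k₂ k₃ (suc p) (suc q)) -ᵉ 𝐠 k₁ k₂ k₃ (suc p) (suc q))
    𝐠≡ : b ≋ m ⊗ s
    𝐠≡ = term-cong refl (exp≡
      (solve 2 (λ P Q → Q :- P :- con (+ 1) := con -[1+ 0 ] :+ (Q :- P)) refl P Q)
      (solve 1 (λ Q → con (+ 1) :- Q := con (+ 1) :+ (:- Q)) refl Q)
      (solve 1 (λ P → P :+ con (+ 1) := con (+ 1) :+ P) refl P))
    2𝐠°-𝐠≡ : c ≋ m′ ⊗ s
    2𝐠°-𝐠≡ = term-cong refl (exp≡
      (solve 2 (λ P Q → ((Q :- P) :+ (Q :- P)) :- (Q :- P :- con (+ 1)) := con (+ 1) :+ (Q :- P)) refl P Q)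
      (solve 1 (λ Q → ((:- Q) :+ (:- Q)) :- (con (+ 1) :- Q) := con -[1+ 0 ] :+ (:- Q)) refl Q)
      (solve 1 (λ P → (P :+ P) :- (P :+ con (+ 1)) := con -[1+ 0 ] :+ P) refl P))
    byStates : ∀ {F} → NonEmpty F →
      (s ⊗ 𝒲¬L F , b ⊗ 𝒲 F , ⊝ (c ⊗ 𝒲¬L¬R F) , ⊝ (s ⊗ 𝒲¬R F)) ≃ᴹ
      (s ⊗ proj₁ (states free F) , b ⊗ (proj₁ (states free F) ⊕ proj₂ (states free F)) ,
       ⊝ (c ⊗ proj₁ (states excluded F)) , ⊝ (s ⊗ (proj₁ (states excluded F) ⊕ proj₂ (states excluded F))))
    byStates (nonEmpty {w} {ws} {rs}) = entries (⊗-congʳ s (𝒲¬L-states w ws rs)) (⊗-congʳ b (𝒲-states w ws rs))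
      (⊝-cong (⊗-congʳ c (𝒲¬L¬R-states w ws rs))) (⊝-cong (⊗-congʳ s (𝒲¬R-states w ws rs)))

  represented-T : T k₁ k₂ k₃ ≃ᴹ LM.conj m m′ (LM.T-of N)
  represented-T = ≃ᴹ-sym (≃ᴹ-trans F.conj-T (entries ≋-refl (term-0 0ᵉ) (≋-sym 𝓜≋) ≋-refl))
    where
    coefficient : ∀ k e → term k e ≋ cst k ⊗ 𝐱^ e
    coefficient k e = term-cong (sym (ℚP.*-identityʳ k)) (sym (+ᵉ-identityˡ e))
    𝓜≋ : 𝓜 k₁ k₂ k₃ ≋ m′ ⊕ 𝐱^ (-[1+ 0 ] , + 1 , -[1+ 0 ]) ⊕ 𝐱^ (-[1+ 0 ] , -[1+ 0 ] , + 1)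
      ⊕ cst (ℕ→ℚ k₁) ⊗ 𝐱^ (-[1+ 0 ] , + 0 , + 0) ⊕ cst (ℕ→ℚ k₂) ⊗ 𝐱^ (+ 0 , -[1+ 0 ] , + 0)
      ⊕ cst (ℕ→ℚ k₃) ⊗ 𝐱^ (+ 0 , + 0 , -[1+ 0 ])
    𝓜≋ = ⊕-cong (⊕-cong (⊕-cong (≋-refl {m′ ⊕ 𝐱^ (-[1+ 0 ] , + 1 , -[1+ 0 ]) ⊕ 𝐱^ (-[1+ 0 ] , -[1+ 0 ] , + 1)}) (coefficient (ℕ→ℚ k₁) (-[1+ 0 ] , + 0 , + 0)))
      (coefficient (ℕ→ℚ k₂) (+ 0 , -[1+ 0 ] , + 0))) (coefficient (ℕ→ℚ k₃) (+ 0 , + 0 , -[1+ 0 ]))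

  M-concat : ∀ p q r s → r ℕ.* q ≡ 1 ℕ.+ p ℕ.* s → Represented p q → Represented r s → Represented (p ℕ.+ r) (q ℕ.+ s) →
    M k₁ k₂ k₃ (p ℕ.+ r) (q ℕ.+ s) ≃ᴹ adj (M k₁ k₂ k₃ p q) · (T k₁ k₂ k₃ · adj (M k₁ k₂ k₃ r s))
  M-concat p q r s bez hp hr hs = ≃ᴹ-trans hs (≃ᴹ-trans
    (F.fromΩ-concat {scale p q} {scale r s} {scale (p ℕ.+ r) (q ℕ.+ s)} p q r s bez (scale-+ p q r s))
    (·-cong {adj X} {adj (M k₁ k₂ k₃ p q)} {LM.conj m m′ (LM.T-of N) · adj Y} {T k₁ k₂ k₃ · adj (M k₁ k₂ k₃ r s)}
      (adj-cong {X} {M k₁ k₂ k₃ p q} (≃ᴹ-sym hp))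
      (·-cong {LM.conj m m′ (LM.T-of N)} {T k₁ k₂ k₃} {adj Y} {adj (M k₁ k₂ k₃ r s)}
        (≃ᴹ-sym represented-T) (adj-cong {Y} {M k₁ k₂ k₃ r s} (≃ᴹ-sym hr)))))
    where
    X = fromΩ (scale p q) (Ωof p q)
    Y = fromΩ (scale r s) (Ωof r s)

  -- The Bezout relation makes each neighbour primitive unless it is 0/1 or 1/0, and those two have
  -- explicit matrices.
  farey-represented : ∀ p q r s → r ℕ.* q ≡ 1 ℕ.+ p ℕ.* s → Represented p q × Represented r s
  farey-represented p q zero s ()
  farey-represented p zero (suc r) s bez = contradiction (trans (sym (ℕP.*-zeroʳ r)) bez) λ ()
  farey-represented p (suc q) (suc r) s bez = first p s bez , second p s bez
    where
    first : ∀ p s → suc r ℕ.* suc q ≡ 1 ℕ.+ p ℕ.* s → Represented p (suc q)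
    first zero s bez = subst (Represented 0) (sym (ℕP.m*n≡1⇒n≡1 (suc r) (suc q) bez)) represented₀₁
    first (suc p) s bez = represented p q (bezout⇒primitive {suc p} {suc q} (suc r) s (inj₁ bez))
    second : ∀ p s → suc r ℕ.* suc q ≡ 1 ℕ.+ p ℕ.* s → Represented (suc r) s
    second p zero bez = subst (λ r → Represented r 0) (sym (ℕP.m*n≡1⇒m≡1 (suc r) (suc q) (trans bez (cong suc (ℕP.*-zeroʳ p))))) represented₁₀
    second p (suc s) bez = represented r s (bezout⇒primitive {suc r} {suc s} p (suc q) (inj₂ bez))

-- Leading monomials

infix 4 _<ᵉ_
_<ᵉ_ : Exp → Exp → Set
(a , b , c) <ᵉ (a′ , b′ , c′) = a ℤ.< a′ ⊎ (a ≡ a′ × (b ℤ.< b′ ⊎ (b ≡ b′ × c ℤ.< c′)))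

<ᵉ-trans : ∀ {e f g} → e <ᵉ f → f <ᵉ g → e <ᵉ g
<ᵉ-trans (inj₁ x) (inj₁ y) = inj₁ (ℤP.<-trans x y)
<ᵉ-trans (inj₁ x) (inj₂ (refl , _)) = inj₁ x
<ᵉ-trans (inj₂ (refl , _)) (inj₁ y) = inj₁ y
<ᵉ-trans (inj₂ (refl , inj₁ x)) (inj₂ (refl , inj₁ y)) = inj₂ (refl , inj₁ (ℤP.<-trans x y))
<ᵉ-trans (inj₂ (refl , inj₁ x)) (inj₂ (refl , inj₂ (refl , _))) = inj₂ (refl , inj₁ x)
<ᵉ-trans (inj₂ (refl , inj₂ (refl , _))) (inj₂ (refl , inj₁ y)) = inj₂ (refl , inj₁ y)
<ᵉ-trans (inj₂ (refl , inj₂ (refl , x))) (inj₂ (refl , inj₂ (refl , y))) = inj₂ (refl , inj₂ (refl , ℤP.<-trans x y))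

<ᵉ-irrefl : ∀ {e} → ¬ (e <ᵉ e)
<ᵉ-irrefl (inj₁ x) = ℤP.<-irrefl refl x
<ᵉ-irrefl (inj₂ (_ , inj₁ x)) = ℤP.<-irrefl refl x
<ᵉ-irrefl (inj₂ (_ , inj₂ (_ , x))) = ℤP.<-irrefl refl x

<ᵉ-cmp : ∀ e f → e <ᵉ f ⊎ e ≡ f ⊎ f <ᵉ e
<ᵉ-cmp (a , b , c) (a′ , b′ , c′) with ℤP.<-cmp a a′
... | tri< x _ _ = inj₁ (inj₁ x)
... | tri> _ _ x = inj₂ (inj₂ (inj₁ x))
... | tri≈ _ refl _ with ℤP.<-cmp b b′
...   | tri< x _ _ = inj₁ (inj₂ (refl , inj₁ x))
...   | tri> _ _ x = inj₂ (inj₂ (inj₂ (refl , inj₁ x)))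
...   | tri≈ _ refl _ with ℤP.<-cmp c c′
...     | tri< x _ _ = inj₁ (inj₂ (refl , inj₂ (refl , x)))
...     | tri≈ _ refl _ = inj₂ (inj₁ refl)
...     | tri> _ _ x = inj₂ (inj₂ (inj₂ (refl , inj₂ (refl , x))))

<ᵉ-monoʳ : ∀ g {e f} → e <ᵉ f → g +ᵉ e <ᵉ g +ᵉ f
<ᵉ-monoʳ (a , _ , _) (inj₁ x) = inj₁ (ℤP.+-monoʳ-< a x)
<ᵉ-monoʳ (a , b , _) (inj₂ (refl , inj₁ x)) = inj₂ (refl , inj₁ (ℤP.+-monoʳ-< b x))
<ᵉ-monoʳ (a , b , c) (inj₂ (refl , inj₂ (refl , x))) = inj₂ (refl , inj₂ (refl , ℤP.+-monoʳ-< c x))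

<ᵉ-monoˡ : ∀ g {e f} → e <ᵉ f → e +ᵉ g <ᵉ f +ᵉ g
<ᵉ-monoˡ g {e} {f} lt = subst₂ _<ᵉ_ (+ᵉ-comm g e) (+ᵉ-comm g f) (<ᵉ-monoʳ g lt)

<ᵉ-cancelˡ : ∀ g {e f} → g +ᵉ e <ᵉ g +ᵉ f → e <ᵉ f
<ᵉ-cancelˡ g {e} {f} lt with <ᵉ-cmp e f
... | inj₁ x = x
... | inj₂ (inj₁ refl) = contradiction lt <ᵉ-irrefl
... | inj₂ (inj₂ x) = contradiction (<ᵉ-trans lt (<ᵉ-monoʳ g x)) <ᵉ-irrefl

_<ᵉ?_ : ∀ e f → Dec (e <ᵉ f)
e <ᵉ? f with <ᵉ-cmp e f
... | inj₁ x = yes x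
... | inj₂ (inj₁ refl) = no <ᵉ-irrefl
... | inj₂ (inj₂ x) = no λ y → <ᵉ-irrefl (<ᵉ-trans x y)

-- c is the coefficient of x^e (possibly zero) and no larger monomial occurs.
record Top (p : LP) (c : ℚ) (e : Exp) : Set where
  constructor top
  field
    at-top : coeff p e ≡ c
    above  : ∀ {f} → e <ᵉ f → coeff p f ≡ 0ℚ
open Top

Top-≋ : ∀ {p q c e} → p ≋ q → Top p c e → Top q c e
Top-≋ (≈⇒≋ eq) (top h h′) = top (trans (sym (eq _)) h) (λ lt → trans (sym (eq _)) (h′ lt))

Top-raise : ∀ {p c e f} → e <ᵉ f → Top p c e → Top p 0ℚ f
Top-raise lt (top h h′) = top (h′ lt) (λ lt′ → h′ (<ᵉ-trans lt lt′))

Top-⊕ : ∀ {p q c d e} → Top p c e → Top q d e → Top (p ⊕ q) (c ℚ.+ d) e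
Top-⊕ {p} {q} {e = e} (top h h′) (top k k′) = top (trans (coeff-++ p q e) (cong₂ ℚ._+_ h k))
  (λ {f} lt → trans (coeff-++ p q f) (cong₂ ℚ._+_ (h′ lt) (k′ lt)))

coeff-hit : ∀ c e p → coeff ((c , e) ∷ p) e ≡ c ℚ.+ coeff p e
coeff-hit c e p = cong (λ b → if b then c ℚ.+ coeff p e else coeff p e) (dec-true (e ≟ᵉ e) refl)

coeff-miss : ∀ c e f p → e ≢ f → coeff ((c , e) ∷ p) f ≡ coeff p f
coeff-miss c e f p e≢f = cong (λ b → if b then c ℚ.+ coeff p f else coeff p f) (dec-false (e ≟ᵉ f) e≢f)

Top-term : ∀ c e → Top (term c e) c e
Top-term c e = top (trans (coeff-hit c e []) (ℚP.+-identityʳ c)) (λ {f} lt → coeff-miss c e f [] λ { refl → <ᵉ-irrefl lt })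

lower : Exp → LP → LP
lower e [] = []
lower e ((c , f) ∷ p) with f <ᵉ? e
... | yes _ = (c , f) ∷ lower e p
... | no _ = lower e p

coeff-lower : ∀ e p {f} → f <ᵉ e → coeff (lower e p) f ≡ coeff p f
coeff-lower e [] lt = refl
coeff-lower e ((c , g) ∷ p) {f} lt with g <ᵉ? e
... | no ≮ = trans (coeff-lower e p lt) (sym (coeff-miss c g f p λ { refl → ≮ lt }))
... | yes _ with does (g ≟ᵉ f)
...   | true = cong (c ℚ.+_) (coeff-lower e p lt)
...   | false = coeff-lower e p lt

coeff-lower-≥ : ∀ e p {f} → ¬ (f <ᵉ e) → coeff (lower e p) f ≡ 0ℚ
coeff-lower-≥ e [] ≮ = refl
coeff-lower-≥ e ((c , g) ∷ p) {f} ≮ with g <ᵉ? e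
... | no _ = coeff-lower-≥ e p ≮
... | yes lt = trans (coeff-miss c g f (lower e p) λ { refl → ≮ lt }) (coeff-lower-≥ e p ≮)

split-top : ∀ {p c e} → Top p c e → p ≋ term c e ⊕ lower e p
split-top {p} {c} {e} (top h h′) = ≈⇒≋ λ f → go f (<ᵉ-cmp f e)
  where
  go : ∀ f → f <ᵉ e ⊎ f ≡ e ⊎ e <ᵉ f → coeff p f ≡ coeff (term c e ⊕ lower e p) f
  go f (inj₁ lt) = sym (trans (coeff-miss c e f (lower e p) λ { refl → <ᵉ-irrefl lt }) (coeff-lower e p lt))
  go f (inj₂ (inj₁ refl)) = trans h (sym (trans (coeff-hit c e (lower e p)) (trans (cong (c ℚ.+_) (coeff-lower-≥ e p <ᵉ-irrefl)) (ℚP.+-identityʳ c))))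
  go f (inj₂ (inj₂ gt)) = trans (h′ gt) (sym (trans (coeff-miss c e f (lower e p) λ { refl → <ᵉ-irrefl gt }) (coeff-lower-≥ e p λ lt → <ᵉ-irrefl (<ᵉ-trans gt lt))))

-- A term of exponent f < e contributes at n a multiple of the coefficient of q at n - f. As n is at
-- least e + g, the exponent n - f exceeds g, and q vanishes there.
lower-⊗ : ∀ e g p q n → (∀ {f} → g <ᵉ f → coeff q f ≡ 0ℚ) → ¬ (n <ᵉ e +ᵉ g) → coeff (lower e p ⊗ q) n ≡ 0ℚ
lower-⊗ e g [] q n h ≮ = refl
lower-⊗ e g ((c , f) ∷ p) q n h ≮ with f <ᵉ? e
... | no _ = lower-⊗ e g p q n h ≮
... | yes lt = trans (coeff-⊗-∷ c f (lower e p) q n) (cong₂ ℚ._+_ (trans (cong (c ℚ.*_) (h g<)) (ℚP.*-zeroʳ c)) (lower-⊗ e g p q n h ≮))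
  where
  f+g<n : f +ᵉ g <ᵉ n
  f+g<n with <ᵉ-cmp (e +ᵉ g) n
  ... | inj₁ x = <ᵉ-trans (<ᵉ-monoˡ g lt) x
  ... | inj₂ (inj₁ refl) = <ᵉ-monoˡ g lt
  ... | inj₂ (inj₂ x) = contradiction x ≮
  g< : g <ᵉ n -ᵉ f
  g< = <ᵉ-cancelˡ f (subst (f +ᵉ g <ᵉ_) (sym (e+[f-e]≡f f n)) f+g<n)

Top-⊗ : ∀ {p q c d e g} → Top p c e → Top q d g → Top (p ⊗ q) (c ℚ.* d) (e +ᵉ g)
Top-⊗ {p} {q} {c} {d} {e} {g} tp tq = Top-≋ (≋-sym (⊗-cong (split-top tp) (≋-refl {q})))
  (top (trans (formula (e +ᵉ g) <ᵉ-irrefl) (cong (c ℚ.*_) (trans (cong (coeff q) ([e+f]-e≡f e g)) (at-top tq))))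
       (λ {n} lt → trans (formula n (λ lt′ → <ᵉ-irrefl (<ᵉ-trans lt lt′)))
          (trans (cong (c ℚ.*_) (above tq (<ᵉ-cancelˡ e (subst (e +ᵉ g <ᵉ_) (sym (e+[f-e]≡f e n)) lt)))) (ℚP.*-zeroʳ c))))
  where
  formula : ∀ n → ¬ (n <ᵉ e +ᵉ g) → coeff ((term c e ⊕ lower e p) ⊗ q) n ≡ c ℚ.* coeff q (n -ᵉ e)
  formula n ≮ = trans (coeff-⊗-∷ c e (lower e p) q n)
    (trans (cong (c ℚ.* coeff q (n -ᵉ e) ℚ.+_) (lower-⊗ e g p q n (above tq) ≮)) (ℚP.+-identityʳ _))

Top-unique : ∀ {p c d e f} → c ≢ 0ℚ → d ≢ 0ℚ → Top p c e → Top p d f → e ≡ f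
Top-unique {e = e} {f} c≢0 d≢0 te tf with <ᵉ-cmp e f
... | inj₁ lt = contradiction (trans (sym (at-top tf)) (above te lt)) d≢0
... | inj₂ (inj₁ eq) = eq
... | inj₂ (inj₂ gt) = contradiction (trans (sym (at-top te)) (above tf gt)) c≢0

exponents : LP → List Exp
exponents = map proj₂

coeff-support : ∀ p {f} → coeff p f ≢ 0ℚ → f ∈ exponents p
coeff-support [] h = contradiction refl h
coeff-support ((c , e) ∷ p) {f} h = byCase (e ≟ᵉ f)
  where
  byCase : Dec (e ≡ f) → f ∈ exponents ((c , e) ∷ p)
  byCase (yes refl) = here refl
  byCase (no e≢f) = there (coeff-support p λ eq → h (trans (coeff-miss c e f p e≢f) eq))

-- Listed terms may cancel, so the maximum is sought among the listed exponents whose total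
-- coefficient is non-zero.
top-exists : ∀ p → p ≋ 𝟘 ⊎ ∃₂ λ c e → c ≢ 0ℚ × Top p c e
top-exists p = conclude (search (exponents p))
  where
  Search : List Exp → Set
  Search es = (∀ {f} → f ∈ es → coeff p f ≡ 0ℚ) ⊎
              ∃ λ e → coeff p e ≢ 0ℚ × (∀ {f} → f ∈ es → e <ᵉ f → coeff p f ≡ 0ℚ)
  search : ∀ es → Search es
  search [] = inj₁ λ ()
  search (e ∷ es) with coeff p e ℚP.≟ 0ℚ | search es
  ... | yes z | inj₁ none = inj₁ λ { (here refl) → z ; (there f∈) → none f∈ }
  ... | yes z | inj₂ (m , m≢0 , max) = inj₂ (m , m≢0 , λ { (here refl) _ → z ; (there f∈) lt → max f∈ lt })
  ... | no e≢0 | inj₁ none = inj₂ (e , e≢0 , λ { (here refl) lt → contradiction lt <ᵉ-irrefl ; (there f∈) _ → none f∈ })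
  ... | no e≢0 | inj₂ (m , m≢0 , max) with <ᵉ-cmp e m
  ...   | inj₁ e<m = inj₂ (m , m≢0 , λ { (here refl) lt → contradiction (<ᵉ-trans e<m lt) <ᵉ-irrefl ; (there f∈) lt → max f∈ lt })
  ...   | inj₂ (inj₁ refl) = inj₂ (m , m≢0 , λ { (here refl) lt → contradiction lt <ᵉ-irrefl ; (there f∈) lt → max f∈ lt })
  ...   | inj₂ (inj₂ m<e) = inj₂ (e , e≢0 , λ { (here refl) lt → contradiction lt <ᵉ-irrefl ; (there f∈) lt → max f∈ (<ᵉ-trans m<e lt) })
  outside : ∀ {f} → (f ∈ exponents p → coeff p f ≡ 0ℚ) → coeff p f ≡ 0ℚ
  outside {f} h with coeff p f ℚP.≟ 0ℚ
  ... | yes z = z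
  ... | no nz = h (coeff-support p nz)
  conclude : Search (exponents p) → p ≋ 𝟘 ⊎ ∃₂ λ c e → c ≢ 0ℚ × Top p c e
  conclude (inj₁ none) = inj₁ (≈⇒≋ λ f → outside none)
  conclude (inj₂ (e , e≢0 , max)) = inj₂ (coeff p e , e , e≢0 , top refl (λ lt → outside λ f∈ → max f∈ lt))

record Leading (p : LP) (e : Exp) : Set where
  constructor leading
  field
    {coefficient} : ℚ
    positive : 0ℚ ℚ.< coefficient
    isTop    : Top p coefficient e

>0⇒≢0 : ∀ {c} → 0ℚ ℚ.< c → c ≢ 0ℚ
>0⇒≢0 lt eq = ℚP.<-irrefl (sym eq) lt

*-positive : ∀ {c d} → 0ℚ ℚ.< c → 0ℚ ℚ.< d → 0ℚ ℚ.< c ℚ.* d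
*-positive {c} {d} hc hd = subst (ℚ._< c ℚ.* d) (ℚP.*-zeroʳ c) (ℚP.*-monoʳ-<-pos c {{ℚ.positive hc}} hd)

*-positive⁻ : ∀ {c d} → 0ℚ ℚ.< c → 0ℚ ℚ.< c ℚ.* d → 0ℚ ℚ.< d
*-positive⁻ {c} {d} hc h = ℚP.≰⇒> λ d≤0 → ℚP.<-irrefl refl (ℚP.<-≤-trans h (subst (c ℚ.* d ℚ.≤_) (ℚP.*-zeroʳ c)
  (ℚP.*-monoˡ-≤-nonNeg c {{ℚP.pos⇒nonNeg c {{ℚ.positive hc}}}} d≤0)))

Leading-unique : ∀ {p e f} → Leading p e → Leading p f → e ≡ f
Leading-unique (leading h t) (leading h′ t′) = Top-unique (>0⇒≢0 h) (>0⇒≢0 h′) t t′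

Leading-≋ : ∀ {p q e} → p ≋ q → Leading p e → Leading q e
Leading-≋ eq (leading h t) = leading h (Top-≋ eq t)

*-nonzero : ∀ {c d} → 0ℚ ℚ.< c → d ≢ 0ℚ → c ℚ.* d ≢ 0ℚ
*-nonzero {c} {d} hc d≢0 eq with ℚP.<-cmp d 0ℚ
... | tri< d<0 _ _ = ℚP.<-irrefl (trans eq (sym (ℚP.*-zeroʳ c))) (ℚP.*-monoʳ-<-pos c {{ℚ.positive hc}} d<0)
... | tri≈ _ d≡0 _ = d≢0 d≡0
... | tri> _ _ d>0 = >0⇒≢0 (*-positive hc d>0) eq

-- A mutation is given by the equation a a′ = r alone, so nothing is known of a′ beforehand. It is
-- not zero because r is not; hence it has a leading term, and since leading terms multiply, its
-- exponent and sign are determined by those of a and r.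
Leading-quotient : ∀ {a a′ r e ρ} → a ⊗ a′ ≋ r → Leading a e → Leading r ρ → Leading a′ (ρ -ᵉ e)
Leading-quotient {a} {a′} {r} {e} {ρ} eq (leading {c} ha ta) (leading {c′} hr tr) with top-exists a′
... | inj₁ a′≋𝟘 = contradiction (trans (sym (at-top tr)) (≋⇒≈ (≋-trans (≋-sym eq) (≋-trans (⊗-congʳ a a′≋𝟘) (≡⇒≋ (⊗-zeroʳ a)))) ρ)) (>0⇒≢0 hr)
... | inj₂ (d , g , d≢0 , tg) = leading (*-positive⁻ ha cd>0) (subst (Top a′ d) g≡ tg)
  where
  tcd : Top r (c ℚ.* d) (e +ᵉ g)
  tcd = Top-≋ eq (Top-⊗ ta tg)
  e+g≡ρ : e +ᵉ g ≡ ρ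
  e+g≡ρ = Top-unique (*-nonzero ha d≢0) (>0⇒≢0 hr) tcd tr
  g≡ : g ≡ ρ -ᵉ e
  g≡ = trans (sym ([e+f]-e≡f e g)) (cong (_-ᵉ e) e+g≡ρ)
  cd>0 : 0ℚ ℚ.< c ℚ.* d
  cd>0 = subst (0ℚ ℚ.<_) (trans (sym (at-top tr)) (trans (cong (coeff r) (sym e+g≡ρ)) (at-top tcd))) hr

-- If β and γ differ, the square belonging to the larger one dominates. If they agree, all three
-- products have the same exponent; the squares have positive coefficients and the middle one is
-- non-negative because k is a natural number, so nothing cancels.
Leading-exchange : ∀ k {b c β γ} → Leading b β → Leading c γ →
  ∃ λ μ → Leading (b ⊗ b ⊕ cst (ℕ→ℚ k) ⊗ b ⊗ c ⊕ c ⊗ c) (μ +ᵉ μ)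
Leading-exchange k {b} {c} {β} {γ} (leading {x} hx tx) (leading {y} hy ty) = byOrder (<ᵉ-cmp β γ)
  where
  K = ℕ→ℚ k
  t₁ : Top (b ⊗ b) (x ℚ.* x) (β +ᵉ β)
  t₁ = Top-⊗ tx tx
  t₂ : Top (cst K ⊗ b ⊗ c) (K ℚ.* x ℚ.* y) (β +ᵉ γ)
  t₂ = subst (λ e → Top (cst K ⊗ b ⊗ c) (K ℚ.* x ℚ.* y) (e +ᵉ γ)) (+ᵉ-identityˡ β) (Top-⊗ (Top-⊗ (Top-term K 0ᵉ) tx) ty)
  t₃ : Top (c ⊗ c) (y ℚ.* y) (γ +ᵉ γ)
  t₃ = Top-⊗ ty ty
  middle≥0 : 0ℚ ℚ.≤ K ℚ.* x ℚ.* y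
  middle≥0 = subst (0ℚ ℚ.≤_) (sym (ℚP.*-assoc K x y)) (subst (ℚ._≤ K ℚ.* (x ℚ.* y)) (ℚP.*-zeroʳ K)
    (ℚP.*-monoˡ-≤-nonNeg K {{ℚ.nonNegative (ℕ→ℚ-mono-≤ {0} {k} z≤n)}} (ℚP.<⇒≤ (*-positive hx hy))))
  Goal : Set
  Goal = ∃ λ μ → Leading (b ⊗ b ⊕ cst K ⊗ b ⊗ c ⊕ c ⊗ c) (μ +ᵉ μ)
  byOrder : β <ᵉ γ ⊎ β ≡ γ ⊎ γ <ᵉ β → Goal
  byOrder (inj₁ lt) = γ , leading (subst (0ℚ ℚ.<_) (sym (ℚP.+-identityˡ (y ℚ.* y))) (*-positive hy hy))
    (Top-⊕ {b ⊗ b ⊕ cst K ⊗ b ⊗ c} {c ⊗ c} (Top-⊕ {b ⊗ b} {cst K ⊗ b ⊗ c} (Top-raise (<ᵉ-trans (<ᵉ-monoˡ β lt) (<ᵉ-monoʳ γ lt)) t₁) (Top-raise (<ᵉ-monoˡ γ lt) t₂)) t₃)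
  byOrder (inj₂ (inj₁ refl)) = β , leading (ℚP.+-mono-<-≤ (ℚP.+-mono-<-≤ (*-positive hx hx) middle≥0) (ℚP.<⇒≤ (*-positive hy hy)))
    (Top-⊕ {b ⊗ b ⊕ cst K ⊗ b ⊗ c} {c ⊗ c} (Top-⊕ {b ⊗ b} {cst K ⊗ b ⊗ c} t₁ t₂) t₃)
  byOrder (inj₂ (inj₂ gt)) = β , leading (ℚP.+-mono-<-≤ (ℚP.+-mono-<-≤ (*-positive hx hx) ℚP.≤-refl) ℚP.≤-refl)
    (Top-⊕ {b ⊗ b ⊕ cst K ⊗ b ⊗ c} {c ⊗ c} (Top-⊕ {b ⊗ b} {cst K ⊗ b ⊗ c} t₁ (Top-raise (<ᵉ-monoʳ β gt) t₂)) (Top-raise (<ᵉ-trans (<ᵉ-monoˡ γ gt) (<ᵉ-monoʳ β gt)) t₃))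

unitᵉ : Pos → Exp
unitᵉ ①' = (+ 1 , + 0 , + 0)
unitᵉ ②' = (+ 0 , + 1 , + 0)
unitᵉ ③' = (+ 0 , + 0 , + 1)

record Parity (i : Pos) (p : LP) : Set where
  constructor parity
  field
    half : Exp
    isLeading : Leading p (unitᵉ i +ᵉ (half +ᵉ half))

Parity-mutate : ∀ {k i a a′ b c j l} → Parity i a → Parity j b → Parity l c →
  a ⊗ a′ ≋ b ⊗ b ⊕ cst (ℕ→ℚ k) ⊗ b ⊗ c ⊕ c ⊗ c → Parity i a′
Parity-mutate {k} {i} {a} {a′} (parity δ la) (parity _ lb) (parity _ lc) eq =
  let μ , lr = Leading-exchange k lb lc
  -- With ε the unit vector at i, 2 μ - (ε + 2 δ) = ε + 2 (μ - ε - δ).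
  in parity ((μ -ᵉ unitᵉ i) -ᵉ δ) (subst (Leading a′) (reflect μ (unitᵉ i) δ) (Leading-quotient eq la lr))
  where
  reflect : ∀ μ ε δ → (μ +ᵉ μ) -ᵉ (ε +ᵉ (δ +ᵉ δ)) ≡ ε +ᵉ (((μ -ᵉ ε) -ᵉ δ) +ᵉ ((μ -ᵉ ε) -ᵉ δ))
  reflect (m₁ , m₂ , m₃) (e₁ , e₂ , e₃) (d₁ , d₂ , d₃) = exp≡ (lem m₁ e₁ d₁) (lem m₂ e₂ d₂) (lem m₃ e₃ d₃)
    where
    open ℤSolver
    lem : ∀ m e d → (m ℤ.+ m) ℤ.- (e ℤ.+ (d ℤ.+ d)) ≡ e ℤ.+ (((m ℤ.- e) ℤ.- d) ℤ.+ ((m ℤ.- e) ℤ.- d))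
    lem = solve 3 (λ m e d → (m :+ m) :- (e :+ (d :+ d)) := e :+ (((m :- e) :- d) :+ ((m :- e) :- d))) refl

1≢2z : ∀ z → z ℤ.+ z ≢ + 1
1≢2z (+ zero) ()
1≢2z (+ suc n) eq with trans (sym (ℕP.+-suc n n)) (ℕP.suc-injective (ℤP.+-injective eq))
... | ()
1≢2z -[1+ n ] ()

odd≢even : ∀ x y → + 1 ℤ.+ (x ℤ.+ x) ≢ + 0 ℤ.+ (y ℤ.+ y)
odd≢even x y eq = 1≢2z (y ℤ.- x) (begin
  (y ℤ.- x) ℤ.+ (y ℤ.- x)           ≡⟨ solve 2 (λ x y → (y :- x) :+ (y :- x) := (con (+ 0) :+ (y :+ y)) :- (x :+ x)) refl x y ⟩
  (+ 0 ℤ.+ (y ℤ.+ y)) ℤ.- (x ℤ.+ x) ≡⟨ cong (ℤ._- (x ℤ.+ x)) (sym eq) ⟩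
  (+ 1 ℤ.+ (x ℤ.+ x)) ℤ.- (x ℤ.+ x) ≡⟨ solve 1 (λ x → (con (+ 1) :+ (x :+ x)) :- (x :+ x) := con (+ 1)) refl x ⟩
  + 1 ∎)
  where
  open ≡-Reasoning
  open ℤSolver

Parity-unique : ∀ {i j p} → Parity i p → Parity j p → i ≡ j
Parity-unique {i} {j} (parity δ l) (parity δ′ l′) = sameClass i j δ δ′ (Leading-unique l l′)
  where
  sameClass : ∀ i j δ δ′ → unitᵉ i +ᵉ (δ +ᵉ δ) ≡ unitᵉ j +ᵉ (δ′ +ᵉ δ′) → i ≡ j
  sameClass ①' ①' δ δ′ eq = refl
  sameClass ②' ②' δ δ′ eq = refl
  sameClass ③' ③' δ δ′ eq = refl
  sameClass ①' ②' (x , _) (y , _) eq = contradiction (cong proj₁ eq) (odd≢even x y)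
  sameClass ①' ③' (x , _) (y , _) eq = contradiction (cong proj₁ eq) (odd≢even x y)
  sameClass ②' ①' (x , _) (y , _) eq = contradiction (sym (cong proj₁ eq)) (odd≢even y x)
  sameClass ③' ①' (x , _) (y , _) eq = contradiction (sym (cong proj₁ eq)) (odd≢even y x)
  sameClass ②' ③' (_ , x , _) (_ , y , _) eq = contradiction (cong (λ e → proj₁ (proj₂ e)) eq) (odd≢even x y)
  sameClass ③' ②' (_ , x , _) (_ , y , _) eq = contradiction (sym (cong (λ e → proj₁ (proj₂ e)) eq)) (odd≢even y x)

module _ (k₁ k₂ k₃ : ℕ) where

  cluster-parity : ∀ {a b c} → LabeledCluster k₁ k₂ k₃ (a , b , c) → Parity ①' a × Parity ②' b × Parity ③' c
  cluster-parity initial = variable-parity ①' , variable-parity ②' , variable-parity ③'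
    where
    1>0 : 0ℚ ℚ.< 1ℚ
    1>0 = ℚP.positive⁻¹ 1ℚ
    variable-parity : ∀ i → Parity i (𝐱^ (unitᵉ i))
    variable-parity ①' = parity 0ᵉ (leading 1>0 (Top-term 1ℚ (unitᵉ ①')))
    variable-parity ②' = parity 0ᵉ (leading 1>0 (Top-term 1ℚ (unitᵉ ②')))
    variable-parity ③' = parity 0ᵉ (leading 1>0 (Top-term 1ℚ (unitᵉ ③')))
  cluster-parity (μ₁ l eq) = let pa , pb , pc = cluster-parity l in Parity-mutate {k₁} pa pb pc (≈⇒≋ eq) , pb , pc
  cluster-parity (μ₂ l eq) = let pa , pb , pc = cluster-parity l in pa , Parity-mutate {k₂} pb pa pc (≈⇒≋ eq) , pc
  cluster-parity (μ₃ l eq) = let pa , pb , pc = cluster-parity l in pa , pb , Parity-mutate {k₃} pc pa pb (≈⇒≋ eq)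

  occurs-parity : ∀ {y} i → OccursAt k₁ k₂ k₃ y i → Parity i y
  occurs-parity {y} i ((a , b , c) , l , eq) = component-parity i (cluster-parity l) eq
    where
    transport : ∀ {i z} → y ≈ z → Parity i z → Parity i y
    transport eq (parity δ lz) = parity δ (Leading-≋ (≋-sym (≈⇒≋ eq)) lz)
    component-parity : ∀ i → Parity ①' a × Parity ②' b × Parity ③' c → y ≈ component i (a , b , c) → Parity i y
    component-parity ①' (pa , _ , _) eq = transport {①'} {a} eq pa
    component-parity ②' (_ , pb , _) eq = transport {②'} {b} eq pb
    component-parity ③' (_ , _ , pc) eq = transport {③'} {c} eq pc

  position-unique : ∀ {y i j} → OccursAt k₁ k₂ k₃ y i → OccursAt k₁ k₂ k₃ y j → i ≡ j
  position-unique {y} {i} {j} oi oj = Parity-unique (occurs-parity {y} i oi) (occurs-parity {y} j oj)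

-- CMM triples

IsInteger : ℚ × Exp → Set
IsInteger (c , _) = ∃ λ z → c ≡ ℤ→ℚ z

-- Stronger than IntegerLaurent: integrality of the listed coefficients is visibly stable under products.
record Integral (p : LP) : Set where
  constructor integral
  field
    {witness} : LP
    equal     : p ≋ witness
    integers  : All IsInteger witness

integral-≋ : ∀ {p q} → p ≋ q → Integral q → Integral p
integral-≋ eq (integral eq′ a) = integral (≋-trans eq eq′) a

integral-term : ∀ z e → Integral (term (ℤ→ℚ z) e)
integral-term z e = integral ≋-refl ((z , refl) All.∷ All.[])

integral-⊕ : ∀ {p q} → Integral p → Integral q → Integral (p ⊕ q)
integral-⊕ (integral eq a) (integral eq′ a′) = integral (⊕-cong eq eq′) (AllP.++⁺ a a′)

integral-⊝ : ∀ {p} → Integral p → Integral (⊝ p)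
integral-⊝ (integral eq a) = integral (⊝-cong eq) (AllP.map⁺ (All.map (λ {t} → negate {t}) a))
  where
  negate : ∀ {t} → IsInteger t → IsInteger (ℚ.- proj₁ t , proj₂ t)
  negate (z , refl) = ℤ.- z , neg z
    where
    neg : ∀ z → ℚ.- ℤ→ℚ z ≡ ℤ→ℚ (ℤ.- z)
    neg z = begin
      ℚ.- ℤ→ℚ z                                   ≡⟨ sym (ℚP.+-identityʳ (ℚ.- ℤ→ℚ z)) ⟩
      ℚ.- ℤ→ℚ z ℚ.+ 0ℚ                            ≡⟨ cong (λ x → ℚ.- ℤ→ℚ z ℚ.+ ℤ→ℚ x) (sym (ℤP.+-inverseʳ z)) ⟩
      ℚ.- ℤ→ℚ z ℚ.+ ℤ→ℚ (z ℤ.+ ℤ.- z)             ≡⟨ cong (ℚ.- ℤ→ℚ z ℚ.+_) (ℤ→ℚ-+ z (ℤ.- z)) ⟩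
      ℚ.- ℤ→ℚ z ℚ.+ (ℤ→ℚ z ℚ.+ ℤ→ℚ (ℤ.- z))       ≡⟨ solve 2 (λ a b → (:- a) :+ (a :+ b) := b) refl (ℤ→ℚ z) (ℤ→ℚ (ℤ.- z)) ⟩
      ℤ→ℚ (ℤ.- z) ∎
      where
      open ≡-Reasoning
      open ℚSolver

integral-⊗ : ∀ {p q} → Integral p → Integral q → Integral (p ⊗ q)
integral-⊗ {p} {q} (integral {p′} eq a) (integral {q′} eq′ a′) = integral (⊗-cong eq eq′) (product p′ a)
  where
  times : ∀ c e → IsInteger (c , e) → ∀ {t} → IsInteger t → IsInteger (c ℚ.* proj₁ t , e +ᵉ proj₂ t)
  times c e (y , refl) (z , refl) = y ℤ.* z , sym (ℤ→ℚ-* y z)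
  product : ∀ p′ → All IsInteger p′ → All IsInteger (p′ ⊗ q′)
  product [] All.[] = All.[]
  product ((c , e) ∷ p′) (i All.∷ a) = AllP.++⁺ (AllP.map⁺ (All.map (λ {t} → times c e i {t}) a′)) (product p′ a)

integral⇒IntegerLaurent : ∀ {p} → Integral p → IntegerLaurent p
integral⇒IntegerLaurent {p} (integral {p′} (≈⇒≋ eq) a) e = let z , h = coefficient p′ a in z , trans (eq e) h
  where
  coefficient : ∀ p′ → All IsInteger p′ → ∃ λ z → coeff p′ e ≡ ℤ→ℚ z
  coefficient [] All.[] = + 0 , refl
  coefficient ((c , f) ∷ p′) ((y , refl) All.∷ a) with does (f ≟ᵉ e) | coefficient p′ a
  ... | true  | z , h = y ℤ.+ z , trans (cong (ℤ→ℚ y ℚ.+_) h) (sym (ℤ→ℚ-+ y z))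
  ... | false | z , h = z , h

record IntegralMatrix (X : Matrix) : Set where
  constructor integralMatrix
  field
    int₁₁ : Integral (e₁₁ X)
    int₁₂ : Integral (e₁₂ X)
    int₂₁ : Integral (e₂₁ X)
    int₂₂ : Integral (e₂₂ X)

integral-· : ∀ {X Y} → IntegralMatrix X → IntegralMatrix Y → IntegralMatrix (X · Y)
integral-· (integralMatrix a b c d) (integralMatrix a′ b′ c′ d′) = integralMatrix
  (integral-⊕ (integral-⊗ a a′) (integral-⊗ b c′)) (integral-⊕ (integral-⊗ a b′) (integral-⊗ b d′))
  (integral-⊕ (integral-⊗ c a′) (integral-⊗ d c′)) (integral-⊕ (integral-⊗ c b′) (integral-⊗ d d′))

integral-adj : ∀ {X} → IntegralMatrix X → IntegralMatrix (adj X)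
integral-adj (integralMatrix a b c d) = integralMatrix d (integral-⊝ b) (integral-⊝ c) a

integral-≃ᴹ : ∀ {X Y} → X ≃ᴹ Y → IntegralMatrix Y → IntegralMatrix X
integral-≃ᴹ (entries p q r s) (integralMatrix a b c d) =
  integralMatrix (integral-≋ p a) (integral-≋ q b) (integral-≋ r c) (integral-≋ s d)

-- The constructors of `LabeledCluster` list the two unchanged entries by position, a vertex of the
-- tree lists them from left to right.
exchange-comm : ∀ k x y → x ⊗ x ⊕ k ⊗ x ⊗ y ⊕ y ⊗ y ≋ y ⊗ y ⊕ k ⊗ y ⊗ x ⊕ x ⊗ x
exchange-comm k x y = solve 3 (λ k x y → x :* x :+ k :* x :* y :+ y :* y := y :* y :+ k :* y :* x :+ x :* x) ≋-refl k x y
  where open LM.Solver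

module _ (k₁ k₂ k₃ : ℕ) where

  private
    kᵢ : Pos → LP
    kᵢ i = cst (kq k₁ k₂ k₃ i)
    Mat′ : ℕ → ℕ → Matrix
    Mat′ = M k₁ k₂ k₃

  -- A triple in the order of the tree together with the positions of its entries in a labeled
  -- cluster. Going down the tree reorders the entries, but each variable keeps its position.
  data Placed : Pos → Pos → Pos → LP → LP → LP → Set where
    at₁₂₃ : ∀ {x y z} → LabeledCluster k₁ k₂ k₃ (x , y , z) → Placed ①' ②' ③' x y z
    at₁₃₂ : ∀ {x y z} → LabeledCluster k₁ k₂ k₃ (x , z , y) → Placed ①' ③' ②' x y z
    at₂₁₃ : ∀ {x y z} → LabeledCluster k₁ k₂ k₃ (y , x , z) → Placed ②' ①' ③' x y z
    at₂₃₁ : ∀ {x y z} → LabeledCluster k₁ k₂ k₃ (z , x , y) → Placed ②' ③' ①' x y z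
    at₃₁₂ : ∀ {x y z} → LabeledCluster k₁ k₂ k₃ (y , z , x) → Placed ③' ①' ②' x y z
    at₃₂₁ : ∀ {x y z} → LabeledCluster k₁ k₂ k₃ (z , y , x) → Placed ③' ②' ①' x y z

  -- The new variable inherits the position l of z but stands in the middle, as in the left child.
  mutate-last : ∀ {i j l x y z z′} → Placed i j l x y z →
    z ⊗ z′ ≋ x ⊗ x ⊕ kᵢ l ⊗ x ⊗ y ⊕ y ⊗ y → Placed i l j x z′ y
  mutate-last {x = x} {y} (at₁₂₃ c) eq = at₁₃₂ (μ₃ c (≋⇒≈ eq))
  mutate-last {x = x} {y} (at₁₃₂ c) eq = at₁₂₃ (μ₂ c (≋⇒≈ eq))
  mutate-last {x = x} {y} (at₂₁₃ c) eq = at₂₃₁ (μ₃ c (≋⇒≈ (≋-trans eq (exchange-comm (kᵢ ③') x y))))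
  mutate-last {x = x} {y} (at₂₃₁ c) eq = at₂₁₃ (μ₁ c (≋⇒≈ eq))
  mutate-last {x = x} {y} (at₃₁₂ c) eq = at₃₂₁ (μ₂ c (≋⇒≈ (≋-trans eq (exchange-comm (kᵢ ②') x y))))
  mutate-last {x = x} {y} (at₃₂₁ c) eq = at₃₁₂ (μ₁ c (≋⇒≈ (≋-trans eq (exchange-comm (kᵢ ①') x y))))

  mutate-first : ∀ {i j l x y z x′} → Placed i j l x y z →
    x ⊗ x′ ≋ y ⊗ y ⊕ kᵢ i ⊗ y ⊗ z ⊕ z ⊗ z → Placed j i l y x′ z
  mutate-first {y = y} {z} (at₁₂₃ c) eq = at₂₁₃ (μ₁ c (≋⇒≈ eq))
  mutate-first {y = y} {z} (at₁₃₂ c) eq = at₃₁₂ (μ₁ c (≋⇒≈ (≋-trans eq (exchange-comm (kᵢ ①') y z))))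
  mutate-first {y = y} {z} (at₂₁₃ c) eq = at₁₂₃ (μ₂ c (≋⇒≈ eq))
  mutate-first {y = y} {z} (at₂₃₁ c) eq = at₃₂₁ (μ₂ c (≋⇒≈ (≋-trans eq (exchange-comm (kᵢ ②') y z))))
  mutate-first {y = y} {z} (at₃₁₂ c) eq = at₁₃₂ (μ₃ c (≋⇒≈ eq))
  mutate-first {y = y} {z} (at₃₂₁ c) eq = at₂₃₁ (μ₃ c (≋⇒≈ (≋-trans eq (exchange-comm (kᵢ ③') y z))))

  private
    ≈-refl : ∀ {p} → p ≈ p
    ≈-refl e = refl

  placed⇒nonLabeled : ∀ {i j l x y z} → Placed i j l x y z → NonLabeledCluster k₁ k₂ k₃ (x , y , z)
  placed⇒nonLabeled {x = x} {y} {z} (at₁₂₃ c) = _ , c , (x , y , z) , p123 , ≈-refl {x} , ≈-refl {y} , ≈-refl {z}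
  placed⇒nonLabeled {x = x} {y} {z} (at₁₃₂ c) = _ , c , (x , y , z) , p132 , ≈-refl {x} , ≈-refl {y} , ≈-refl {z}
  placed⇒nonLabeled {x = x} {y} {z} (at₂₁₃ c) = _ , c , (x , y , z) , p213 , ≈-refl {x} , ≈-refl {y} , ≈-refl {z}
  placed⇒nonLabeled {x = x} {y} {z} (at₂₃₁ c) = _ , c , (x , y , z) , p231 , ≈-refl {x} , ≈-refl {y} , ≈-refl {z}
  placed⇒nonLabeled {x = x} {y} {z} (at₃₁₂ c) = _ , c , (x , y , z) , p312 , ≈-refl {x} , ≈-refl {y} , ≈-refl {z}
  placed⇒nonLabeled {x = x} {y} {z} (at₃₂₁ c) = _ , c , (x , y , z) , p321 , ≈-refl {x} , ≈-refl {y} , ≈-refl {z}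

  placed⇒occurs : ∀ {i j l x y z} → Placed i j l x y z →
    OccursAt k₁ k₂ k₃ x i × OccursAt k₁ k₂ k₃ y j × OccursAt k₁ k₂ k₃ z l
  placed⇒occurs {x = x} {y} {z} (at₁₂₃ c) = (_ , c , ≈-refl {x}) , (_ , c , ≈-refl {y}) , (_ , c , ≈-refl {z})
  placed⇒occurs {x = x} {y} {z} (at₁₃₂ c) = (_ , c , ≈-refl {x}) , (_ , c , ≈-refl {y}) , (_ , c , ≈-refl {z})
  placed⇒occurs {x = x} {y} {z} (at₂₁₃ c) = (_ , c , ≈-refl {x}) , (_ , c , ≈-refl {y}) , (_ , c , ≈-refl {z})
  placed⇒occurs {x = x} {y} {z} (at₂₃₁ c) = (_ , c , ≈-refl {x}) , (_ , c , ≈-refl {y}) , (_ , c , ≈-refl {z})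
  placed⇒occurs {x = x} {y} {z} (at₃₁₂ c) = (_ , c , ≈-refl {x}) , (_ , c , ≈-refl {y}) , (_ , c , ≈-refl {z})
  placed⇒occurs {x = x} {y} {z} (at₃₂₁ c) = (_ , c , ≈-refl {x}) , (_ , c , ≈-refl {y}) , (_ , c , ≈-refl {z})

  record Unimodular (i : Pos) (X : Matrix) : Set where
    field
      det≋1     : LM.det X ≋ 𝟙
      trace≋-k  : trace X ≋ ⊝ kᵢ i
      integrals : IntegralMatrix X
  open Unimodular

  unimodular⇒CMM : ∀ {i X} → Unimodular i X → OccursAt k₁ k₂ k₃ (e₁₂ X) i → CMM k₁ k₂ k₃ X
  unimodular⇒CMM {i} {X@(a , b , c , d)} g occ =
    (integral⇒IntegerLaurent (int₁₁ (integrals g)) , integral⇒IntegerLaurent (int₁₂ (integrals g)) ,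
     integral⇒IntegerLaurent (int₂₁ (integrals g)) , integral⇒IntegerLaurent (int₂₂ (integrals g)) , ≋⇒≈ (det≋1 g)) ,
    (i , occ) ,
    -- `CMM` asks for the trace at every position in which the entry occurs; `position-unique`
    -- leaves only the known one.
    λ j occ′ → subst (λ j → tr X ≈ cst (ℚ.- kq k₁ k₂ k₃ j)) (position-unique k₁ k₂ k₃ {b} {i} {j} occ occ′) (≋⇒≈ (trace≋-k g))
    where open IntegralMatrix

  record Vertex (X Y Z : Matrix) : Set where
    field
      {i j l} : Pos
      first   : Unimodular i X
      middle  : Unimodular j Y
      last    : Unimodular l Z
      product : X · Y · Z ≃ᴹ T-of (𝓜 k₁ k₂ k₃)
      cluster : Placed i j l (ent₁₂ X) (ent₁₂ Y) (ent₁₂ Z)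
  open Vertex

  ≃ᴹ⇒≈ᴹ : ∀ {X Y} → X ≃ᴹ Y → X ≈ᴹ Y
  ≃ᴹ⇒≈ᴹ (entries p q r s) = ≋⇒≈ p , ≋⇒≈ q , ≋⇒≈ r , ≋⇒≈ s

  vertex⇒triple : ∀ {X Y Z} → Vertex X Y Z → CMMTriple k₁ k₂ k₃ X Y Z
  vertex⇒triple {X} {Y} {Z} V =
    let oX , oY , oZ = placed⇒occurs (cluster V) in
    unimodular⇒CMM (first V) oX , unimodular⇒CMM (middle V) oY , unimodular⇒CMM (last V) oZ ,
    ≃ᴹ⇒≈ᴹ (≃ᴹ-trans (product V) (entries ≋-refl (term-0 0ᵉ) ≋-refl ≋-refl)) , placed⇒nonLabeled (cluster V)

  private
    t : LP
    t = 𝓜 k₁ k₂ k₃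

    integral-T : IntegralMatrix (T-of t)
    integral-T = integralMatrix (integral-term (ℤ.- + 1) 0ᵉ) (integral-term (+ 0) 0ᵉ)
      (integral-⊕ (integral-⊕ (integral-⊕ (integral-⊕ (integral-⊕ (integral-term (+ 1) (+ 1 , -[1+ 0 ] , -[1+ 0 ])) (integral-term (+ 1) (-[1+ 0 ] , + 1 , -[1+ 0 ])))
        (integral-term (+ 1) (-[1+ 0 ] , -[1+ 0 ] , + 1))) (integral-term (+ k₁) (-[1+ 0 ] , + 0 , + 0)))
        (integral-term (+ k₂) (+ 0 , -[1+ 0 ] , + 0))) (integral-term (+ k₃) (+ 0 , + 0 , -[1+ 0 ])))
      (integral-term (ℤ.- + 1) 0ᵉ)

    -- The weights of a fence contain fractions 1/k, but the product formula only adds, multiplies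
    -- and negates entries that are already integral.
    integral-middle : ∀ {X Y Z} → IntegralMatrix X → IntegralMatrix Z → Y ≃ᴹ adj X · (T-of t · adj Z) → IntegralMatrix Y
    integral-middle iX iZ h = integral-≃ᴹ h (integral-· (integral-adj iX) (integral-· integral-T (integral-adj iZ)))

  left-vertex : ∀ {X Y Z Y′} → Vertex X Y Z → Y′ ≃ᴹ adj X · (T-of t · adj Y) → Vertex X Y′ Y
  left-vertex {X} {Y} {Z} {Y′} V h = record
    { first = first V
    ; middle = record
      { det≋1 = LM.det-middle {X} {Y′} {Y} {t} dX dY h
      ; trace≋-k = ≋-trans (LM.trace-cong {Y′} {Y · Z · adj Y} Y′≃) (≋-trans (LM.trace-conj Y Z)
          (≋-trans (⊗-cong dY (trace≋-k (last V))) (≡⇒≋ (⊗-identityˡ (⊝ kᵢ (l V))))))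
      ; integrals = integral-middle {X} {Y′} {Y} (integrals (first V)) (integrals (middle V)) h }
    ; last = middle V
    ; product = LM.middle-triple {X} {Y′} {Y} {t} dX dY h
    ; cluster = mutate-last (cluster V) (≋-trans (⊗-congʳ (ent₁₂ Z) (LM.ent₁₂-cong {Y′} {Y · Z · adj Y} Y′≃))
        (≋-trans (LM.exchange Y Z (kᵢ (l V)) (det≋1 (last V)) (trace≋-k (last V)))
          (⊕-cong (⊕-cong (⊗-cong x≋ x≋) (⊗-cong (⊗-congʳ (kᵢ (l V)) x≋) ≋-refl)) ≋-refl))) }
    where
    dX = det≋1 (first V)
    dY = det≋1 (middle V)
    Y′≃ : Y′ ≃ᴹ Y · Z · adj Y
    Y′≃ = LM.left-child {X} {Y} {Z} {t} {Y′} dX (product V) h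
    x≋ : ent₁₂ (Y · Z) ≋ ent₁₂ X
    x≋ = LM.ent₁₂-first {X} {Y} {Z} {t} dX (product V)

  right-vertex : ∀ {X Y Z Y′} → Vertex X Y Z → Y′ ≃ᴹ adj Y · (T-of t · adj Z) → Vertex Y Y′ Z
  right-vertex {X} {Y} {Z} {Y′} V h = record
    { first = middle V
    ; middle = record
      { det≋1 = LM.det-middle {Y} {Y′} {Z} {t} dY dZ h
      ; trace≋-k = ≋-trans (LM.trace-cong {Y′} {adj Y · X · Y} Y′≃) (≋-trans (LM.trace-conj′ X Y)
          (≋-trans (⊗-cong dY (trace≋-k (first V))) (≡⇒≋ (⊗-identityˡ (⊝ kᵢ (i V))))))
      ; integrals = integral-middle {Y} {Y′} {Z} (integrals (middle V)) (integrals (last V)) h }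
    ; last = last V
    ; product = LM.middle-triple {Y} {Y′} {Z} {t} dY dZ h
    ; cluster = mutate-first (cluster V) (≋-trans (⊗-congʳ (ent₁₂ X) (LM.ent₁₂-cong {Y′} {adj Y · X · Y} Y′≃))
        (≋-trans (LM.exchange′ X Y (kᵢ (i V)) (det≋1 (first V)) (trace≋-k (first V)))
          (⊕-cong (⊕-cong ≋-refl (⊗-congʳ (kᵢ (i V) ⊗ ent₁₂ Y) z≋)) (⊗-cong z≋ z≋)))) }
    where
    dY = det≋1 (middle V)
    dZ = det≋1 (last V)
    Y′≃ : Y′ ≃ᴹ adj Y · X · Y
    Y′≃ = LM.right-child {X} {Y} {Z} {t} {Y′} dZ (product V) h
    z≋ : ent₁₂ (X · Y) ≋ ent₁₂ Z
    z≋ = LM.ent₁₂-last {X} {Y} {Z} {t} dZ (product V)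

  private
    bezout-left : ∀ a b e f → e ℕ.* b ≡ 1 ℕ.+ a ℕ.* f → (a ℕ.+ e) ℕ.* b ≡ 1 ℕ.+ a ℕ.* (b ℕ.+ f)
    bezout-left a b e f bez = begin
      (a ℕ.+ e) ℕ.* b            ≡⟨ ℕP.*-distribʳ-+ b a e ⟩
      a ℕ.* b ℕ.+ e ℕ.* b        ≡⟨ cong (a ℕ.* b ℕ.+_) bez ⟩
      a ℕ.* b ℕ.+ (1 ℕ.+ a ℕ.* f) ≡⟨ solveℕ (a ∷ b ∷ f ∷ []) ⟩
      1 ℕ.+ a ℕ.* (b ℕ.+ f) ∎
      where open ≡-Reasoning

    bezout-right : ∀ a b e f → e ℕ.* b ≡ 1 ℕ.+ a ℕ.* f → e ℕ.* (b ℕ.+ f) ≡ 1 ℕ.+ (a ℕ.+ e) ℕ.* f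
    bezout-right a b e f bez = begin
      e ℕ.* (b ℕ.+ f)            ≡⟨ ℕP.*-distribˡ-+ e b f ⟩
      e ℕ.* b ℕ.+ e ℕ.* f        ≡⟨ cong (ℕ._+ e ℕ.* f) bez ⟩
      1 ℕ.+ a ℕ.* f ℕ.+ e ℕ.* f  ≡⟨ solveℕ (a ∷ e ∷ f ∷ []) ⟩
      1 ℕ.+ (a ℕ.+ e) ℕ.* f ∎
      where open ≡-Reasoning

  mediant : ∀ p q r s → r ℕ.* q ≡ 1 ℕ.+ p ℕ.* s → Mat′ (p ℕ.+ r) (q ℕ.+ s) ≃ᴹ adj (Mat′ p q) · (T-of t · adj (Mat′ r s))
  mediant p q r s bez = ≃ᴹ-trans
    -- The mediant is itself a right neighbour of p/q, and this gives its own representation.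
    (M-concat k₁ k₂ k₃ p q r s bez (proj₁ reps) (proj₂ reps) (proj₂ (farey-represented k₁ k₂ k₃ p q (p ℕ.+ r) (q ℕ.+ s) (bezout-left p q r s bez))))
    (·-cong {adj (Mat′ p q)} {adj (Mat′ p q)} {T k₁ k₂ k₃ · adj (Mat′ r s)} {T-of t · adj (Mat′ r s)} ≃ᴹ-refl
      (·-cong {T k₁ k₂ k₃} {T-of t} {adj (Mat′ r s)} {adj (Mat′ r s)} (entries ≋-refl (≋-sym (term-0 0ᵉ)) ≋-refl ≋-refl) ≃ᴹ-refl))
    where reps = farey-represented k₁ k₂ k₃ p q r s bez

  unimodular₀₁ : Unimodular ③' (Mat′ 0 1)
  unimodular₀₁ = record
    { det≋1 = ≋-trans (LM.det-cong {Mat′ 0 1} {X} (represented₀₁ k₁ k₂ k₃)) (F.det-fromΩ₀₁ k₁ k₂ k₃ s ≋-refl)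
    ; trace≋-k = ≋-trans (LM.trace-cong {Mat′ 0 1} {X} (represented₀₁ k₁ k₂ k₃)) (F.trace-fromΩ₀₁ k₁ k₂ k₃ s ≋-refl)
    ; integrals = integralMatrix (integral-term (+ 1) (+ 1 , -[1+ 0 ] , + 0)) (integral-term (+ 1) (+ 0 , + 0 , + 1))
        (integral-⊝ (integral-⊗ (integral-term (+ 1) (+ 2 , -[1+ 1 ] , -[1+ 0 ])) (integral-⊕ (integral-⊕ (integral-term (+ 1) 0ᵉ)
          (integral-⊗ (integral-term (+ k₃) 0ᵉ) (integral-term (+ 1) (-[1+ 0 ] , + 1 , + 0)))) (integral-term (+ 1) (-[1+ 1 ] , + 2 , + 0)))))
        (integral-⊕ (integral-⊝ (integral-term (+ 1) (+ 1 , -[1+ 0 ] , + 0))) (integral-⊝ (integral-term (+ k₃) 0ᵉ))) }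
    where
    s = scale k₁ k₂ k₃ 0 1
    X = F.fromΩ k₁ k₂ k₃ s (T.Ω₀₁ k₁ k₂ k₃)

  unimodular₁₀ : Unimodular ②' (Mat′ 1 0)
  unimodular₁₀ = record
    { det≋1 = ≋-trans (LM.det-cong {Mat′ 1 0} {X} (represented₁₀ k₁ k₂ k₃)) (F.det-fromΩ₁₀ k₁ k₂ k₃)
    ; trace≋-k = ≋-trans (LM.trace-cong {Mat′ 1 0} {X} (represented₁₀ k₁ k₂ k₃)) (F.trace-fromΩ₁₀ k₁ k₂ k₃)
    ; integrals = integralMatrix (integral-⊝ (integral-term (+ k₂) 0ᵉ)) (integral-term (+ 1) (+ 0 , + 1 , + 0))
        (integral-⊝ (integral-term (+ 1) (+ 0 , -[1+ 0 ] , + 0))) (integral-≋ (≋-sym (term-0 0ᵉ)) (integral-term (+ 0) 0ᵉ)) }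
    where
    X = F.fromΩ k₁ k₂ k₃ (scale k₁ k₂ k₃ 1 0) (T.Ω₁₀ k₁ k₂ k₃)

  root-vertex : Vertex (Mat′ 0 1) (Mat′ 1 1) (Mat′ 1 0)
  root-vertex = record
    { first = unimodular₀₁
    ; middle = record
      { det≋1 = LM.det-middle {X} {Y} {Z} {t} (det≋1 unimodular₀₁) (det≋1 unimodular₁₀) h
      ; trace≋-k = ≋-trans (LM.trace-cong {Y} {W} Y≃W) (F.trace-fromΩ₁₁ k₁ k₂ k₃ s ≋-refl)
      ; integrals = integral-middle {X} {Y} {Z} (integrals unimodular₀₁) (integrals unimodular₁₀) h }
    ; last = unimodular₁₀
    ; product = LM.middle-triple {X} {Y} {Z} {t} (det≋1 unimodular₀₁) (det≋1 unimodular₁₀) h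
    -- The upper right entries at the root are x₃, the mutation of x₁, and x₂, in the positions 3,
    -- 1, 2.
    ; cluster = at₃₁₂ (μ₁ initial (≋⇒≈ (≋-trans (⊗-congʳ x₁ (LM.ent₁₂-cong {Y} {W} Y≃W)) (≋-trans (F.ent₁₂-fromΩ₁₁ k₁ k₂ k₃ s x₁)
        (⊕-cong (⊕-cong (≋-refl {x₂ ⊗ x₂}) (≡⇒≋ (sym (⊗-assoc (kᵢ ①') x₂ x₃)))) (≋-refl {x₃ ⊗ x₃})))))) }
    where
    X = Mat′ 0 1
    Y = Mat′ 1 1
    Z = Mat′ 1 0
    h = mediant 0 1 1 0 refl
    s = scale k₁ k₂ k₃ 1 1
    -- The line to (1 , 1) crosses a single diagonal at its midpoint, and the tie gives the bit
    -- `false`.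
    W = F.fromΩ k₁ k₂ k₃ s (T.GD k₁ k₂ k₃ false)
    Y≃W : Y ≃ᴹ W
    Y≃W = proj₂ (farey-represented k₁ k₂ k₃ 0 1 1 1 refl)

  -- The indices of `FareyVertex` treat the middle fraction as independent; that it is the mediant,
  -- and that the outer fractions satisfy the Bezout relation, is recovered by induction.
  record Invariant (a b c d e f : ℕ) : Set where
    constructor invariant
    field
      numerator   : c ≡ a ℕ.+ e
      denominator : d ≡ b ℕ.+ f
      bezout      : e ℕ.* b ≡ 1 ℕ.+ a ℕ.* f
      vertex      : Vertex (Mat′ a b) (Mat′ c d) (Mat′ e f)

  farey-vertex : ∀ {a b c d e f} → FareyVertex a b c d e f → Invariant a b c d e f
  farey-vertex root = invariant refl refl refl root-vertex
  farey-vertex (left {a} {b} {c} {d} {e} {f} V) with farey-vertex V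
  ... | invariant refl refl bez v = invariant refl refl bez′ (left-vertex v (mediant a b (a ℕ.+ e) (b ℕ.+ f) bez′))
    where bez′ = bezout-left a b e f bez
  farey-vertex (right {a} {b} {c} {d} {e} {f} V) with farey-vertex V
  ... | invariant refl refl bez v = invariant refl refl bez′ (right-vertex v (mediant (a ℕ.+ e) (b ℕ.+ f) e f bez′))
    where bez′ = bezout-right a b e f bez

  -- Descent in the tree: the coefficients of (p , q) in the basis of the outer fractions decrease.
  descend : ∀ n i j {a b e f} → i ℕ.+ j ℕ.≤ n → 0 ℕ.< i → 0 ℕ.< j → FareyVertex a b (a ℕ.+ e) (b ℕ.+ f) e f →
    Coprime (a ℕ.* i ℕ.+ e ℕ.* j) (b ℕ.* i ℕ.+ f ℕ.* j) → CMM k₁ k₂ k₃ (Mat′ (a ℕ.* i ℕ.+ e ℕ.* j) (b ℕ.* i ℕ.+ f ℕ.* j))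
  descend zero (suc i) j () _ _ _ _
  descend (suc n) i j {a} {b} {e} {f} bound i>0 j>0 V cop with ℕP.<-cmp i j
  -- Now i divides numerator and denominator, so i = 1 and the fraction is the middle one of this
  -- vertex.
  ... | tri≈ _ refl _ = subst₂ (λ p q → CMM k₁ k₂ k₃ (Mat′ p q)) (at-one a e) (at-one b f)
          (proj₁ (proj₂ (vertex⇒triple (Invariant.vertex (farey-vertex V)))))
    where
    i≡1 : i ≡ 1
    i≡1 = cop (∣m∣n⇒∣m+n (∣n⇒∣m*n a (divides 1 (sym (ℕP.*-identityˡ i)))) (∣n⇒∣m*n e (divides 1 (sym (ℕP.*-identityˡ i)))) ,
               ∣m∣n⇒∣m+n (∣n⇒∣m*n b (divides 1 (sym (ℕP.*-identityˡ i)))) (∣n⇒∣m*n f (divides 1 (sym (ℕP.*-identityˡ i)))))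
    at-one : ∀ a e → a ℕ.+ e ≡ a ℕ.* i ℕ.+ e ℕ.* i
    at-one a e = sym (trans (cong (λ z → a ℕ.* z ℕ.+ e ℕ.* z) i≡1) (cong₂ ℕ._+_ (ℕP.*-identityʳ a) (ℕP.*-identityʳ e)))
  -- The fraction lies between the mediant and e/f, since a i + e j = (a + e) i + e (j - i).
  ... | tri< i<j _ _ = subst₂ (λ p q → CMM k₁ k₂ k₃ (Mat′ p q)) (regroup a e) (regroup b f)
          (descend n i δ bound′ i>0 (ℕP.m<n⇒0<n∸m i<j) (right V) (subst₂ Coprime (sym (regroup a e)) (sym (regroup b f)) cop))
    where
    δ = j ℕ.∸ i
    j≡ : i ℕ.+ δ ≡ j
    j≡ = ℕP.m+[n∸m]≡n (ℕP.<⇒≤ i<j)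
    regroup : ∀ a e → (a ℕ.+ e) ℕ.* i ℕ.+ e ℕ.* δ ≡ a ℕ.* i ℕ.+ e ℕ.* j
    regroup a e = trans (lem a e i δ) (cong (λ z → a ℕ.* i ℕ.+ e ℕ.* z) j≡)
      where
      lem : ∀ a e i δ → (a ℕ.+ e) ℕ.* i ℕ.+ e ℕ.* δ ≡ a ℕ.* i ℕ.+ e ℕ.* (i ℕ.+ δ)
      lem a e i δ = solveℕ (a ∷ e ∷ i ∷ δ ∷ [])
    bound′ : i ℕ.+ δ ℕ.≤ n
    bound′ = subst (ℕ._≤ n) (sym j≡) (ℕ.s≤s⁻¹ (ℕP.≤-trans (ℕP.+-monoˡ-≤ j i>0) bound))
  ... | tri> _ _ j<i = subst₂ (λ p q → CMM k₁ k₂ k₃ (Mat′ p q)) (regroup a e) (regroup b f)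
          (descend n δ j bound′ (ℕP.m<n⇒0<n∸m j<i) j>0 (left V) (subst₂ Coprime (sym (regroup a e)) (sym (regroup b f)) cop))
    where
    δ = i ℕ.∸ j
    i≡ : δ ℕ.+ j ≡ i
    i≡ = ℕP.m∸n+n≡m (ℕP.<⇒≤ j<i)
    regroup : ∀ a e → a ℕ.* δ ℕ.+ (a ℕ.+ e) ℕ.* j ≡ a ℕ.* i ℕ.+ e ℕ.* j
    regroup a e = trans (lem a e j δ) (cong (λ z → a ℕ.* z ℕ.+ e ℕ.* j) i≡)
      where
      lem : ∀ a e j δ → a ℕ.* δ ℕ.+ (a ℕ.+ e) ℕ.* j ≡ a ℕ.* (δ ℕ.+ j) ℕ.+ e ℕ.* j
      lem a e j δ = solveℕ (a ∷ e ∷ j ∷ δ ∷ [])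
    bound′ : δ ℕ.+ j ℕ.≤ n
    bound′ = subst (ℕ._≤ n) (sym i≡) (ℕ.s≤s⁻¹ (ℕP.≤-trans (ℕP.≤-trans (ℕP.≤-reflexive (ℕP.+-comm 1 i)) (ℕP.+-monoʳ-≤ i j>0)) bound))

  coprime⇒CMM : ∀ p q → Coprime p q → CMM k₁ k₂ k₃ (Mat′ p q)
  coprime⇒CMM zero zero cop = proj₁ (proj₂ (proj₂ (vertex⇒triple root-vertex)))
  coprime⇒CMM (suc p) zero cop = proj₁ (proj₂ (proj₂ (vertex⇒triple root-vertex)))
  coprime⇒CMM zero (suc q) cop = proj₁ (vertex⇒triple root-vertex)
  coprime⇒CMM (suc p) (suc q) cop = subst₂ (λ p q → CMM k₁ k₂ k₃ (Mat′ p q)) p≡ q≡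
    -- In the basis given by the outer fractions 0/1 and 1/0 of the root, p/q has its denominator
    -- and its numerator as coefficients.
    (descend (suc q ℕ.+ suc p) (suc q) (suc p) ℕP.≤-refl (s≤s z≤n) (s≤s z≤n) root (subst₂ Coprime (sym p≡) (sym q≡) cop))
    where
    p≡ : 0 ℕ.* suc q ℕ.+ 1 ℕ.* suc p ≡ suc p
    p≡ = ℕP.*-identityˡ (suc p)
    q≡ : 1 ℕ.* suc q ℕ.+ 0 ℕ.* suc p ≡ suc q
    q≡ = trans (ℕP.+-identityʳ (1 ℕ.* suc q)) (ℕP.*-identityˡ (suc q))

theorem10p1 : (k₁ k₂ k₃ : ℕ) →
    ((p q : ℕ) → Coprime p q → CMM k₁ k₂ k₃ (M k₁ k₂ k₃ p q)) ×
    ((p q r s : ℕ) → FareyVertex p q (p Data.Nat.+ r) (q Data.Nat.+ s) r s →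
    CMMTriple k₁ k₂ k₃ (M k₁ k₂ k₃ p q) (M k₁ k₂ k₃ (p Data.Nat.+ r) (q Data.Nat.+ s)) (M k₁ k₂ k₃ r s))
theorem10p1 k₁ k₂ k₃ = coprime⇒CMM k₁ k₂ k₃ , λ p q r s V → vertex⇒triple k₁ k₂ k₃ (Invariant.vertex (farey-vertex k₁ k₂ k₃ V))
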